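{- Let $d, k, r$ be positive integers with $k < d$ and $r \ge k+2$. Then, as $n \to \infty$, $f_{\mathrm{aff}}(n,d,k,r) = \Omega(f_{d,k,r}(n))$, where $$f_{d,k,r}(n) = \begin{cases} n^{d(1-k/(r-1))}, & \text{if } r \le d,\\ n^{d-k}/(\log n)^{1/d}, & \text{if } r = d+1,\\ n^{d-k}, & \text{otherwise.}\end{cases}$$ In particular, if $r = k+2$, then $f_{\mathrm{aff}}(n,d,k,k+2) = \Omega(f_{d,k}(n))$, where $$f_{d,k}(n) = \begin{cases} n/(\log n)^{1/d}, & \text{if } k = d-1,\\ n^{d/(k+1)}, & \text{otherwise.}\end{cases}$$
   Context: $[n] = \{1,\dots,n\}$. For positive integers $n,d,k,r$ with $k<d$ and $r\ge k+2$, $f_{\mathrm{aff}}(n,d,k,r)$ is the maximum size of a subset of $[n]^d \subset \mathbb{R}^d$ such that no $r$ (distinct) points of the subset lie on a common $k$-dimensional affine subspace of $\mathbb{R}^d$. Here $d,k,r$ are fixed and $n\to\infty$; implied constants may depend on $d,k,r$. -}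

module Defs where

open import Algebra.Bundles using (CommutativeRing)
open import Algebra.Definitions.RawMonoid using (sum)
open import Algebra.Definitions.RawSemiring using () renaming (_^_ to pow)
open import Data.Bool.Base using (if_then_else_)
open import Data.Fin.Base using (Fin; toℕ)
open import Data.Integer.Base using (+_; -[1+_])
open import Data.List.Base using (List; length)
open import Data.List.Membership.Propositional using (_∈_)
open import Data.List.Relation.Unary.Unique.Propositional using (Unique)
open import Data.Nat.Base as ℕ using (ℕ; zero; suc; _∸_; _≤ᵇ_; _≡ᵇ_)
import Data.Nat.Properties as ℕₚ
open import Data.Product.Base using (Σ; ∃-syntax; _×_; _,_; proj₁; proj₂)
open import Data.Rational.Base as ℚ
  using (ℚ; mkℚ; 0ℚ; 1ℚ; ½; _+_; _*_; -_; _-_; _≤_; _<_; ∣_∣; _/_; 1/_; Positive)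
open import Data.Rational.Properties
open import Data.Rational.Solver using (module +-*-Solver)
open import Data.Vec.Base using (Vec; lookup)
open import Data.Vec.Functional using (Vector)
open import Function.Definitions using (Injective)
open import Level using (0ℓ)
open import Relation.Binary.PropositionalEquality
  using (_≡_; refl; sym; trans; cong; subst)
open import Relation.Nullary.Negation using (¬_)

open +-*-Solver using (solve; _:+_; _:*_; :-_; _:=_)

------------------------------------------------------------------------
-- The real numbers: Cauchy sequences of rationals, with pointwise
-- operations, modulo sequences tending to 0.

Null : (ℕ → ℚ) → Set
Null s = ∀ ε → .{{Positive ε}} → ∃[ N ] ∀ n → N ℕ.≤ n → ∣ s n ∣ < ε

record ℝ : Set where
  field
    seq    : ℕ → ℚ
    cauchy : ∀ ε → .{{Positive ε}} →
             ∃[ N ] ∀ m n → N ℕ.≤ m → N ℕ.≤ n → ∣ seq m - seq n ∣ < ε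

open ℝ public

infix 4 _≈ᴿ_

_≈ᴿ_ : ℝ → ℝ → Set
x ≈ᴿ y = Null (λ n → seq x n - seq y n)

private

  half-sum : ∀ ε → ½ * ε + ½ * ε ≡ ε
  half-sum ε = trans (sym (*-distribʳ-+ ε ½ ½)) (*-identityˡ ε)

  half-pos : ∀ ε → .{{Positive ε}} → Positive (½ * ε)
  half-pos ε = pos*pos⇒pos ½ ε

  ∣0∣< : ∀ s ε → .{{Positive ε}} → s ≡ 0ℚ → ∣ s ∣ < ε
  ∣0∣< _ ε refl = positive⁻¹ ε

  ∣-∣≡ : ∀ s t → - s ≡ t → ∣ s ∣ ≡ ∣ t ∣
  ∣-∣≡ s _ refl = sym (∣-p∣≡∣p∣ s)

  sum-diff : ∀ a b c d → (a - c) + (b - d) ≡ (a + b) - (c + d)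
  sum-diff = solve 4 (λ a b c d →
    (a :+ :- c) :+ (b :+ :- d) := (a :+ b) :+ :- (c :+ d)) refl

  prod-diff : ∀ a b c d → a * (b - d) + d * (a - c) ≡ a * b - c * d
  prod-diff = solve 4 (λ a b c d →
    a :* (b :+ :- d) :+ d :* (a :+ :- c) := a :* b :+ :- (c :* d)) refl

  neg-diff : ∀ a b → - (a - b) ≡ - a - (- b)
  neg-diff = solve 2 (λ a b → :- (a :+ :- b) := :- a :+ :- (:- b)) refl

  swap-diff : ∀ a b → - (a - b) ≡ b - a
  swap-diff = solve 2 (λ a b → :- (a :+ :- b) := b :+ :- a) refl

  tel-diff : ∀ a b c → (a - b) + (b - c) ≡ a - c
  tel-diff = solve 3 (λ a b c → (a :+ :- b) :+ (b :+ :- c) := a :+ :- c) refl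

  add-back : ∀ a b → (a - b) + b ≡ a
  add-back = solve 2 (λ a b → (a :+ :- b) :+ b := a) refl

  neg-close : ∀ s t ε → - s ≡ t → ∣ s ∣ < ε → ∣ t ∣ < ε
  neg-close s t ε eq s<ε = subst (_< ε) (∣-∣≡ s t eq) s<ε

  sum-close : ∀ a b s ε → a + b ≡ s → ∣ a ∣ < ½ * ε → ∣ b ∣ < ½ * ε → ∣ s ∣ < ε
  sum-close a b _ ε refl a<ε b<ε = subst (∣ a + b ∣ <_) (half-sum ε)
    (≤-<-trans {∣ a + b ∣} {∣ a ∣ + ∣ b ∣} {½ * ε + ½ * ε}
      (∣p+q∣≤∣p∣+∣q∣ a b) (+-mono-< {∣ a ∣} {½ * ε} {∣ b ∣} {½ * ε} a<ε b<ε))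

  ∣*∣< : ∀ a b B β → ∣ a ∣ < B → ∣ b ∣ < β → ∣ a * b ∣ < B * β
  ∣*∣< a b B β a<B b<β =
    subst (_< B * β) (sym (∣p*q∣≡∣p∣*∣q∣ a b))
      (≤-<-trans {∣ a ∣ * ∣ b ∣} {B * ∣ b ∣} {B * β}
        (*-monoʳ-≤-nonNeg ∣ b ∣ {{∣-∣-nonNeg b}} {∣ a ∣} {B} (<⇒≤ {∣ a ∣} {B} a<B))
        (*-monoʳ-<-pos B {{ℚ.positive {B} (≤-<-trans {0ℚ} {∣ a ∣} {B} (0≤∣p∣ a) a<B)}}
          {∣ b ∣} {β} b<β))

  prod-close : ∀ a b c d B δ ε → B * δ ≡ ½ * ε →
    ∣ a ∣ < B → ∣ d ∣ < B → ∣ b - d ∣ < δ → ∣ a - c ∣ < δ → ∣ a * b - c * d ∣ < ε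
  prod-close a b c d B δ ε eq a<B d<B bd ac =
    sum-close (a * (b - d)) (d * (a - c)) (a * b - c * d) ε (prod-diff a b c d)
      (subst (∣ a * (b - d) ∣ <_) eq (∣*∣< a (b - d) B δ a<B bd))
      (subst (∣ d * (a - c) ∣ <_) eq (∣*∣< d (a - c) B δ d<B ac))

  EventuallyBounded : ℝ → ℝ → ℚ → Set
  EventuallyBounded x y B =
    ∃[ N ] ∀ n → N ℕ.≤ n → ∣ seq x n ∣ < B × ∣ seq y n ∣ < B

  tail-bound : ∀ a b → ∣ a - b ∣ < 1ℚ → ∣ a ∣ < 1ℚ + ∣ b ∣
  tail-bound a b a-b<1 = subst (λ t → ∣ t ∣ < 1ℚ + ∣ b ∣) (add-back a b)
    (≤-<-trans {∣ (a - b) + b ∣} {∣ a - b ∣ + ∣ b ∣} {1ℚ + ∣ b ∣}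
      (∣p+q∣≤∣p∣+∣q∣ (a - b) b) (+-monoˡ-< ∣ b ∣ {∣ a - b ∣} {1ℚ} a-b<1))

  ≤-+ʳ : ∀ a b → Positive b → a ≤ a + b
  ≤-+ʳ a b b>0 = subst (_≤ a + b) (+-identityʳ a)
    (+-monoʳ-≤ a {0ℚ} {b} (<⇒≤ {0ℚ} {b} (positive⁻¹ b {{b>0}})))

  bounded : ∀ x y → Σ ℚ λ B → Positive B × EventuallyBounded x y B
  bounded x y with cauchy x 1ℚ | cauchy y 1ℚ
  ... | Nx , cx | Ny , cy = Cx + Cy , pos+pos⇒pos Cx {{Cx>0}} Cy {{Cy>0}} , Nx ℕ.⊔ Ny ,
    λ n N≤n →
      <-≤-trans {∣ seq x n ∣} {Cx} {Cx + Cy}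
        (tail-bound (seq x n) (seq x Nx) (cx n Nx (ℕₚ.m⊔n≤o⇒m≤o Nx Ny N≤n) ℕₚ.≤-refl))
        (≤-+ʳ Cx Cy Cy>0)
    , <-≤-trans {∣ seq y n ∣} {Cy} {Cx + Cy}
        (tail-bound (seq y n) (seq y Ny) (cy n Ny (ℕₚ.m⊔n≤o⇒n≤o Nx Ny N≤n) ℕₚ.≤-refl))
        (subst (Cy ≤_) (+-comm Cy Cx) (≤-+ʳ Cy Cx Cx>0))
    where
    Cx = 1ℚ + ∣ seq x Nx ∣
    Cy = 1ℚ + ∣ seq y Ny ∣
    Cx>0 : Positive Cx
    Cx>0 = pos+nonNeg⇒pos 1ℚ ∣ seq x Nx ∣ {{∣-∣-nonNeg (seq x Nx)}}
    Cy>0 : Positive Cy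
    Cy>0 = pos+nonNeg⇒pos 1ℚ ∣ seq y Ny ∣ {{∣-∣-nonNeg (seq y Ny)}}

  scale : ∀ B → Positive B → ∀ ε → .{{Positive ε}} → Σ ℚ λ δ → Positive δ × B * δ ≡ ½ * ε
  scale B B>0 ε = δ , δ>0 , Bδ
    where
    instance
      _ = B>0
      _ = pos⇒nonZero B
    δ = 1/ B * (½ * ε)
    δ>0 : Positive δ
    δ>0 = pos*pos⇒pos (1/ B) {{1/pos⇒pos B}} (½ * ε) {{half-pos ε}}
    Bδ : B * δ ≡ ½ * ε
    Bδ = trans (sym (*-assoc B (1/ B) (½ * ε)))
           (trans (cong (_* (½ * ε)) (*-inverseʳ B)) (*-identityˡ (½ * ε)))

infixl 6 _+ᴿ_
infixl 7 _*ᴿ_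
infix  8 -ᴿ_

_+ᴿ_ : ℝ → ℝ → ℝ
seq    (x +ᴿ y) n = seq x n + seq y n
cauchy (x +ᴿ y) ε =
  let Nx , cx = cauchy x (½ * ε) {{half-pos ε}}
      Ny , cy = cauchy y (½ * ε) {{half-pos ε}}
  in Nx ℕ.⊔ Ny , λ m n N≤m N≤n →
  sum-close (seq x m - seq x n) (seq y m - seq y n) ((seq x m + seq y m) - (seq x n + seq y n)) ε
    (sum-diff (seq x m) (seq y m) (seq x n) (seq y n))
    (cx m n (ℕₚ.m⊔n≤o⇒m≤o Nx Ny N≤m) (ℕₚ.m⊔n≤o⇒m≤o Nx Ny N≤n))
    (cy m n (ℕₚ.m⊔n≤o⇒n≤o Nx Ny N≤m) (ℕₚ.m⊔n≤o⇒n≤o Nx Ny N≤n))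

-ᴿ_ : ℝ → ℝ
seq    (-ᴿ x) n = - seq x n
cauchy (-ᴿ x) ε = proj₁ (cauchy x ε) , λ m n N≤m N≤n →
  neg-close (seq x m - seq x n) (- seq x m - (- seq x n)) ε
    (neg-diff (seq x m) (seq x n)) (proj₂ (cauchy x ε) m n N≤m N≤n)

_*ᴿ_ : ℝ → ℝ → ℝ
seq    (x *ᴿ y) n = seq x n * seq y n
cauchy (x *ᴿ y) ε =
  let B , B>0 , N₀ , bd = bounded x y
      δ , δ>0 , eq = scale B B>0 ε
      Nx , cx = cauchy x δ {{δ>0}}
      Ny , cy = cauchy y δ {{δ>0}}
  in N₀ ℕ.⊔ (Nx ℕ.⊔ Ny) , λ m n N≤m N≤n →
  let m′ = ℕₚ.m⊔n≤o⇒n≤o N₀ (Nx ℕ.⊔ Ny) N≤m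
      n′ = ℕₚ.m⊔n≤o⇒n≤o N₀ (Nx ℕ.⊔ Ny) N≤n in
  prod-close (seq x m) (seq y m) (seq x n) (seq y n) B δ ε eq
    (proj₁ (bd m (ℕₚ.m⊔n≤o⇒m≤o N₀ (Nx ℕ.⊔ Ny) N≤m)))
    (proj₂ (bd n (ℕₚ.m⊔n≤o⇒m≤o N₀ (Nx ℕ.⊔ Ny) N≤n)))
    (cy m n (ℕₚ.m⊔n≤o⇒n≤o Nx Ny m′) (ℕₚ.m⊔n≤o⇒n≤o Nx Ny n′))
    (cx m n (ℕₚ.m⊔n≤o⇒m≤o Nx Ny m′) (ℕₚ.m⊔n≤o⇒m≤o Nx Ny n′))

fromℚ : ℚ → ℝ
seq    (fromℚ q) _ = q
cauchy (fromℚ q) ε = 0 , λ _ _ _ _ → ∣0∣< (q - q) ε (+-inverseʳ q)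

0ᴿ 1ᴿ : ℝ
0ᴿ = fromℚ 0ℚ
1ᴿ = fromℚ 1ℚ

≗⇒≈ᴿ : ∀ x y → (∀ n → seq x n ≡ seq y n) → x ≈ᴿ y
≗⇒≈ᴿ x y p ε = 0 , λ n _ → ∣0∣< (seq x n - seq y n) ε
  (trans (cong (_- seq y n) (p n)) (+-inverseʳ (seq y n)))

private

  ≈-sym : ∀ x y → x ≈ᴿ y → y ≈ᴿ x
  ≈-sym x y p ε = proj₁ (p ε) , λ n N≤n →
    neg-close (seq x n - seq y n) (seq y n - seq x n) ε
      (swap-diff (seq x n) (seq y n)) (proj₂ (p ε) n N≤n)

  ≈-trans : ∀ x y z → x ≈ᴿ y → y ≈ᴿ z → x ≈ᴿ z
  ≈-trans x y z p q ε =
    let Np , cp = p (½ * ε) {{half-pos ε}}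
        Nq , cq = q (½ * ε) {{half-pos ε}}
    in Np ℕ.⊔ Nq , λ n N≤n →
    sum-close (seq x n - seq y n) (seq y n - seq z n) (seq x n - seq z n) ε
      (tel-diff (seq x n) (seq y n) (seq z n))
      (cp n (ℕₚ.m⊔n≤o⇒m≤o Np Nq N≤n)) (cq n (ℕₚ.m⊔n≤o⇒n≤o Np Nq N≤n))

  +ᴿ-cong : ∀ x x′ y y′ → x ≈ᴿ x′ → y ≈ᴿ y′ → (x +ᴿ y) ≈ᴿ (x′ +ᴿ y′)
  +ᴿ-cong x x′ y y′ p q ε =
    let Np , cp = p (½ * ε) {{half-pos ε}}
        Nq , cq = q (½ * ε) {{half-pos ε}}
    in Np ℕ.⊔ Nq , λ n N≤n →
    sum-close (seq x n - seq x′ n) (seq y n - seq y′ n)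
      ((seq x n + seq y n) - (seq x′ n + seq y′ n)) ε
      (sum-diff (seq x n) (seq y n) (seq x′ n) (seq y′ n))
      (cp n (ℕₚ.m⊔n≤o⇒m≤o Np Nq N≤n)) (cq n (ℕₚ.m⊔n≤o⇒n≤o Np Nq N≤n))

  -ᴿ-cong : ∀ x y → x ≈ᴿ y → (-ᴿ x) ≈ᴿ (-ᴿ y)
  -ᴿ-cong x y p ε = proj₁ (p ε) , λ n N≤n →
    neg-close (seq x n - seq y n) (- seq x n - (- seq y n)) ε
      (neg-diff (seq x n) (seq y n)) (proj₂ (p ε) n N≤n)

  *ᴿ-cong : ∀ x x′ y y′ → x ≈ᴿ x′ → y ≈ᴿ y′ → (x *ᴿ y) ≈ᴿ (x′ *ᴿ y′)
  *ᴿ-cong x x′ y y′ p q ε =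
    let B , B>0 , N₀ , bd = bounded x y′
        δ , δ>0 , eq = scale B B>0 ε
        Np , cp = p δ {{δ>0}}
        Nq , cq = q δ {{δ>0}}
    in N₀ ℕ.⊔ (Np ℕ.⊔ Nq) , λ n N≤n →
    let n′ = ℕₚ.m⊔n≤o⇒n≤o N₀ (Np ℕ.⊔ Nq) N≤n
        b  = bd n (ℕₚ.m⊔n≤o⇒m≤o N₀ (Np ℕ.⊔ Nq) N≤n) in
    prod-close (seq x n) (seq y n) (seq x′ n) (seq y′ n) B δ ε eq (proj₁ b) (proj₂ b)
      (cq n (ℕₚ.m⊔n≤o⇒n≤o Np Nq n′)) (cp n (ℕₚ.m⊔n≤o⇒m≤o Np Nq n′))

ℝ-commutativeRing : CommutativeRing 0ℓ 0ℓ
ℝ-commutativeRing = record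
  { Carrier = ℝ
  ; _≈_ = _≈ᴿ_
  ; _+_ = _+ᴿ_
  ; _*_ = _*ᴿ_
  ; -_  = -ᴿ_
  ; 0#  = 0ᴿ
  ; 1#  = 1ᴿ
  ; isCommutativeRing = record
    { isRing = record
      { +-isAbelianGroup = record
        { isGroup = record
          { isMonoid = record
            { isSemigroup = record
              { isMagma = record
                { isEquivalence = record
                  { refl  = λ {x} → ≗⇒≈ᴿ x x (λ _ → refl)
                  ; sym   = λ {x} {y} → ≈-sym x y
                  ; trans = λ {x} {y} {z} → ≈-trans x y z
                  }
                ; ∙-cong = λ {x} {x′} {y} {y′} → +ᴿ-cong x x′ y y′
                }
              ; assoc = λ x y z → ≗⇒≈ᴿ ((x +ᴿ y) +ᴿ z) (x +ᴿ (y +ᴿ z))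
                  (λ n → +-assoc (seq x n) (seq y n) (seq z n))
              }
            ; identity =
                (λ x → ≗⇒≈ᴿ (0ᴿ +ᴿ x) x (λ n → +-identityˡ (seq x n)))
              , (λ x → ≗⇒≈ᴿ (x +ᴿ 0ᴿ) x (λ n → +-identityʳ (seq x n)))
            }
          ; inverse =
              (λ x → ≗⇒≈ᴿ ((-ᴿ x) +ᴿ x) 0ᴿ (λ n → +-inverseˡ (seq x n)))
            , (λ x → ≗⇒≈ᴿ (x +ᴿ (-ᴿ x)) 0ᴿ (λ n → +-inverseʳ (seq x n)))
          ; ⁻¹-cong = λ {x} {y} → -ᴿ-cong x y
          }
        ; comm = λ x y → ≗⇒≈ᴿ (x +ᴿ y) (y +ᴿ x) (λ n → +-comm (seq x n) (seq y n))
        }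
      ; *-cong = λ {x} {x′} {y} {y′} → *ᴿ-cong x x′ y y′
      ; *-assoc = λ x y z → ≗⇒≈ᴿ ((x *ᴿ y) *ᴿ z) (x *ᴿ (y *ᴿ z))
          (λ n → *-assoc (seq x n) (seq y n) (seq z n))
      ; *-identity =
          (λ x → ≗⇒≈ᴿ (1ᴿ *ᴿ x) x (λ n → *-identityˡ (seq x n)))
        , (λ x → ≗⇒≈ᴿ (x *ᴿ 1ᴿ) x (λ n → *-identityʳ (seq x n)))
      ; distrib =
          (λ x y z → ≗⇒≈ᴿ (x *ᴿ (y +ᴿ z)) (x *ᴿ y +ᴿ x *ᴿ z)
            (λ n → *-distribˡ-+ (seq x n) (seq y n) (seq z n)))
        , (λ x y z → ≗⇒≈ᴿ ((y +ᴿ z) *ᴿ x) (y *ᴿ x +ᴿ z *ᴿ x)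
            (λ n → *-distribʳ-+ (seq x n) (seq y n) (seq z n)))
      }
    ; *-comm = λ x y → ≗⇒≈ᴿ (x *ᴿ y) (y *ᴿ x) (λ n → *-comm (seq x n) (seq y n))
    }
  }

------------------------------------------------------------------------
-- Affine subspaces of ℝ^d

∑ᴿ : ∀ {k} → Vector ℝ k → ℝ
∑ᴿ = sum (CommutativeRing.+-rawMonoid ℝ-commutativeRing)

combination : ∀ {k d} → Vector ℝ k → (Fin k → Vector ℝ d) → Vector ℝ d
combination t v j = ∑ᴿ (λ i → t i *ᴿ v i j)

LinearlyIndependent : ∀ {k d} → (Fin k → Vector ℝ d) → Set
LinearlyIndependent v =
  ∀ t → (∀ j → combination t v j ≈ᴿ 0ᴿ) → ∀ i → t i ≈ᴿ 0ᴿ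

-- The translate by `base` of the linear subspace with basis `direction`.
record AffineSubspace (k d : ℕ) : Set where
  field
    base        : Vector ℝ d
    direction   : Fin k → Vector ℝ d
    independent : LinearlyIndependent direction

infix 4 _liesOn_

_liesOn_ : ∀ {k d} → Vector ℝ d → AffineSubspace k d → Set
x liesOn A = ∃[ t ] ∀ j → x j ≈ᴿ (base j +ᴿ combination t direction j)
  where open AffineSubspace A

------------------------------------------------------------------------
-- The extremal function

fromℕ : ℕ → ℚ
fromℕ m = + m / 1

GridPoint : ℕ → ℕ → Set
GridPoint n d = Vec (Fin n) d

-- Fin n is {0,…,n-1}, so coordinates are shifted by one to land in [n].
toℝ^ : ∀ {n d} → GridPoint n d → Vector ℝ d
toℝ^ x j = fromℚ (fromℕ (suc (toℕ (lookup x j))))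

-- Finite subsets of [n]^d are duplicate-free lists of grid points.
NoRPointsOnCommonFlat : ∀ {n d} (k r : ℕ) → List (GridPoint n d) → Set
NoRPointsOnCommonFlat {n} {d} k r S =
  (p : Fin r → GridPoint n d) → Injective _≡_ _≡_ p → (∀ i → p i ∈ S) →
  ¬ (Σ (AffineSubspace k d) λ A → ∀ i → toℝ^ (p i) liesOn A)

AdmissibleSize : (n d k r m : ℕ) → Set
AdmissibleSize n d k r m =
  Σ (List (GridPoint n d)) λ S →
    Unique S × length S ≡ m × NoRPointsOnCommonFlat k r S

IsMaximum : (ℕ → Set) → ℕ → Set
IsMaximum P m = P m × (∀ m′ → P m′ → m′ ℕ.≤ m)

-- The graph of f_aff: the relation  f_aff(n,d,k,r) = m.  Sizes are bounded
-- by n^d, so the maximum exists classically; as a relation it needs no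
-- decision procedure for lying on a common real flat.
f-aff[_,_,_,_]≡_ : (n d k r m : ℕ) → Set
f-aff[ n , d , k , r ]≡ m = IsMaximum (AdmissibleSize n d k r) m

------------------------------------------------------------------------
-- Real-valued growth functions.  A non-negative, possibly infinite, real
-- number is given by its lower cut: the set of rationals q with
-- 0 ≤ q ≤ x.

Cut : Set₁
Cut = ℚ → Set

infixr 8 _^ℚ_

_^ℚ_ : ℚ → ℕ → ℚ
_^ℚ_ = pow ℚ.+-*-rawSemiring

⟦_⟧ : ℕ → Cut
⟦ m ⟧ q = 0ℚ ≤ q × q ≤ fromℕ m

-- n to a rational power:  q ≤ n^(a/b)  iff  q^b ≤ n^a.
infixr 8 _^ᶜ_

_^ᶜ_ : ℕ → ℚ → Cut
(n ^ᶜ mkℚ (+ a)    b-1 _) q = 0ℚ ≤ q × q ^ℚ suc b-1 ≤ fromℕ (n ℕ.^ a)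
(n ^ᶜ mkℚ -[1+ a ] b-1 _) q = 0ℚ ≤ q × q ^ℚ suc b-1 * fromℕ (n ℕ.^ suc a) ≤ 1ℚ

root : ℕ → Cut → Cut
root b x q = 0ℚ ≤ q × x (q ^ℚ b)

-- q ≤ log n  iff  exp q ≤ n, where for q ≥ 0 the increasing sequence
-- (1 + q/j)^j (j ≥ 1) has supremum exp q.  Intended for n ≥ 1.
log : ℕ → Cut
log n q = 0ℚ ≤ q × (∀ j → (1ℚ + q * (+ 1 / suc j)) ^ℚ suc j ≤ fromℕ n)

-- q ≤ m / x  iff  q * p ≤ m for all rationals 0 ≤ p ≤ x.
infixl 7 _÷ᶜ_

_÷ᶜ_ : ℕ → Cut → Cut
(m ÷ᶜ x) q = 0ℚ ≤ q × (∀ p → x p → q * p ≤ fromℕ m)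

-- Division of naturals in ℚ, with the convention a ÷ 0 = 0.
infixl 7 _÷_

_÷_ : ℕ → ℕ → ℚ
a ÷ zero  = 0ℚ
a ÷ suc b = + a / suc b

f⟨_,_,_⟩ : (d k r : ℕ) → ℕ → Cut
f⟨ d , k , r ⟩ n =
  if r ≤ᵇ d          then n ^ᶜ (fromℕ d * (1ℚ - k ÷ (r ∸ 1)))
  else if r ≡ᵇ suc d then (n ℕ.^ (d ∸ k)) ÷ᶜ root d (log n)
  else                 ⟦ n ℕ.^ (d ∸ k) ⟧

f⟨_,_⟩ : (d k : ℕ) → ℕ → Cut
f⟨ d , k ⟩ n =
  if k ≡ᵇ d ∸ 1 then n ÷ᶜ root d (log n)
  else             n ^ᶜ (d ÷ suc k)

-- F = Ω(g), for F given by its graph (F n m meaning F(n) = m) and g by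
-- lower cuts: for some c > 0, c g(n) ≤ F(n) for all sufficiently large n.
infix 4 _=Ω_

_=Ω_ : (ℕ → ℕ → Set) → (ℕ → Cut) → Set
F =Ω g = Σ ℚ λ c → Positive c × (∃[ N ] ∀ n m → N ℕ.≤ n → F n m →
           ∀ q → g n q → c * q ≤ fromℕ m)

{-# OPTIONS --safe #-}
-- Put s = r - 1.  The differences of r points of [n]^d on a common k-flat form an integer
-- d × s matrix with entries at most n which factors through ℝ^k.  A random subset of the grid,
-- with one point of every bad r-tuple deleted, has the required size as soon as the number of
-- these matrices is O(n^(k max(d,s))), with an extra factor log n when d = s.
--
-- To count them, reduce the lattice spanned by the columns: this writes the matrix as a sum of at
-- most k terms u vᵀ with ∥u∥ ∥v∥ = O(n).  Order the terms so that the first u is the shortest and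
-- reduce the others modulo it in a coordinate where it is largest.  Summing over dyadic scales
-- of the factor living in the smaller of the two dimensions, the other terms contribute O(n^max(d,s))
-- each because of the restricted coordinate, and the scale of the first term is a convergent
-- geometric sum when d ≠ s and a sum of O(log n) equal contributions when d = s.

module Submission where

-- The three regimes come from one computation. With C = `length codes` there are at most n^d C
-- forbidden r-tuples, and a set of density 1/q keeps n^d / (2q) points after deletion once 2C ≤
-- q^s. For C of order n^(k max(d,s)) this allows q of order n^(kd/s) when s < d and n^k when s > d;
-- when s = d the extra logarithm multiplies q by (log n)^(1/d).
--
-- The obstacle is that equality of these reals has no decision procedure, so ranks over ℝ cannot be
-- computed. A flat is therefore used only through rational approximations of the differences of its
-- points: reducedness of an integral system turns an approximate dependency into a contradiction as
-- soon as more than k generators are nonzero. A shortest system of generators is likewise obtained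
-- only classically. All of this takes place under double negation, at no cost, because the absence
-- of r points on a common flat is itself a negation. Counting and deletion are explicit: finite
-- lists, with conditional expectations in place of probability.

import Data.Product.Base as Product

-- The embedding of the integers into the rationals.

module Rationals where

 open import Data.Nat.Base as ℕ using (ℕ; zero; suc)
 import Data.Nat.Properties as ℕ
 open import Data.Integer.Base as ℤ using (ℤ; +_; -[1+_])
 import Data.Integer.Properties as ℤ
 open import Data.Rational.Base
 open import Data.Rational.Properties
 open import Data.Rational.Unnormalised.Base as ℚᵘ using (mkℚᵘ; *≡*; *≤*)
 import Data.Rational.Unnormalised.Properties as ℚᵘ
 open import Relation.Binary.PropositionalEquality

 ι : ℤ → ℚ
 ι z = z / 1

 toℚᵘ-ι : ∀ z → toℚᵘ (ι z) ℚᵘ.≃ mkℚᵘ z 0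
 toℚᵘ-ι z = toℚᵘ-fromℚᵘ (mkℚᵘ z 0)

 ι-+ : ∀ x y → ι (x ℤ.+ y) ≡ ι x + ι y
 ι-+ x y = toℚᵘ-injective (ℚᵘ.≃-trans (toℚᵘ-ι (x ℤ.+ y)) (ℚᵘ.≃-trans same
   (ℚᵘ.≃-sym (ℚᵘ.≃-trans (toℚᵘ-homo-+ (ι x) (ι y)) (ℚᵘ.+-cong (toℚᵘ-ι x) (toℚᵘ-ι y))))))
   where
   same : mkℚᵘ (x ℤ.+ y) 0 ℚᵘ.≃ mkℚᵘ x 0 ℚᵘ.+ mkℚᵘ y 0
   same = *≡* (cong (ℤ._* ℤ.1ℤ) (sym (cong₂ ℤ._+_ (ℤ.*-identityʳ x) (ℤ.*-identityʳ y))))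

 ι-* : ∀ x y → ι (x ℤ.* y) ≡ ι x * ι y
 ι-* x y = toℚᵘ-injective (ℚᵘ.≃-trans (toℚᵘ-ι (x ℤ.* y)) (ℚᵘ.≃-trans (*≡* refl)
   (ℚᵘ.≃-sym (ℚᵘ.≃-trans (toℚᵘ-homo-* (ι x) (ι y)) (ℚᵘ.*-cong (toℚᵘ-ι x) (toℚᵘ-ι y))))))

 ι-mono-≤ : ∀ {x y} → x ℤ.≤ y → ι x ≤ ι y
 ι-mono-≤ {x} {y} x≤y = toℚᵘ-cancel-≤ (ℚᵘ.≤-respˡ-≃ (ℚᵘ.≃-sym (toℚᵘ-ι x)) (ℚᵘ.≤-respʳ-≃ (ℚᵘ.≃-sym (toℚᵘ-ι y))
   (*≤* (ℤ.*-monoʳ-≤-nonNeg ℤ.1ℤ x≤y))))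

 ι-cancel-≤ : ∀ {x y} → ι x ≤ ι y → x ℤ.≤ y
 ι-cancel-≤ {x} {y} h with ℚᵘ.≤-respˡ-≃ (toℚᵘ-ι x) (ℚᵘ.≤-respʳ-≃ (toℚᵘ-ι y) (toℚᵘ-mono-≤ h))
 ... | *≤* p = subst₂ ℤ._≤_ (ℤ.*-identityʳ x) (ℤ.*-identityʳ y) p

 ι-∣∣ : ∀ z → ∣ ι z ∣ ≡ ι (+ ℤ.∣ z ∣)
 ι-∣∣ z = toℚᵘ-injective (ℚᵘ.≃-trans (toℚᵘ-homo-∣-∣ (ι z)) (ℚᵘ.≃-trans (ℚᵘ.∣-∣-cong (toℚᵘ-ι z)) (ℚᵘ.≃-sym (toℚᵘ-ι (+ ℤ.∣ z ∣)))))

 private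
   neg-neg : ∀ p → - (- p) ≡ p
   neg-neg (mkℚ (+ zero)    _ _) = refl
   neg-neg (mkℚ ℤ.+[1+ n ] _ _) = refl
   neg-neg (mkℚ -[1+ n ]    _ _) = refl

 ι-neg : ∀ z → ι (ℤ.- z) ≡ - ι z
 ι-neg (+ zero)  = refl
 ι-neg ℤ.+[1+ n ] = refl
 ι-neg -[1+ n ]  = sym (neg-neg (ι (+ suc n)))

 ↥≡p*↧ : ∀ p → ι (↥ p) ≡ p * ι (↧ p)
 ↥≡p*↧ p@record{} = toℚᵘ-injective (ℚᵘ.≃-trans (toℚᵘ-ι (↥ p)) (ℚᵘ.≃-trans (*≡* same)
   (ℚᵘ.≃-sym (ℚᵘ.≃-trans (toℚᵘ-homo-* p (ι (↧ p))) (ℚᵘ.*-congˡ {toℚᵘ p} (toℚᵘ-ι (↧ p)))))))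
   where
   same : ↥ p ℤ.* (+ suc (ℚ.denominator-1 p ℕ.* 1)) ≡ ↥ p ℤ.* ↧ p ℤ.* ℤ.1ℤ
   same = trans (cong (λ t → ↥ p ℤ.* + suc t) (ℕ.*-identityʳ (ℚ.denominator-1 p))) (sym (ℤ.*-identityʳ (↥ p ℤ.* ↧ p)))

 recip : ℕ → ℚ
 recip M = + 1 / suc M

 /-inverse : ∀ k M → (+ k / suc M) * ι (+ suc M) ≡ ι (+ k)
 /-inverse k M = toℚᵘ-injective (ℚᵘ.≃-trans (toℚᵘ-homo-* (+ k / suc M) (ι (+ suc M)))
   (ℚᵘ.≃-trans (ℚᵘ.*-cong (toℚᵘ-fromℚᵘ (mkℚᵘ (+ k) M)) (toℚᵘ-ι (+ suc M))) (ℚᵘ.≃-trans (*≡* same) (ℚᵘ.≃-sym (toℚᵘ-ι (+ k))))))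
   where
   same : + k ℤ.* + suc M ℤ.* + 1 ≡ + k ℤ.* + (suc M ℕ.* 1)
   same = trans (ℤ.*-assoc (+ k) (+ suc M) (+ 1)) (cong (+ k ℤ.*_) (sym (ℤ.pos-* (suc M) 1)))

 recip-inverse : ∀ M → recip M * ι (+ suc M) ≡ 1ℚ
 recip-inverse = /-inverse 1

 recip-pos : ∀ M → Positive (recip M)
 recip-pos M = normalize-pos 1 (suc M)

 ι-nonNeg : ∀ n → NonNegative (ι (+ n))
 ι-nonNeg n = normalize-nonNeg n 1

 ι-pos : ∀ n → Positive (ι (+ suc n))
 ι-pos n = normalize-pos (suc n) 1

-- Integer vectors, the lattices they span, and the Euclidean algorithm on generators.

module IntegerVectors where

 open import Data.Nat.Base as ℕ using (ℕ; zero; suc)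
 import Data.Nat.Properties as ℕ
 import Data.Nat.Induction as ℕ
 open import Data.Integer.Base hiding (suc)
 open import Data.Integer.Properties
 open import Data.Integer.DivMod using (_/_; _%_; a≡a%n+[a/n]*n; n%d<d)
 open import Data.Integer.Tactic.RingSolver using (solve-∀)
 open import Data.Fin.Base using (Fin; zero; suc)
 open import Data.Product.Base using (∃; _×_; _,_; proj₁; proj₂)
 open import Data.Vec.Base using (Vec; []; _∷_; lookup; zipWith; map; replicate)
 open import Data.Vec.Properties using (lookup-zipWith; lookup-map; lookup-replicate)
 open import Function.Base using (_∘_)
 open import Induction.WellFounded using (Acc; acc)
 open import Relation.Binary.PropositionalEquality
 open import Relation.Nullary using (yes; no; contradiction)

 infixl 6 _⊕_
 infixr 7 _⊙_

 _⊕_ : ∀ {a} → Vec ℤ a → Vec ℤ a → Vec ℤ a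
 _⊕_ = zipWith _+_

 _⊙_ : ∀ {a} → ℤ → Vec ℤ a → Vec ℤ a
 c ⊙ x = map (c *_) x

 𝟎 : ∀ {a} → Vec ℤ a
 𝟎 = replicate _ 0ℤ

 lookup-ext : ∀ {A : Set} {n} {x y : Vec A n} → (∀ i → lookup x i ≡ lookup y i) → x ≡ y
 lookup-ext {x = []}    {[]}    eq = refl
 lookup-ext {x = _ ∷ _} {_ ∷ _} eq = cong₂ _∷_ (eq zero) (lookup-ext (eq ∘ suc))

 lookup-⊕ : ∀ {a} (x y : Vec ℤ a) i → lookup (x ⊕ y) i ≡ lookup x i + lookup y i
 lookup-⊕ x y i = lookup-zipWith _+_ i x y

 lookup-⊙ : ∀ {a} c (x : Vec ℤ a) i → lookup (c ⊙ x) i ≡ c * lookup x i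
 lookup-⊙ c x i = lookup-map i (c *_) x

 lookup-𝟎 : ∀ {a} (i : Fin a) → lookup 𝟎 i ≡ 0ℤ
 lookup-𝟎 i = lookup-replicate i 0ℤ

 ⊕-assoc : ∀ {a} (x y z : Vec ℤ a) → (x ⊕ y) ⊕ z ≡ x ⊕ (y ⊕ z)
 ⊕-assoc []      []      []      = refl
 ⊕-assoc (p ∷ x) (q ∷ y) (r ∷ z) = cong₂ _∷_ (+-assoc p q r) (⊕-assoc x y z)

 ⊕-comm : ∀ {a} (x y : Vec ℤ a) → x ⊕ y ≡ y ⊕ x
 ⊕-comm []      []      = refl
 ⊕-comm (p ∷ x) (q ∷ y) = cong₂ _∷_ (+-comm p q) (⊕-comm x y)

 ⊕-identityˡ : ∀ {a} (x : Vec ℤ a) → 𝟎 ⊕ x ≡ x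
 ⊕-identityˡ []      = refl
 ⊕-identityˡ (p ∷ x) = cong₂ _∷_ (+-identityˡ p) (⊕-identityˡ x)

 ⊕-identityʳ : ∀ {a} (x : Vec ℤ a) → x ⊕ 𝟎 ≡ x
 ⊕-identityʳ x = trans (⊕-comm x 𝟎) (⊕-identityˡ x)

 ⊙-distribˡ : ∀ {a} c (x y : Vec ℤ a) → c ⊙ (x ⊕ y) ≡ c ⊙ x ⊕ c ⊙ y
 ⊙-distribˡ c []      []      = refl
 ⊙-distribˡ c (p ∷ x) (q ∷ y) = cong₂ _∷_ (*-distribˡ-+ c p q) (⊙-distribˡ c x y)

 ⊙-distribʳ : ∀ {a} c d (x : Vec ℤ a) → (c + d) ⊙ x ≡ c ⊙ x ⊕ d ⊙ x
 ⊙-distribʳ c d []      = refl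
 ⊙-distribʳ c d (p ∷ x) = cong₂ _∷_ (*-distribʳ-+ p c d) (⊙-distribʳ c d x)

 ⊙-assoc : ∀ {a} c d (x : Vec ℤ a) → (c * d) ⊙ x ≡ c ⊙ d ⊙ x
 ⊙-assoc c d []      = refl
 ⊙-assoc c d (p ∷ x) = cong₂ _∷_ (*-assoc c d p) (⊙-assoc c d x)

 ⊙-identity : ∀ {a} (x : Vec ℤ a) → 1ℤ ⊙ x ≡ x
 ⊙-identity []      = refl
 ⊙-identity (p ∷ x) = cong₂ _∷_ (*-identityˡ p) (⊙-identity x)

 ⊙-zeroˡ : ∀ {a} (x : Vec ℤ a) → 0ℤ ⊙ x ≡ 𝟎
 ⊙-zeroˡ []      = refl
 ⊙-zeroˡ (p ∷ x) = cong (0ℤ ∷_) (⊙-zeroˡ x)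

 ⊙-zeroʳ : ∀ {a} c → c ⊙ 𝟎 {a} ≡ 𝟎
 ⊙-zeroʳ {zero}  c = refl
 ⊙-zeroʳ {suc a} c = cong₂ _∷_ (*-zeroʳ c) (⊙-zeroʳ {a} c)

 ⊕-interchange : ∀ {a} (x y z t : Vec ℤ a) → (x ⊕ y) ⊕ (z ⊕ t) ≡ (x ⊕ z) ⊕ (y ⊕ t)
 ⊕-interchange x y z t = begin
   (x ⊕ y) ⊕ (z ⊕ t) ≡⟨ ⊕-assoc x y (z ⊕ t) ⟩
   x ⊕ (y ⊕ (z ⊕ t)) ≡⟨ cong (x ⊕_) (⊕-assoc y z t) ⟨
   x ⊕ ((y ⊕ z) ⊕ t) ≡⟨ cong (λ s → x ⊕ (s ⊕ t)) (⊕-comm y z) ⟩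
   x ⊕ ((z ⊕ y) ⊕ t) ≡⟨ cong (x ⊕_) (⊕-assoc z y t) ⟩
   x ⊕ (z ⊕ (y ⊕ t)) ≡⟨ ⊕-assoc x z (y ⊕ t) ⟨
   (x ⊕ z) ⊕ (y ⊕ t) ∎
   where open ≡-Reasoning

 lin : ∀ {a b} → Vec ℤ b → Vec (Vec ℤ a) b → Vec ℤ a
 lin []       []       = 𝟎
 lin (c ∷ cs) (w ∷ ws) = c ⊙ w ⊕ lin cs ws

 lin-⊕ : ∀ {a b} (c d : Vec ℤ b) (w : Vec (Vec ℤ a) b) → lin (c ⊕ d) w ≡ lin c w ⊕ lin d w
 lin-⊕ []       []       []       = sym (⊕-identityˡ 𝟎)
 lin-⊕ (c ∷ cs) (d ∷ ds) (w ∷ ws) = begin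
   (c + d) ⊙ w ⊕ lin (cs ⊕ ds) ws                ≡⟨ cong₂ _⊕_ (⊙-distribʳ c d w) (lin-⊕ cs ds ws) ⟩
   (c ⊙ w ⊕ d ⊙ w) ⊕ (lin cs ws ⊕ lin ds ws)     ≡⟨ ⊕-interchange (c ⊙ w) (d ⊙ w) _ _ ⟩
   (c ⊙ w ⊕ lin cs ws) ⊕ (d ⊙ w ⊕ lin ds ws)     ∎
   where open ≡-Reasoning

 lin-⊙ : ∀ {a b} k (c : Vec ℤ b) (w : Vec (Vec ℤ a) b) → lin (k ⊙ c) w ≡ k ⊙ lin c w
 lin-⊙ k []       []       = sym (⊙-zeroʳ k)
 lin-⊙ k (c ∷ cs) (w ∷ ws) = begin
   (k * c) ⊙ w ⊕ lin (k ⊙ cs) ws  ≡⟨ cong₂ _⊕_ (⊙-assoc k c w) (lin-⊙ k cs ws) ⟩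
   k ⊙ c ⊙ w ⊕ k ⊙ lin cs ws      ≡⟨ ⊙-distribˡ k (c ⊙ w) (lin cs ws) ⟨
   k ⊙ (c ⊙ w ⊕ lin cs ws)        ∎
   where open ≡-Reasoning

 lin-𝟎 : ∀ {a b} (w : Vec (Vec ℤ a) b) → lin 𝟎 w ≡ 𝟎
 lin-𝟎 []       = refl
 lin-𝟎 (w ∷ ws) = trans (cong₂ _⊕_ (⊙-zeroˡ w) (lin-𝟎 ws)) (⊕-identityˡ 𝟎)

 unit : ∀ {b} → Fin b → Vec ℤ b
 unit zero    = 1ℤ ∷ 𝟎
 unit (suc i) = 0ℤ ∷ unit i

 lin-unit : ∀ {a b} (i : Fin b) (w : Vec (Vec ℤ a) b) → lin (unit i) w ≡ lookup w i
 lin-unit zero    (w ∷ ws) = trans (cong₂ _⊕_ (⊙-identity w) (lin-𝟎 ws)) (⊕-identityʳ w)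
 lin-unit (suc i) (w ∷ ws) = trans (cong₂ _⊕_ (⊙-zeroˡ w) (lin-unit i ws)) (⊕-identityˡ _)

 lookup-unit : ∀ {b} (i : Fin b) → lookup (unit i) i ≡ 1ℤ
 lookup-unit zero    = refl
 lookup-unit (suc i) = lookup-unit i

 -- An inductive closure instead of a coefficient vector: inclusion of spans and `span-onDirections`
 -- become plain inductions, and `span⇒lin` recovers coefficients where they are needed.
 data Span {a b} (w : Vec (Vec ℤ a) b) : Vec ℤ a → Set where
   span-𝟎   : Span w 𝟎
   span-⊕   : ∀ {x y} → Span w x → Span w y → Span w (x ⊕ y)
   span-⊙   : ∀ c {x} → Span w x → Span w (c ⊙ x)
   span-gen : ∀ i → Span w (lookup w i)

 infix 4 _⊑_

 record _⊑_ {a b c} (u : Vec (Vec ℤ a) b) (w : Vec (Vec ℤ a) c) : Set where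
   constructor gens
   field gen : ∀ i → Span w (lookup u i)

 open _⊑_ public

 span-mono : ∀ {a b c} {u : Vec (Vec ℤ a) b} {w : Vec (Vec ℤ a) c} {x} → u ⊑ w → Span u x → Span w x
 span-mono u⊑w span-𝟎         = span-𝟎
 span-mono u⊑w (span-⊕ p q)   = span-⊕ (span-mono u⊑w p) (span-mono u⊑w q)
 span-mono u⊑w (span-⊙ c p)   = span-⊙ c (span-mono u⊑w p)
 span-mono u⊑w (span-gen i)   = gen u⊑w i

 ⊑-refl : ∀ {a b} (u : Vec (Vec ℤ a) b) → u ⊑ u
 ⊑-refl u = gens span-gen

 ⊑-trans : ∀ {a b c d} {u : Vec (Vec ℤ a) b} {v : Vec (Vec ℤ a) c} {w : Vec (Vec ℤ a) d} →
           u ⊑ v → v ⊑ w → u ⊑ w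
 ⊑-trans u⊑v v⊑w = gens λ i → span-mono v⊑w (gen u⊑v i)

 ∷-⊑ : ∀ {a b c} {x : Vec ℤ a} {u : Vec (Vec ℤ a) b} {w : Vec (Vec ℤ a) c} →
       Span w x → u ⊑ w → x ∷ u ⊑ w
 ∷-⊑ p q = gens λ { zero → p ; (suc i) → gen q i }

 ⊑-there : ∀ {a b c} {x : Vec ℤ a} {u : Vec (Vec ℤ a) b} {w : Vec (Vec ℤ a) c} →
           u ⊑ w → u ⊑ x ∷ w
 ⊑-there p = gens λ i → span-mono (gens λ j → span-gen (suc j)) (gen p i)

 span⇒lin : ∀ {a b} {w : Vec (Vec ℤ a) b} {x} → Span w x → ∃ λ c → lin c w ≡ x
 span⇒lin {w = w} span-𝟎       = 𝟎 , lin-𝟎 w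
 span⇒lin {w = w} (span-⊕ p q) with span⇒lin p | span⇒lin q
 ... | c , refl | d , refl = c ⊕ d , lin-⊕ c d w
 span⇒lin {w = w} (span-⊙ k p) with span⇒lin p
 ... | c , refl = k ⊙ c , lin-⊙ k c w
 span⇒lin {w = w} (span-gen i) = unit i , lin-unit i w

 infix 4 _≅_

 -- Two systems generating the same lattice. They may be dependent, so no basis or rank ever has to
 -- be found.
 record _≅_ {a b c} (u : Vec (Vec ℤ a) b) (w : Vec (Vec ℤ a) c) : Set where
   constructor _,_
   field
     to   : u ⊑ w
     from : w ⊑ u

 ≅-refl : ∀ {a b} (u : Vec (Vec ℤ a) b) → u ≅ u
 ≅-refl u = ⊑-refl u , ⊑-refl u

 ≅-trans : ∀ {a b c d} {u : Vec (Vec ℤ a) b} {v : Vec (Vec ℤ a) c} {w : Vec (Vec ℤ a) d} →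
           u ≅ v → v ≅ w → u ≅ w
 ≅-trans (p , q) (r , s) = ⊑-trans p r , ⊑-trans s q

 ∷-cong : ∀ {a b c} (x : Vec ℤ a) {u : Vec (Vec ℤ a) b} {w : Vec (Vec ℤ a) c} → u ≅ w → x ∷ u ≅ x ∷ w
 ∷-cong x (p , q) = ∷-⊑ (span-gen zero) (⊑-there p) , ∷-⊑ (span-gen zero) (⊑-there q)

 -- The Euclidean algorithm on the two coefficients of c w + d h.
 gcd-pair : ∀ {a b} (c d : ℤ) (w h : Vec ℤ a) (rest : Vec (Vec ℤ a) b) → Acc ℕ._<_ ∣ d ∣ →
            ∃ λ α → ∃ λ β → ∃ λ g → (α ∷ β ∷ rest) ≅ (w ∷ h ∷ rest) ×
            c ⊙ w ⊕ d ⊙ h ≡ g ⊙ α × (g ≡ 0ℤ → c ≡ 0ℤ × d ≡ 0ℤ)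
 gcd-pair c d w h rest (acc rs) with d ≟ 0ℤ
 ... | yes refl = w , h , c , ≅-refl (w ∷ h ∷ rest) ,
       trans (cong (c ⊙ w ⊕_) (⊙-zeroˡ h)) (⊕-identityʳ (c ⊙ w)) , λ c≡0 → c≡0 , refl
 ... | no d≢0 = step (gcd-pair d (+ r) (h ⊕ q ⊙ w) w rest (rs (n%d<d c d)))
   where
   instance _ = ≢-nonZero d≢0
   q = c / d
   r = c % d
   eq : c ≡ + r + q * d
   eq = a≡a%n+[a/n]*n c d
   back : ∀ h w q → h ≡ (h + q * w) + (- q) * w
   back = solve-∀
   h-back : h ≡ (h ⊕ q ⊙ w) ⊕ (- q) ⊙ w
   h-back = lookup-ext λ i → begin
     lookup h i                                                  ≡⟨ back (lookup h i) (lookup w i) q ⟩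
     lookup h i + q * lookup w i + (- q) * lookup w i            ≡⟨ cong₂ (λ s t → lookup h i + s + t) (lookup-⊙ q w i) (lookup-⊙ (- q) w i) ⟨
     lookup h i + lookup (q ⊙ w) i + lookup ((- q) ⊙ w) i        ≡⟨ cong (_+ lookup ((- q) ⊙ w) i) (lookup-⊕ h (q ⊙ w) i) ⟨
     lookup (h ⊕ q ⊙ w) i + lookup ((- q) ⊙ w) i                 ≡⟨ lookup-⊕ (h ⊕ q ⊙ w) ((- q) ⊙ w) i ⟨
     lookup ((h ⊕ q ⊙ w) ⊕ (- q) ⊙ w) i                          ∎
     where open ≡-Reasoning
   change : (h ⊕ q ⊙ w) ∷ w ∷ rest ≅ w ∷ h ∷ rest
   change = ∷-⊑ (span-⊕ (span-gen (suc zero)) (span-⊙ q (span-gen zero)))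
              (∷-⊑ (span-gen zero) (gens λ i → span-gen (suc (suc i))))
          , ∷-⊑ (span-gen (suc zero))
              (∷-⊑ (subst (Span _) (sym h-back) (span-⊕ (span-gen zero) (span-⊙ (- q) (span-gen (suc zero)))))
                (gens λ i → span-gen (suc (suc i))))
   regroup : ∀ r q d w h → (r + q * d) * w + d * h ≡ d * (h + q * w) + r * w
   regroup = solve-∀
   combo : c ⊙ w ⊕ d ⊙ h ≡ d ⊙ (h ⊕ q ⊙ w) ⊕ + r ⊙ w
   combo = lookup-ext λ i → begin
     lookup (c ⊙ w ⊕ d ⊙ h) i                              ≡⟨ lookup-⊕ (c ⊙ w) (d ⊙ h) i ⟩
     lookup (c ⊙ w) i + lookup (d ⊙ h) i                   ≡⟨ cong₂ _+_ (lookup-⊙ c w i) (lookup-⊙ d h i) ⟩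
     c * lookup w i + d * lookup h i                       ≡⟨ cong (λ t → t * lookup w i + d * lookup h i) eq ⟩
     (+ r + q * d) * lookup w i + d * lookup h i           ≡⟨ regroup (+ r) q d (lookup w i) (lookup h i) ⟩
     d * (lookup h i + q * lookup w i) + + r * lookup w i  ≡⟨ cong (λ t → d * (lookup h i + t) + + r * lookup w i) (lookup-⊙ q w i) ⟨
     d * (lookup h i + lookup (q ⊙ w) i) + + r * lookup w i ≡⟨ cong (λ t → d * t + + r * lookup w i) (lookup-⊕ h (q ⊙ w) i) ⟨
     d * lookup (h ⊕ q ⊙ w) i + + r * lookup w i           ≡⟨ cong₂ _+_ (lookup-⊙ d (h ⊕ q ⊙ w) i) (lookup-⊙ (+ r) w i) ⟨
     lookup (d ⊙ (h ⊕ q ⊙ w)) i + lookup (+ r ⊙ w) i       ≡⟨ lookup-⊕ (d ⊙ (h ⊕ q ⊙ w)) (+ r ⊙ w) i ⟨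
     lookup (d ⊙ (h ⊕ q ⊙ w) ⊕ + r ⊙ w) i                  ∎
     where open ≡-Reasoning
   step : _ → _
   step (α , β , g , e , l , z) = α , β , g , ≅-trans e change , trans combo l ,
     λ g≡0 → contradiction (proj₁ (z g≡0)) d≢0

 -- Euclid's algorithm through all coefficients collects the combination into one multiple `g ⊙ α`,
 -- where `α` heads a system of the same size generating the same lattice. This is how minimality
 -- among heads of systems will bound `Q` on every combination with a nonzero coefficient.
 gcd-system : ∀ {a b} (c : Vec ℤ (suc b)) (w : Vec (Vec ℤ a) (suc b)) →
              ∃ λ α → ∃ λ (rest : Vec (Vec ℤ a) b) → ∃ λ g → (α ∷ rest) ≅ w ×
              lin c w ≡ g ⊙ α × (g ≡ 0ℤ → ∀ i → lookup c i ≡ 0ℤ)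
 gcd-system {b = zero} (c ∷ []) (w ∷ []) = w , [] , c , ≅-refl (w ∷ []) , ⊕-identityʳ (c ⊙ w) , λ { c≡0 zero → c≡0 }
 gcd-system {b = suc b} (c ∷ cs) (w ∷ ws) with gcd-system cs ws
 ... | h , hs , d , e , l , z with gcd-pair c d w h hs (ℕ.<-wellFounded _)
 ... | α , β , g , e′ , l′ , z′ = α , β ∷ hs , g , ≅-trans e′ (∷-cong w e) , trans (cong (c ⊙ w ⊕_) l) l′ ,
   λ { g≡0 zero → proj₁ (z′ g≡0) ; g≡0 (suc i) → z (proj₂ (z′ g≡0)) i }

-- Reduction of lattice generators with respect to a semidefinite form.

module LatticeReduction where

 open IntegerVectors
 open import Data.Nat.Base as ℕ using (ℕ; zero; suc)
 import Data.Nat.Properties as ℕ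
 import Data.Nat.Induction as ℕ
 open import Data.Integer.Base hiding (suc)
 open import Data.Integer.Properties
 open import Data.Integer.DivMod using (_/_; _%_; a≡a%n+[a/n]*n; n%d<d)
 open import Data.Integer.Tactic.RingSolver using (solve-∀)
 open import Data.Fin.Base using (Fin; zero; suc)
 open import Data.Product.Base using (Σ; ∃; _×_; _,_; proj₁; proj₂)
 open import Data.Vec.Base using (Vec; []; _∷_; lookup; map; head)
 open import Data.Vec.Properties using (lookup-map)
 open import Function.Base using (_∘_)
 open import Induction.WellFounded using (Acc; acc)
 open import Relation.Binary.PropositionalEquality
 open import Relation.Nullary using (¬_; yes; no; contradiction)
 open import Relation.Nullary.Negation using (DoubleNegation)

 square≥0 : ∀ i → 0ℤ ≤ i * i
 square≥0 (+ n)    = subst (0ℤ ≤_) (pos-* n n) (+≤+ ℕ.z≤n)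
 square≥0 -[1+ n ] = +≤+ ℕ.z≤n

 -- Positive semidefinite only: the projected forms of `Quotient` vanish at `u`, and the induction
 -- in `reduction` passes to them.
 record Form (a : ℕ) : Set where
   field
     B     : Vec ℤ a → Vec ℤ a → ℤ
     B-sym : ∀ x y → B x y ≡ B y x
     B-⊕   : ∀ x y z → B (x ⊕ y) z ≡ B x z + B y z
     B-⊙   : ∀ c x z → B (c ⊙ x) z ≡ c * B x z
     B≥0   : ∀ x → 0ℤ ≤ B x x

   Q : Vec ℤ a → ℤ
   Q x = B x x

   B-⊕ʳ : ∀ x y z → B x (y ⊕ z) ≡ B x y + B x z
   B-⊕ʳ x y z = trans (B-sym x _) (trans (B-⊕ y z x) (cong₂ _+_ (B-sym y x) (B-sym z x)))

   B-⊙ʳ : ∀ c x y → B x (c ⊙ y) ≡ c * B x y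
   B-⊙ʳ c x y = trans (B-sym x _) (trans (B-⊙ c y x) (cong (c *_) (B-sym y x)))

   B-combo : ∀ c x y z → B (c ⊙ x ⊕ y) z ≡ c * B x z + B y z
   B-combo c x y z = trans (B-⊕ (c ⊙ x) y z) (cong (_+ B y z) (B-⊙ c x z))

   B-comboʳ : ∀ c x y z → B z (c ⊙ x ⊕ y) ≡ c * B z x + B z y
   B-comboʳ c x y z = trans (B-⊕ʳ z (c ⊙ x) y) (cong (_+ B z y) (B-⊙ʳ c z x))

   Q-⊙ : ∀ c x → Q (c ⊙ x) ≡ c * c * Q x
   Q-⊙ c x = trans (B-⊙ c x _) (trans (cong (c *_) (B-⊙ʳ c x x)) (sym (*-assoc c c (Q x))))

   Q-combo : ∀ c x y → Q (c ⊙ x ⊕ y) ≡ c * c * Q x + (c * B x y + c * B x y) + Q y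
   Q-combo c x y = begin
     B (c ⊙ x ⊕ y) (c ⊙ x ⊕ y)                    ≡⟨ B-combo c x y _ ⟩
     c * B x (c ⊙ x ⊕ y) + B y (c ⊙ x ⊕ y)        ≡⟨ cong₂ (λ s t → c * s + t) (B-comboʳ c x y x) (B-comboʳ c x y y) ⟩
     c * (c * Q x + B x y) + (c * B y x + Q y)    ≡⟨ cong (λ s → c * (c * Q x + B x y) + (c * s + Q y)) (B-sym y x) ⟩
     c * (c * Q x + B x y) + (c * B x y + Q y)    ≡⟨ regroup c (Q x) (B x y) (Q y) ⟩
     c * c * Q x + (c * B x y + c * B x y) + Q y  ∎
     where
     open ≡-Reasoning
     regroup : ∀ c p q r → c * (c * p + q) + (c * q + r) ≡ c * c * p + (c * q + c * q) + r
     regroup = solve-∀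

   -- Both bounds come from the parallelogram law.
   Q-⊕-≤ : ∀ x y → Q (x ⊕ y) ≤ + 2 * Q x + + 2 * Q y
   Q-⊕-≤ x y = 0≤i-j⇒j≤i (subst (0ℤ ≤_) eq (B≥0 (-1ℤ ⊙ x ⊕ y)))
     where
     identity : ∀ p q r → -1ℤ * -1ℤ * p + (-1ℤ * q + -1ℤ * q) + r
              ≡ + 2 * p + + 2 * r - (1ℤ * 1ℤ * p + (1ℤ * q + 1ℤ * q) + r)
     identity = solve-∀
     eq : Q (-1ℤ ⊙ x ⊕ y) ≡ + 2 * Q x + + 2 * Q y - Q (x ⊕ y)
     eq = trans (Q-combo -1ℤ x y) (trans (identity (Q x) (B x y) (Q y))
       (cong (λ s → + 2 * Q x + + 2 * Q y - s)
         (trans (sym (Q-combo 1ℤ x y)) (cong (λ s → Q (s ⊕ y)) (⊙-identity x)))))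

   Q-difference-≤ : ∀ x y → Q x ≤ + 2 * Q (x ⊕ y) + + 2 * Q y
   Q-difference-≤ x y = 0≤i-j⇒j≤i (subst (0ℤ ≤_) eq (B≥0 (+ 2 ⊙ y ⊕ x)))
     where
     identity : ∀ p q r → + 2 * + 2 * r + (+ 2 * q + + 2 * q) + p
              ≡ + 2 * (1ℤ * 1ℤ * p + (1ℤ * q + 1ℤ * q) + r) + + 2 * r - p
     identity = solve-∀
     eq : Q (+ 2 ⊙ y ⊕ x) ≡ + 2 * Q (x ⊕ y) + + 2 * Q y - Q x
     eq = trans (Q-combo (+ 2) y x) (trans (cong (λ s → + 2 * + 2 * Q y + (+ 2 * s + + 2 * s) + Q x) (B-sym y x))
       (trans (identity (Q x) (B x y) (Q y))
         (cong (λ s → + 2 * s + + 2 * Q y - Q x)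
           (trans (sym (Q-combo 1ℤ x y)) (cong (λ s → Q (s ⊕ y)) (⊙-identity x))))))

 open Form using (Q)

 -- The Gram–Schmidt projection orthogonal to u, scaled by Q u to stay integral;
 -- it is nonnegative by the Cauchy–Schwarz inequality.
 module Quotient {a} (F : Form a) (u : Vec ℤ a) (q>0 : 0ℤ < Q F u) where
   open Form F hiding (Q)

   q : ℤ
   q = Q F u

   B′ : Vec ℤ a → Vec ℤ a → ℤ
   B′ x y = q * B x y - B u x * B u y

   -- The form at `(- B u x) ⊙ u ⊕ q ⊙ x` equals `q * B′ x x`, so its positivity gives the claim
   -- after cancelling `q`.
   cauchy-schwarz : ∀ x → 0ℤ ≤ B′ x x
   cauchy-schwarz x = *-cancelˡ-≤-pos 0ℤ (B′ x x) q {{positive q>0}}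
     (subst₂ _≤_ (sym (*-zeroʳ q)) eq (B≥0 ((- B u x) ⊙ u ⊕ q ⊙ x)))
     where
     identity : ∀ b q p → - b * - b * q + (- b * (q * b) + - b * (q * b)) + q * q * p ≡ q * (q * p - b * b)
     identity = solve-∀
     eq : Q F ((- B u x) ⊙ u ⊕ q ⊙ x) ≡ q * B′ x x
     eq = trans (Q-combo (- B u x) u (q ⊙ x))
       (trans (cong₂ (λ s t → - B u x * - B u x * q + (- B u x * s + - B u x * s) + t) (B-⊙ʳ q u x) (Q-⊙ q x))
         (identity (B u x) q (Q F x)))

   form : Form a
   form = record
     { B     = B′
     ; B-sym = λ x y → cong₂ (λ s t → q * s - t) (B-sym x y) (*-comm (B u x) (B u y))
     ; B-⊕   = λ x y z → trans (cong₂ (λ s t → q * s - t * B u z) (B-⊕ x y z) (B-⊕ʳ u x y))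
                 (add q (B x z) (B y z) (B u x) (B u y) (B u z))
     ; B-⊙   = λ c x z → trans (cong₂ (λ s t → q * s - t * B u z) (B-⊙ c x z) (B-⊙ʳ c u x))
                 (scale q c (B x z) (B u x) (B u z))
     ; B≥0   = cauchy-schwarz
     }
     where
     add : ∀ q r s t v w → q * (r + s) - (t + v) * w ≡ (q * r - t * w) + (q * s - v * w)
     add = solve-∀
     scale : ∀ q c r t w → q * (c * r) - c * t * w ≡ c * (q * r - t * w)
     scale = solve-∀

   Q-shift : ∀ c y → Q form (c ⊙ u ⊕ y) ≡ Q form y
   Q-shift c y = trans (Form.Q-combo form c u y) (vanish c q (B u y) (Q form y))
     where
     vanish : ∀ c q b r → c * c * (q * q - q * q) + (c * (q * b - q * b) + c * (q * b - q * b)) + r ≡ r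
     vanish = solve-∀

   Q-form-≤ : ∀ x → Q form x ≤ q * Q F x
   Q-form-≤ x = 0≤i-j⇒j≤i (subst (0ℤ ≤_) (cancel (q * Q F x) (B u x * B u x)) (square≥0 (B u x)))
     where
     cancel : ∀ s t → t ≡ s - (s - t)
     cancel = solve-∀

   private
     instance
       2q-nonZero : NonZero (+ 2 * q)
       2q-nonZero = ≢-nonZero (<⇒≢ (*-monoˡ-<-pos (+ 2) q>0) ∘ sym)

   -- Minus an integer nearest to `B u y / q`: one half is added before rounding down, over the
   -- common denominator `2 * q`.
   nearest : Vec ℤ a → ℤ
   nearest y = - ((+ 2 * B u y + q) / (+ 2 * q))

   lift : Vec ℤ a → Vec ℤ a
   lift y = nearest y ⊙ u ⊕ y

   -- The remainder `r` of the rounding division lies between 0 and 2q and satisfies 2 B(u, lift y)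
   -- = r - q, while q² - (r - q)² factors as r (2q - r).
   lift-close : ∀ y → + 4 * (B u (lift y) * B u (lift y)) ≤ q * q
   lift-close y = 0≤i-j⇒j≤i (subst (0ℤ ≤_) eq (0≤* r≥0 r≤2q))
     where
     n = + 2 * B u y + q
     r = + (n % (+ 2 * q))
     t = n / (+ 2 * q)
     0≤* : ∀ {i j} → 0ℤ ≤ i → 0ℤ ≤ j → 0ℤ ≤ i * j
     0≤* {i} {j} p s = subst (_≤ i * j) (*-zeroʳ i) (*-monoˡ-≤-nonNeg i {{nonNegative p}} s)
     r≥0 : 0ℤ ≤ r
     r≥0 = +≤+ ℕ.z≤n
     r≤2q : 0ℤ ≤ + 2 * q - r
     r≤2q = i≤j⇒0≤j-i (<⇒≤ (subst (r <_) (0≤i⇒+∣i∣≡i (<⇒≤ (*-monoˡ-<-pos (+ 2) q>0))) (+<+ (n%d<d n (+ 2 * q)))))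
     double : ∀ b q n r t → n ≡ + 2 * b + q → n ≡ r + t * (+ 2 * q) → + 2 * (- t * q + b) ≡ r - q
     double b q n r t refl e = trans (expand b q t) (trans (cong (λ s → s - t * (+ 2 * q) - q) e) (cancel r (t * (+ 2 * q)) q))
       where
       expand : ∀ b q t → + 2 * (- t * q + b) ≡ (+ 2 * b + q) - t * (+ 2 * q) - q
       expand = solve-∀
       cancel : ∀ r s q → (r + s) - s - q ≡ r - q
       cancel = solve-∀
     identity : ∀ r q → r * (+ 2 * q - r) ≡ q * q - (r - q) * (r - q)
     identity = solve-∀
     four : ∀ s → + 4 * (s * s) ≡ (+ 2 * s) * (+ 2 * s)
     four = solve-∀
     eq : r * (+ 2 * q - r) ≡ q * q - + 4 * (B u (lift y) * B u (lift y))
     eq = trans (identity r q) (cong (λ s → q * q - s) (sym (trans (four (B u (lift y)))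
       (cong (λ s → s * s) (trans (cong (+ 2 *_) (B-comboʳ (nearest y) u y u))
         (double (B u y) q n r t refl (a≡a%n+[a/n]*n n (+ 2 * q))))))))

   -- With `z = lift y`, `q * Q F z` is `Q form y` plus the square of `B u z`. By `lift-close` that
   -- square is at most a quarter of `q * q`, hence of `q * Q F z` by the hypothesis, and is
   -- absorbed on the left.
   lift-reduced : ∀ y → q ≤ Q F (lift y) → + 3 * (q * Q F (lift y)) ≤ + 4 * Q form y
   lift-reduced y q≤ = begin
     + 3 * (q * Q F z)                                          ≡⟨ split (q * Q F z) ⟩
     + 4 * (q * Q F z) - q * Q F z                              ≤⟨ +-monoʳ-≤ (+ 4 * (q * Q F z)) (neg-mono-≤ (*-monoˡ-≤-nonNeg q {{nonNegative (<⇒≤ q>0)}} q≤)) ⟩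
     + 4 * (q * Q F z) - q * q                                  ≤⟨ +-monoʳ-≤ (+ 4 * (q * Q F z)) (neg-mono-≤ (lift-close y)) ⟩
     + 4 * (q * Q F z) - + 4 * (B u z * B u z)                  ≡⟨ factor (q * Q F z) (B u z * B u z) ⟩
     + 4 * Q form z                                             ≡⟨ cong (+ 4 *_) (Q-shift (nearest y) y) ⟩
     + 4 * Q form y                                             ∎
     where
     open ≤-Reasoning
     z = lift y
     split : ∀ s → + 3 * s ≡ + 4 * s - s
     split = solve-∀
     factor : ∀ s t → + 4 * s - + 4 * t ≡ + 4 * (s - t)
     factor = solve-∀

   lin-lift : ∀ {b} (c : Vec ℤ b) (e : Vec (Vec ℤ a) b) → ∃ λ σ → lin c (map lift e) ≡ σ ⊙ u ⊕ lin c e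
   lin-lift []       []       = 0ℤ , sym (trans (cong (_⊕ 𝟎) (⊙-zeroˡ u)) (⊕-identityˡ 𝟎))
   lin-lift (c ∷ cs) (e ∷ es) with lin-lift cs es
   ... | σ , eq = c * nearest e + σ , (begin
     c ⊙ (nearest e ⊙ u ⊕ e) ⊕ lin cs (map lift es)         ≡⟨ cong₂ _⊕_ (⊙-distribˡ c (nearest e ⊙ u) e) eq ⟩
     (c ⊙ nearest e ⊙ u ⊕ c ⊙ e) ⊕ (σ ⊙ u ⊕ lin cs es)      ≡⟨ ⊕-interchange _ (c ⊙ e) _ _ ⟩
     (c ⊙ nearest e ⊙ u ⊕ σ ⊙ u) ⊕ (c ⊙ e ⊕ lin cs es)      ≡⟨ cong (λ s → (s ⊕ σ ⊙ u) ⊕ (c ⊙ e ⊕ lin cs es)) (⊙-assoc c (nearest e) u) ⟨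
     ((c * nearest e) ⊙ u ⊕ σ ⊙ u) ⊕ (c ⊙ e ⊕ lin cs es)    ≡⟨ cong (_⊕ (c ⊙ e ⊕ lin cs es)) (⊙-distribʳ (c * nearest e) σ u) ⟨
     (c * nearest e + σ) ⊙ u ⊕ (c ⊙ e ⊕ lin cs es)          ∎)
     where open ≡-Reasoning

   lift-≅ : ∀ {b} (e : Vec (Vec ℤ a) b) → u ∷ map lift e ≅ u ∷ e
   lift-≅ e = ∷-⊑ (span-gen zero) (gens λ i → subst (Span _) (sym (lookup-map i lift e))
                  (span-⊕ (span-⊙ (nearest (lookup e i)) (span-gen zero)) (span-gen (suc i))))
            , ∷-⊑ (span-gen zero) (gens λ i → subst (Span _) (back (lookup e i))
                  (span-⊕ (span-⊙ (- nearest (lookup e i)) (span-gen zero))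
                    (subst (Span _) (lookup-map i lift e) (span-gen (suc i)))))
     where
     back : ∀ y → (- nearest y) ⊙ u ⊕ lift y ≡ y
     back y = begin
       (- nearest y) ⊙ u ⊕ (nearest y ⊙ u ⊕ y)   ≡⟨ ⊕-assoc ((- nearest y) ⊙ u) (nearest y ⊙ u) y ⟨
       ((- nearest y) ⊙ u ⊕ nearest y ⊙ u) ⊕ y   ≡⟨ cong (_⊕ y) (⊙-distribʳ (- nearest y) (nearest y) u) ⟨
       (- nearest y + nearest y) ⊙ u ⊕ y         ≡⟨ cong (λ s → s ⊙ u ⊕ y) (+-inverseˡ (nearest y)) ⟩
       0ℤ ⊙ u ⊕ y                                ≡⟨ cong (_⊕ y) (⊙-zeroˡ u) ⟩
       𝟎 ⊕ y                                     ≡⟨ ⊕-identityˡ y ⟩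
       y                                         ∎
       where open ≡-Reasoning

 -- Comparing two values is decidable but searching `A` is not: a value below the current one
 -- restarts the descent, so only the double negation of a minimum is obtained.
 ¬¬-minimum : ∀ {A : Set} (f : A → ℕ) → A → DoubleNegation (Σ A λ a → ∀ a′ → f a ℕ.≤ f a′)
 ¬¬-minimum {A} f a = go a (ℕ.<-wellFounded (f a))
   where
   go : ∀ a → Acc ℕ._<_ (f a) → DoubleNegation (Σ A λ a → ∀ a′ → f a ℕ.≤ f a′)
   go a (acc rs) k = k (a , λ a′ → case a′ (f a ℕ.≤? f a′))
     where
     case : ∀ a′ → _ → f a ℕ.≤ f a′
     case a′ (yes p) = p
     case a′ (no ¬p) = contradiction k (go a′ (rs (ℕ.≰⇒> ¬p)))

 -- No cancellation among generators: each term of a combination is controlled by the whole. In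
 -- particular every term of an integral relation has length zero, which makes dependent systems as
 -- usable as bases.
 Reduced : ∀ {a b} → Form a → ℕ → Vec (Vec ℤ a) b → Set
 Reduced F C u = ∀ c i → lookup c i * lookup c i * Q F (lookup u i) ≤ + C * Q F (lin c u)

 -- The recursion is read off from `assemble`: with X the form of the whole combination and C the
 -- previous constant, the first term costs 2X plus twice `4 ^ b` times 2CX.
 reductionConstant : ℕ → ℕ
 reductionConstant zero    = 0
 reductionConstant (suc b) = 2 ℕ.+ 4 ℕ.^ suc b ℕ.* reductionConstant b

 private
   scale-≤ : ∀ n {i j} → i ≤ j → + n * i ≤ + n * j
   scale-≤ n = *-monoˡ-≤-nonNeg (+ n)

   Q-lin-≤ : ∀ {a b} (F : Form a) (c : Vec ℤ b) (u : Vec (Vec ℤ a) b) K → 0ℤ ≤ K →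
             (∀ i → lookup c i * lookup c i * Q F (lookup u i) ≤ K) → Q F (lin c u) ≤ + (4 ℕ.^ b) * K
   Q-lin-≤ F []       []       K K≥0 h = subst₂ _≤_ (sym Q𝟎) (sym (*-identityˡ K)) K≥0
     where
     Q𝟎 : Q F 𝟎 ≡ 0ℤ
     Q𝟎 = trans (cong (Q F) (sym (⊙-zeroˡ 𝟎))) (trans (Form.Q-⊙ F 0ℤ 𝟎) refl)
   Q-lin-≤ {b = suc b} F (c ∷ cs) (u ∷ us) K K≥0 h = begin
     Q F (c ⊙ u ⊕ lin cs us)                      ≤⟨ Form.Q-⊕-≤ F (c ⊙ u) (lin cs us) ⟩
     + 2 * Q F (c ⊙ u) + + 2 * Q F (lin cs us)    ≤⟨ +-mono-≤ (scale-≤ 2 (subst (_≤ K) (sym (Form.Q-⊙ F c u)) (h zero)))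
                                                              (scale-≤ 2 (Q-lin-≤ F cs us K K≥0 (h ∘ suc))) ⟩
     + 2 * K + + 2 * (+ (4 ℕ.^ b) * K)            ≡⟨ split (+ (4 ℕ.^ b)) K ⟩
     + 2 * (1ℤ + + (4 ℕ.^ b)) * K                 ≤⟨ *-monoʳ-≤-nonNeg K {{nonNegative K≥0}} (subst (_≤ + (4 ℕ.^ suc b)) (pos-* 2 (1 ℕ.+ 4 ℕ.^ b)) (+≤+ four)) ⟩
     + (4 ℕ.^ suc b) * K                          ∎
     where
     open ≤-Reasoning
     split : ∀ p K → + 2 * K + + 2 * (p * K) ≡ + 2 * (1ℤ + p) * K
     split = solve-∀
     four : 2 ℕ.* (1 ℕ.+ 4 ℕ.^ b) ℕ.≤ 4 ℕ.* 4 ℕ.^ b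
     four = ℕ.≤-trans (ℕ.*-monoʳ-≤ 2 (ℕ.+-monoˡ-≤ (4 ℕ.^ b) (ℕ.^-monoʳ-≤ 4 {0} {b} ℕ.z≤n)))
              (ℕ.≤-reflexive (trans (cong (2 ℕ.*_) (cong (4 ℕ.^ b ℕ.+_) (sym (ℕ.+-identityʳ (4 ℕ.^ b))))) (sym (ℕ.*-assoc 2 2 (4 ℕ.^ b)))))

   -- The first coefficient is controlled because c ⊙ u is a difference of two combinations.
   assemble : ∀ {a b} (F : Form a) (u : Vec ℤ a) (e : Vec (Vec ℤ a) b) C →
              (∀ c cs i → lookup cs i * lookup cs i * Q F (lookup e i) ≤ + 2 * (+ C * Q F (lin (c ∷ cs) (u ∷ e)))) →
              Reduced F (2 ℕ.+ 4 ℕ.^ suc b ℕ.* C) (u ∷ e)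
   assemble {b = b} F u e C h (c ∷ cs) i = case i
     where
     x = lin (c ∷ cs) (u ∷ e)
     y = lin cs e
     X = Q F x
     X≥0 : 0ℤ ≤ X
     X≥0 = Form.B≥0 F x
     instance _ = nonNegative X≥0
     P = 4 ℕ.^ b
     K≥0 : 0ℤ ≤ + 2 * (+ C * X)
     K≥0 = subst (0ℤ ≤_) (*-assoc (+ 2) (+ C) X) (subst (_≤ + 2 * + C * X) (*-zeroˡ X) (*-monoʳ-≤-nonNeg X (subst (0ℤ ≤_) (pos-* 2 C) (+≤+ ℕ.z≤n))))
     const : + (2 ℕ.+ 4 ℕ.* P ℕ.* C) ≡ + 2 + + 4 * + P * + C
     const = trans (pos-+ 2 _) (cong (_+_ (+ 2)) (trans (pos-* (4 ℕ.* P) C) (cong (_* + C) (pos-* 4 P))))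
     first : c * c * Q F u ≤ + (2 ℕ.+ 4 ℕ.* P ℕ.* C) * X
     first = begin
       c * c * Q F u                                    ≡⟨ Form.Q-⊙ F c u ⟨
       Q F (c ⊙ u)                                      ≤⟨ Form.Q-difference-≤ F (c ⊙ u) y ⟩
       + 2 * X + + 2 * Q F y                            ≤⟨ +-monoʳ-≤ (+ 2 * X) (scale-≤ 2 (Q-lin-≤ F cs e (+ 2 * (+ C * X)) K≥0 (h c cs))) ⟩
       + 2 * X + + 2 * (+ P * (+ 2 * (+ C * X)))        ≡⟨ regroup (+ P) (+ C) X ⟩
       (+ 2 + + 4 * + P * + C) * X                      ≡⟨ cong (_* X) const ⟨
       + (2 ℕ.+ 4 ℕ.* P ℕ.* C) * X                      ∎
       where
       open ≤-Reasoning
       regroup : ∀ p c X → + 2 * X + + 2 * (p * (+ 2 * (c * X))) ≡ (+ 2 + + 4 * p * c) * X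
       regroup = solve-∀
     2C≤ : 2 ℕ.* C ℕ.≤ 2 ℕ.+ 4 ℕ.* P ℕ.* C
     2C≤ = ℕ.≤-trans (ℕ.*-monoˡ-≤ C (ℕ.≤-trans (ℕ.s≤s (ℕ.s≤s ℕ.z≤n)) (ℕ.*-monoʳ-≤ 4 (ℕ.^-monoʳ-≤ 4 {0} {b} ℕ.z≤n)))) (ℕ.m≤n+m _ 2)
     case : ∀ i → lookup (c ∷ cs) i * lookup (c ∷ cs) i * Q F (lookup (u ∷ e) i) ≤ + (2 ℕ.+ 4 ℕ.* P ℕ.* C) * X
     case zero    = first
     case (suc i) = ≤-trans (h c cs i) (subst (_≤ + (2 ℕ.+ 4 ℕ.* P ℕ.* C) * X) (*-assoc (+ 2) (+ C) X)
       (*-monoʳ-≤-nonNeg X (subst (_≤ + (2 ℕ.+ 4 ℕ.* P ℕ.* C)) (pos-* 2 C) (+≤+ 2C≤))))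

 -- Take a system whose head `u` is shortest, project the others along `u`, reduce the projections
 -- by induction and lift them back with nearest multiples of `u`. Induction controls the
 -- projections of the terms, minimality of `u` lets `lift-reduced` pass from projections to
 -- vectors, and `assemble` then recovers the term of `u` itself.
 reduction : ∀ {a} b (F : Form a) (w : Vec (Vec ℤ a) b) →
             DoubleNegation (Σ (Vec (Vec ℤ a) b) λ u → u ≅ w × Reduced F (reductionConstant b) u)
 reduction zero    F [] k = k ([] , ≅-refl [] , λ _ ())
 reduction {a} (suc b) F w k = ¬¬-minimum size (w , ≅-refl w) minimal
   where
   System : Set
   System = Σ (Vec (Vec ℤ a) (suc b)) (_≅ w)
   size : System → ℕ
   size (e , _) = ∣ Q F (head e) ∣
   minimal : ¬ Σ System λ s → ∀ s′ → size s ℕ.≤ size s′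
   minimal ((u ∷ es , es≅w) , least) with Q F u ≟ 0ℤ
   -- There is nothing to project along, but adding multiples of a vector of length zero changes `Q`
   -- by a factor of at most 2, so the others are reduced for `F` itself.
   ... | yes Qu≡0 = reduction b F es λ (e , e≅es , red) →
       k (u ∷ e , ≅-trans (∷-cong u e≅es) es≅w , assemble F u e (reductionConstant b) λ c cs i → ≤-trans (red cs i) (degenerate e c cs))
     where
     C = reductionConstant b
     degenerate : ∀ (e : Vec (Vec ℤ a) b) c cs → + C * Q F (lin cs e) ≤ + 2 * (+ C * Q F (lin (c ∷ cs) (u ∷ e)))
     degenerate e c cs = begin
       + C * Q F y                               ≤⟨ scale-≤ C (Form.Q-difference-≤ F y (c ⊙ u)) ⟩
       + C * (+ 2 * Q F (y ⊕ c ⊙ u) + + 2 * Q F (c ⊙ u)) ≡⟨ cong₂ (λ s t → + C * (+ 2 * Q F s + + 2 * t)) (⊕-comm y (c ⊙ u))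
                                                               (trans (Form.Q-⊙ F c u) (trans (cong (c * c *_) Qu≡0) (*-zeroʳ (c * c)))) ⟩
       + C * (+ 2 * Q F (c ⊙ u ⊕ y) + + 2 * 0ℤ)  ≡⟨ regroup (+ C) (Q F (c ⊙ u ⊕ y)) ⟩
       + 2 * (+ C * Q F (c ⊙ u ⊕ y))             ∎
       where
       open ≤-Reasoning
       y = lin cs e
       regroup : ∀ c x → c * (+ 2 * x + + 2 * 0ℤ) ≡ + 2 * (c * x)
       regroup = solve-∀
   ... | no Qu≢0 = reduction b form es λ (e , e≅es , red) →
       let sys = ≅-trans (∷-cong u e≅es) es≅w in
       k (u ∷ map lift e , ≅-trans (lift-≅ e) sys , assemble F u (map lift e) (reductionConstant b) (bound e sys red))
     where
     C = reductionConstant b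
     q>0 : 0ℤ < Q F u
     q>0 = ≤∧≢⇒< (Form.B≥0 F u) (Qu≢0 ∘ sym)
     open Quotient F u q>0
     instance _ = positive q>0

     -- By `gcd-system` the combination is a nonzero multiple of the head of another system of the
     -- lattice, and that head is not shorter than `u`.
     shortest : ∀ (e : Vec (Vec ℤ a) b) → u ∷ e ≅ w → ∀ c i → lookup c i ≢ 0ℤ → q ≤ Q F (lin c (u ∷ e))
     shortest e sys c i cᵢ≢0 with gcd-system c (u ∷ e)
     ... | α , rest , g , α≅ , eq , z = begin
       q                      ≡⟨ 0≤i⇒+∣i∣≡i (Form.B≥0 F u) ⟨
       + ∣ q ∣                ≤⟨ +≤+ (least (α ∷ rest , ≅-trans α≅ sys)) ⟩
       + ∣ Q F α ∣            ≡⟨ 0≤i⇒+∣i∣≡i (Form.B≥0 F α) ⟩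
       Q F α                  ≡⟨ *-identityˡ (Q F α) ⟨
       1ℤ * Q F α             ≤⟨ *-monoʳ-≤-nonNeg (Q F α) {{nonNegative (Form.B≥0 F α)}} (square≥1 g λ g≡0 → cᵢ≢0 (z g≡0 i)) ⟩
       g * g * Q F α          ≡⟨ Form.Q-⊙ F g α ⟨
       Q F (g ⊙ α)            ≡⟨ cong (Q F) eq ⟨
       Q F (lin c (u ∷ e))    ∎
       where
       open ≤-Reasoning
       square≥1 : ∀ g → g ≢ 0ℤ → 1ℤ ≤ g * g
       square≥1 (+ zero)  g≢0 = contradiction refl g≢0
       square≥1 +[1+ n ]  g≢0 = +≤+ (ℕ.s≤s ℕ.z≤n)
       square≥1 -[1+ n ]  g≢0 = +≤+ (ℕ.s≤s ℕ.z≤n)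

     bound : ∀ (e : Vec (Vec ℤ a) b) → u ∷ e ≅ w → Reduced form C e → ∀ c cs i →
             lookup cs i * lookup cs i * Q F (lookup (map lift e) i) ≤ + 2 * (+ C * Q F (lin (c ∷ cs) (u ∷ map lift e)))
     bound e sys red c cs i rewrite lookup-map i lift e =
       *-cancelˡ-≤-pos (cᵢ * cᵢ * Z) (+ 2 * (+ C * Q F x)) (+ 3 * q)
         {{positive (*-monoˡ-<-pos (+ 3) q>0)}} (begin
       + 3 * q * (cᵢ * cᵢ * Z)           ≡⟨ move q (cᵢ * cᵢ) Z ⟩
       cᵢ * cᵢ * (+ 3 * (q * Z))         ≤⟨ *-monoˡ-≤-nonNeg (cᵢ * cᵢ) {{nonNegative (square≥0 cᵢ)}} (lift-reduced eᵢ long) ⟩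
       cᵢ * cᵢ * (+ 4 * Q form eᵢ)       ≡⟨ move₂ (cᵢ * cᵢ) (Q form eᵢ) ⟩
       + 4 * (cᵢ * cᵢ * Q form eᵢ)       ≤⟨ scale-≤ 4 (red cs i) ⟩
       + 4 * (+ C * Q form (lin cs e))   ≡⟨ cong (λ s → + 4 * (+ C * s)) same ⟨
       + 4 * (+ C * Q form x)            ≤⟨ scale-≤ 4 (scale-≤ C (Q-form-≤ x)) ⟩
       -- The factor 4/3 lost in `lift-reduced` is rounded up to the 2 that `assemble` expects.
       + 4 * (+ C * (q * Q F x))         ≤⟨ *-monoʳ-≤-nonNeg (+ C * (q * Q F x)) {{nonNegative nn}} {+ 4} {+ 6} (+≤+ (ℕ.m≤n+m 4 2)) ⟩
       + 6 * (+ C * (q * Q F x))         ≡⟨ move₃ q (+ C) (Q F x) ⟩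
       + 3 * q * (+ 2 * (+ C * Q F x))   ∎)
       where
       open ≤-Reasoning
       cᵢ = lookup cs i
       eᵢ = lookup e i
       Z  = Q F (lift eᵢ)
       x  = lin (c ∷ cs) (u ∷ map lift e)
       nn : 0ℤ ≤ + C * (q * Q F x)
       nn = subst (_≤ + C * (q * Q F x)) (*-zeroʳ (+ C)) (scale-≤ C (≤-trans (Form.B≥0 form x) (Q-form-≤ x)))
       -- The lifted vector is a combination in which `eᵢ` has coefficient 1, so `shortest` applies.
       long : q ≤ Q F (lift eᵢ)
       long = subst (λ s → q ≤ Q F (nearest eᵢ ⊙ u ⊕ s)) (lin-unit i e)
                (shortest e sys (nearest eᵢ ∷ unit i) (suc i) (λ p → contradiction (trans (sym (lookup-unit i)) p) λ ()))
       same : Q form x ≡ Q form (lin cs e)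
       same = trans (Q-shift c (lin cs (map lift e)))
         (trans (cong (Q form) (proj₂ (lin-lift cs e))) (Q-shift (proj₁ (lin-lift cs e)) (lin cs e)))
       move : ∀ q s z → + 3 * q * (s * z) ≡ s * (+ 3 * (q * z))
       move = solve-∀
       move₂ : ∀ s z → s * (+ 4 * z) ≡ + 4 * (s * z)
       move₂ = solve-∀
       move₃ : ∀ q c z → + 6 * (c * (q * z)) ≡ + 3 * q * (+ 2 * (c * z))
       move₃ = solve-∀

-- Reduced systems in the supremum norm.

module SupNorm where

 open IntegerVectors
 open LatticeReduction
 open import Data.Nat.Base as ℕ using (ℕ; zero; suc; _⊔_)
 import Data.Nat.Properties as ℕ
 open import Data.Integer.Base hiding (suc; _⊔_)
 open import Data.Integer.Properties hiding (⊔-sel; m≤m⊔n)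
 open import Data.Fin.Base using (Fin; zero; suc)
 open import Data.Product.Base using (Σ; ∃; _×_; _,_; proj₁; proj₂)
 open import Data.Sum.Base using (inj₁; inj₂)
 open import Data.Vec.Base using (Vec; []; _∷_; lookup)
 open import Function.Base using (_∘_)
 open import Relation.Binary.PropositionalEquality
 open import Relation.Nullary using (yes; no; contradiction)
 open import Relation.Nullary.Negation using (DoubleNegation)
 open import Data.Integer.Tactic.RingSolver using (solve-∀)

 ‖_‖ : ∀ {a} → Vec ℤ a → ℕ
 ‖ [] ‖    = 0
 ‖ p ∷ x ‖ = ∣ p ∣ ⊔ ‖ x ‖

 ∣lookup∣≤‖‖ : ∀ {a} (x : Vec ℤ a) i → ∣ lookup x i ∣ ℕ.≤ ‖ x ‖
 ∣lookup∣≤‖‖ (p ∷ x) zero    = ℕ.m≤m⊔n ∣ p ∣ ‖ x ‖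
 ∣lookup∣≤‖‖ (p ∷ x) (suc i) = ℕ.≤-trans (∣lookup∣≤‖‖ x i) (ℕ.m≤n⊔m ∣ p ∣ ‖ x ‖)

 ‖‖-least : ∀ {a} (x : Vec ℤ a) {N} → (∀ i → ∣ lookup x i ∣ ℕ.≤ N) → ‖ x ‖ ℕ.≤ N
 ‖‖-least []      h = ℕ.z≤n
 ‖‖-least (p ∷ x) h = ℕ.⊔-lub (h zero) (‖‖-least x (h ∘ suc))

 ‖‖-attained : ∀ {a} (x : Vec ℤ (suc a)) → ∃ λ i → ∣ lookup x i ∣ ≡ ‖ x ‖
 ‖‖-attained (p ∷ [])        = zero , sym (ℕ.⊔-identityʳ ∣ p ∣)
 ‖‖-attained (p ∷ x@(_ ∷ _)) with ℕ.⊔-sel ∣ p ∣ ‖ x ‖ | ‖‖-attained x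
 ... | inj₁ eq | _      = zero , sym eq
 ... | inj₂ eq | i , e  = suc i , trans e (sym eq)

 dot : ∀ {a} → Vec ℤ a → Vec ℤ a → ℤ
 dot []      []      = 0ℤ
 dot (p ∷ x) (q ∷ y) = p * q + dot x y

 euclidean : ∀ a → Form a
 euclidean a = record { B = dot ; B-sym = dot-sym ; B-⊕ = dot-⊕ ; B-⊙ = dot-⊙ ; B≥0 = dot≥0 }
   where
   dot-sym : ∀ {a} (x y : Vec ℤ a) → dot x y ≡ dot y x
   dot-sym []      []      = refl
   dot-sym (p ∷ x) (q ∷ y) = cong₂ _+_ (*-comm p q) (dot-sym x y)
   dot-⊕ : ∀ {a} (x y z : Vec ℤ a) → dot (x ⊕ y) z ≡ dot x z + dot y z
   dot-⊕ []      []      []      = refl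
   dot-⊕ (p ∷ x) (q ∷ y) (r ∷ z) = trans (cong (_+_ ((p + q) * r)) (dot-⊕ x y z)) (regroup p q r (dot x z) (dot y z))
     where
     regroup : ∀ p q r s t → (p + q) * r + (s + t) ≡ (p * r + s) + (q * r + t)
     regroup = solve-∀
   dot-⊙ : ∀ {a} c (x z : Vec ℤ a) → dot (c ⊙ x) z ≡ c * dot x z
   dot-⊙ c []      []      = sym (*-zeroʳ c)
   dot-⊙ c (p ∷ x) (r ∷ z) = trans (cong (_+_ (c * p * r)) (dot-⊙ c x z)) (regroup c p r (dot x z))
     where
     regroup : ∀ c p r s → c * p * r + c * s ≡ c * (p * r + s)
     regroup = solve-∀
   dot≥0 : ∀ {a} (x : Vec ℤ a) → 0ℤ ≤ dot x x
   dot≥0 []      = ≤-refl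
   dot≥0 (p ∷ x) = +-mono-≤ (square≥0 p) (dot≥0 x)

 square : ∀ p → p * p ≡ + (∣ p ∣ ℕ.* ∣ p ∣)
 square (+ n)    = sym (pos-* n n)
 square -[1+ n ] = refl

 norm² : ∀ {a} → Vec ℤ a → ℕ
 norm² []      = 0
 norm² (p ∷ x) = ∣ p ∣ ℕ.* ∣ p ∣ ℕ.+ norm² x

 dot-norm² : ∀ {a} (x : Vec ℤ a) → dot x x ≡ + norm² x
 dot-norm² []      = refl
 dot-norm² (p ∷ x) = trans (cong₂ _+_ (square p) (dot-norm² x)) (sym (pos-+ (∣ p ∣ ℕ.* ∣ p ∣) (norm² x)))

 norm²-lower : ∀ {a} (x : Vec ℤ a) → ‖ x ‖ ℕ.* ‖ x ‖ ℕ.≤ norm² x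
 norm²-lower []      = ℕ.z≤n
 norm²-lower (p ∷ x) with ℕ.⊔-sel ∣ p ∣ ‖ x ‖
 ... | inj₁ eq rewrite eq = ℕ.m≤m+n _ (norm² x)
 ... | inj₂ eq rewrite eq = ℕ.≤-trans (norm²-lower x) (ℕ.m≤n+m (norm² x) _)

 norm²-upper : ∀ {a} (x : Vec ℤ a) {N} → ‖ x ‖ ℕ.≤ N → norm² x ℕ.≤ a ℕ.* (N ℕ.* N)
 norm²-upper []      h = ℕ.z≤n
 norm²-upper (p ∷ x) h = ℕ.+-mono-≤ (ℕ.*-mono-≤ p≤ p≤) (norm²-upper x (ℕ.m⊔n≤o⇒n≤o ∣ p ∣ ‖ x ‖ h))
   where p≤ = ℕ.m⊔n≤o⇒m≤o ∣ p ∣ ‖ x ‖ h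

 square-cancel-≤ : ∀ {m n} → m ℕ.* m ℕ.≤ n ℕ.* n → m ℕ.≤ n
 square-cancel-≤ {m} {n} h with m ℕ.≤? n
 ... | yes p = p
 ... | no ¬p = contradiction h (ℕ.<⇒≱ (ℕ.*-mono-< (ℕ.≰⇒> ¬p) (ℕ.≰⇒> ¬p)))

 SupReduced : ∀ {a b} → ℕ → Vec (Vec ℤ a) b → Set
 SupReduced K u = ∀ c i → ∣ lookup c i ∣ ℕ.* ‖ lookup u i ‖ ℕ.≤ K ℕ.* ‖ lin c u ‖

 supConstant : ℕ → ℕ → ℕ
 supConstant a b = reductionConstant b ℕ.* a

 sup-reduced : ∀ {a b} C (u : Vec (Vec ℤ a) b) → Reduced (euclidean a) C u → SupReduced (C ℕ.* a) u
 sup-reduced {a} C u red c i = square-cancel-≤ (begin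
   (m ℕ.* n) ℕ.* (m ℕ.* n)         ≡⟨ ℕ.[m*n]*[o*p]≡[m*o]*[n*p] m n m n ⟩
   (m ℕ.* m) ℕ.* (n ℕ.* n)         ≤⟨ ℕ.*-monoʳ-≤ (m ℕ.* m) (norm²-lower (lookup u i)) ⟩
   (m ℕ.* m) ℕ.* norm² (lookup u i) ≤⟨ drop‿+≤+ (subst₂ _≤_ left right (red c i)) ⟩
   C ℕ.* norm² (lin c u)           ≤⟨ ℕ.*-monoʳ-≤ C (norm²-upper (lin c u) ℕ.≤-refl) ⟩
   C ℕ.* (a ℕ.* (N ℕ.* N))         ≡⟨ ℕ.*-assoc C a (N ℕ.* N) ⟨
   -- Enlarging `C * a` to its square makes the right side a perfect square, so that the squares can
   -- be cancelled.
   C ℕ.* a ℕ.* (N ℕ.* N)           ≤⟨ ℕ.*-monoˡ-≤ (N ℕ.* N) (self (C ℕ.* a)) ⟩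
   (C ℕ.* a) ℕ.* (C ℕ.* a) ℕ.* (N ℕ.* N) ≡⟨ ℕ.[m*n]*[o*p]≡[m*o]*[n*p] (C ℕ.* a) (C ℕ.* a) N N ⟩
   (C ℕ.* a ℕ.* N) ℕ.* (C ℕ.* a ℕ.* N) ∎)
   where
   open ℕ.≤-Reasoning
   m = ∣ lookup c i ∣
   n = ‖ lookup u i ‖
   N = ‖ lin c u ‖
   left : lookup c i * lookup c i * dot (lookup u i) (lookup u i) ≡ + (m ℕ.* m ℕ.* norm² (lookup u i))
   left = trans (cong₂ _*_ (square (lookup c i)) (dot-norm² (lookup u i))) (sym (pos-* (m ℕ.* m) _))
   right : + C * dot (lin c u) (lin c u) ≡ + (C ℕ.* norm² (lin c u))
   right = trans (cong (_*_ (+ C)) (dot-norm² (lin c u))) (sym (pos-* C _))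
   self : ∀ k → k ℕ.≤ k ℕ.* k
   self zero    = ℕ.z≤n
   self (suc k) = ℕ.m≤m*n (suc k) (suc k)

 sup-reduction : ∀ {a b} (w : Vec (Vec ℤ a) b) →
                 DoubleNegation (Σ (Vec (Vec ℤ a) b) λ u → u ≅ w × SupReduced (supConstant a b) u)
 sup-reduction {a} {b} w k = reduction b (euclidean a) w λ (u , u≅w , red) →
   k (u , u≅w , sup-reduced (reductionConstant b) u red)

-- Integer vectors in the real span of k directions.

module RealDependence where

 open import Defs
 open Rationals
 open IntegerVectors
 open SupNorm using (‖_‖; SupReduced; ‖‖-least)
 open import Algebra.Bundles using (CommutativeRing)
 import Algebra.Properties.Semiring.Sum as Sum
 open import Data.Nat.Base as ℕ using (ℕ; zero; suc)
 import Data.Nat.Properties as ℕ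
 import Data.Nat.DivMod as ℕ
 open import Data.Integer.Base as ℤ using (ℤ; +_; 0ℤ)
 import Data.Integer.Properties as ℤ
 open import Data.Rational.Base as ℚ hiding (_⊔_)
 open import Data.Rational.Properties
 open import Data.Rational.Solver using (module +-*-Solver)
 open import Data.Fin.Base using (Fin; zero; suc; punchIn)
 open import Data.Fin.Properties using (punchInᵢ≢i; punchIn-injective; suc-injective)
 open import Data.Product.Base using (∃; _×_; _,_; proj₁; proj₂)
 open import Data.Sum.Base using (_⊎_; inj₁; inj₂)
 open import Data.Vec.Base using (Vec; []; _∷_; lookup)
 open import Data.Vec.Functional using (Vector)
 open import Function.Base using (_∘_)
 open import Function.Definitions using (Injective)
 open import Relation.Binary.PropositionalEquality
 open import Relation.Nullary using (¬_; Dec; yes; no; contradiction)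

 module Rᴿ = CommutativeRing ℝ-commutativeRing
 module Σᴿ = Sum Rᴿ.semiring
 module Σℚ = Sum (CommutativeRing.semiring +-*-commutativeRing)

 open +-*-Solver using (solve; _:+_; _:*_; :-_; _:-_; _:=_)

 OnDirections : ∀ {k d} → (Fin k → Vector ℝ d) → Vec ℤ d → Set
 OnDirections D x = ∃ λ t → ∀ j → fromℚ (ι (lookup x j)) ≈ᴿ combination t D j

 fromℚ-cong : ∀ {p q} → p ≡ q → fromℚ p ≈ᴿ fromℚ q
 fromℚ-cong {p} refl = Rᴿ.refl {fromℚ p}

 span-onDirections : ∀ {k d b} (D : Fin k → Vector ℝ d) {w : Vec (Vec ℤ d) b} →
                     (∀ i → OnDirections D (lookup w i)) → ∀ {x} → Span w x → OnDirections D x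
 span-onDirections {k} D h span-𝟎 = (λ _ → 0ᴿ) , λ j → begin
   fromℚ (ι (lookup 𝟎 j))      ≈⟨ fromℚ-cong (cong ι (lookup-𝟎 j)) ⟩
   0ᴿ                          ≈⟨ Σᴿ.sum-replicate-zero k ⟨
   ∑ᴿ {k} (λ _ → 0ᴿ)           ≈⟨ Σᴿ.sum-cong-≋ (λ i → Rᴿ.sym {0ᴿ *ᴿ D i j} {0ᴿ} (Rᴿ.zeroˡ (D i j))) ⟩
   combination (λ _ → 0ᴿ) D j  ∎
   where open import Relation.Binary.Reasoning.Setoid Rᴿ.setoid
 span-onDirections D h (span-⊕ {x} {y} p q) with span-onDirections D h p | span-onDirections D h q
 ... | s , hs | t , ht = (λ i → s i +ᴿ t i) , λ j → begin
   fromℚ (ι (lookup (x ⊕ y) j))                            ≈⟨ fromℚ-cong (trans (cong ι (lookup-⊕ x y j)) (ι-+ (lookup x j) (lookup y j))) ⟩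
   fromℚ (ι (lookup x j) + ι (lookup y j))                 ≈⟨ ≗⇒≈ᴿ (fromℚ (ι (lookup x j) + ι (lookup y j))) (fromℚ (ι (lookup x j)) +ᴿ fromℚ (ι (lookup y j))) (λ _ → refl) ⟩
   fromℚ (ι (lookup x j)) +ᴿ fromℚ (ι (lookup y j))        ≈⟨ Rᴿ.+-cong {fromℚ (ι (lookup x j))} {combination s D j} {fromℚ (ι (lookup y j))} {combination t D j} (hs j) (ht j) ⟩
   combination s D j +ᴿ combination t D j                  ≈⟨ Σᴿ.∑-distrib-+ (λ i → s i *ᴿ D i j) (λ i → t i *ᴿ D i j) ⟨
   ∑ᴿ (λ i → s i *ᴿ D i j +ᴿ t i *ᴿ D i j)                 ≈⟨ Σᴿ.sum-cong-≋ (λ i → Rᴿ.sym {(s i +ᴿ t i) *ᴿ D i j} {s i *ᴿ D i j +ᴿ t i *ᴿ D i j} (Rᴿ.distribʳ (D i j) (s i) (t i))) ⟩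
   combination (λ i → s i +ᴿ t i) D j                      ∎
   where open import Relation.Binary.Reasoning.Setoid Rᴿ.setoid
 span-onDirections D h (span-⊙ c {x} p) with span-onDirections D h p
 ... | s , hs = (λ i → fromℚ (ι c) *ᴿ s i) , λ j → begin
   fromℚ (ι (lookup (c ⊙ x) j))                       ≈⟨ fromℚ-cong (trans (cong ι (lookup-⊙ c x j)) (ι-* c (lookup x j))) ⟩
   fromℚ (ι c * ι (lookup x j))                       ≈⟨ ≗⇒≈ᴿ (fromℚ (ι c * ι (lookup x j))) (fromℚ (ι c) *ᴿ fromℚ (ι (lookup x j))) (λ _ → refl) ⟩
   fromℚ (ι c) *ᴿ fromℚ (ι (lookup x j))              ≈⟨ Rᴿ.*-cong {fromℚ (ι c)} {fromℚ (ι c)} {fromℚ (ι (lookup x j))} {combination s D j} (Rᴿ.refl {fromℚ (ι c)}) (hs j) ⟩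
   fromℚ (ι c) *ᴿ combination s D j                   ≈⟨ Σᴿ.*-distribˡ-sum (fromℚ (ι c)) (λ i → s i *ᴿ D i j) ⟩
   ∑ᴿ (λ i → fromℚ (ι c) *ᴿ (s i *ᴿ D i j))           ≈⟨ Σᴿ.sum-cong-≋ (λ i → Rᴿ.sym {fromℚ (ι c) *ᴿ s i *ᴿ D i j} {fromℚ (ι c) *ᴿ (s i *ᴿ D i j)} (Rᴿ.*-assoc (fromℚ (ι c)) (s i) (D i j))) ⟩
   combination (λ i → fromℚ (ι c) *ᴿ s i) D j         ∎
   where open import Relation.Binary.Reasoning.Setoid Rᴿ.setoid
 span-onDirections D h (span-gen i) = h i

 seq-∑ : ∀ {k} (f : Vector ℝ k) n → seq (∑ᴿ f) n ≡ Σℚ.sum (λ i → seq (f i) n)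
 seq-∑ {zero}  f n = refl
 seq-∑ {suc k} f n = cong (_+_ (seq (f zero) n)) (seq-∑ (f ∘ suc) n)

 uniformly : ∀ {s} {P : Fin s → ℕ → Set} → (∀ i → ∃ λ N → ∀ n → N ℕ.≤ n → P i n) →
             ∃ λ N → ∀ n → N ℕ.≤ n → ∀ i → P i n
 uniformly {zero}  h = 0 , λ _ _ ()
 uniformly {suc s} h with h zero | uniformly (h ∘ suc)
 ... | N , p | M , q = N ℕ.⊔ M , λ n le →
   λ { zero → p n (ℕ.m⊔n≤o⇒m≤o N M le) ; (suc i) → q n (ℕ.m⊔n≤o⇒n≤o N M le) i }

 -- The finitely many real equations hold up to `ε` at one common index `N`, and the terms at that
 -- index give `τ` and `E`. As the real operations are pointwise, the approximations still factor
 -- exactly through k coordinates.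
 rational-approximation : ∀ {k d s} (D : Fin k → Vector ℝ d) (u : Vec (Vec ℤ d) s) → (∀ i → OnDirections D (lookup u i)) →
   ∀ ε → .{{Positive ε}} → ∃ λ (τ : Fin s → Fin k → ℚ) → ∃ λ (E : Fin k → Fin d → ℚ) →
   ∀ i j → ∣ ι (lookup (lookup u i) j) - Σℚ.sum (λ t → τ i t * E t j) ∣ ≤ ε
 rational-approximation D u h ε with uniformly (λ i → uniformly (λ j → proj₂ (h i) j ε))
 ... | N , close = (λ i t → seq (proj₁ (h i) t) N) , (λ t j → seq (D t j) N) , λ i j →
   subst (λ s → ∣ ι (lookup (lookup u i) j) - s ∣ ≤ ε) (seq-∑ (λ t → proj₁ (h i) t *ᴿ D t j) N)
     (<⇒≤ (close N ℕ.≤-refl i j))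

 record Functional (s : ℕ) : Set where
   field
     φ   : Vec ℤ s → ℚ
     φ-⊕ : ∀ x y → φ (x ⊕ y) ≡ φ x + φ y
     φ-⊙ : ∀ c x → φ (c ⊙ x) ≡ ι c * φ x

 open Functional

 lookup-unit-≢ : ∀ {b} (i j : Fin b) → i ≢ j → lookup (unit j) i ≡ 0ℤ
 lookup-unit-≢ zero    zero    i≢j = contradiction refl i≢j
 lookup-unit-≢ (suc i) zero    i≢j = lookup-𝟎 i
 lookup-unit-≢ zero    (suc j) i≢j = refl
 lookup-unit-≢ (suc i) (suc j) i≢j = lookup-unit-≢ i j (i≢j ∘ cong suc)

 -- k functionals have a common nontrivial zero supported on any k + 1 coordinates: combine two
 -- zeros of the last k functionals, one of which avoids a coordinate where the other is nonzero.
 dependence : ∀ k {s} (f : Fin k → Functional s) (e : Fin (suc k) → Fin s) → Injective _≡_ _≡_ e →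
              ∃ λ x → (∀ i → (∀ l → i ≢ e l) → lookup x i ≡ 0ℤ) × (∃ λ l → lookup x (e l) ≢ 0ℤ) ×
              (∀ t → φ (f t) x ≡ 0ℚ)
 dependence zero f e inj = unit (e zero) , (λ i h → lookup-unit-≢ i (e zero) (h zero)) ,
   (zero , λ p → contradiction (trans (sym (lookup-unit (e zero))) p) λ ()) , λ ()
 dependence (suc k) {s} f e inj with dependence k (f ∘ suc) (e ∘ suc) (suc-injective ∘ inj)
 ... | x , x-supp , (l , xₗ≢0) , fx≡0
   with dependence k (f ∘ suc) (e ∘ punchIn (suc l)) (punchIn-injective (suc l) _ _ ∘ inj)
 ... | y , y-supp , (m , yₘ≢0) , fy≡0 = combine (φ f₀ x ≟ 0ℚ) (φ f₀ y ≟ 0ℚ)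
   where
   f₀ = f zero
   Goal : Set
   Goal = ∃ λ x → (∀ i → (∀ l → i ≢ e l) → lookup x i ≡ 0ℤ) × (∃ λ l → lookup x (e l) ≢ 0ℤ) ×
          (∀ t → φ (f t) x ≡ 0ℚ)
   a = φ f₀ x
   b = φ f₀ y
   yₗ≡0 : lookup y (e (suc l)) ≡ 0ℤ
   yₗ≡0 = y-supp (e (suc l)) λ m eq → punchInᵢ≢i (suc l) m (sym (inj eq))
   c c′ : ℤ
   c  = ↥ b ℤ.* ↧ a
   c′ = ℤ.- (↥ a ℤ.* ↧ b)
   z = c ⊙ x ⊕ c′ ⊙ y
   lookup-z : ∀ i → lookup z i ≡ c ℤ.* lookup x i ℤ.+ c′ ℤ.* lookup y i
   lookup-z i = trans (lookup-⊕ (c ⊙ x) (c′ ⊙ y) i) (cong₂ ℤ._+_ (lookup-⊙ c x i) (lookup-⊙ c′ y i))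
   φ-z : ∀ t → φ (f t) z ≡ ι c * φ (f t) x + ι c′ * φ (f t) y
   φ-z t = trans (φ-⊕ (f t) (c ⊙ x) (c′ ⊙ y)) (cong₂ _+_ (φ-⊙ (f t) c x) (φ-⊙ (f t) c′ y))
   kills₀ : ι c * a + ι c′ * b ≡ 0ℚ
   kills₀ = trans (cong₂ (λ s t → s * a + t * b)
       (trans (ι-* (↥ b) (↧ a)) (cong (_* ι (↧ a)) (↥≡p*↧ b)))
       (trans (ι-neg (↥ a ℤ.* ↧ b)) (cong (λ s → - s) (trans (ι-* (↥ a) (↧ b)) (cong (_* ι (↧ b)) (↥≡p*↧ a))))))
     (cancel a b (ι (↧ a)) (ι (↧ b)))
     where
     cancel : ∀ a b p q → b * q * p * a + - (a * p * q) * b ≡ 0ℚ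
     cancel a b p q = trans (regroup a b p q) (+-inverseʳ (b * q * p * a))
       where
       regroup : ∀ a b p q → b * q * p * a + - (a * p * q) * b ≡ b * q * p * a - b * q * p * a
       regroup = solve 4 (λ a b p q → b :* q :* p :* a :+ :- (a :* p :* q) :* b := b :* q :* p :* a :- b :* q :* p :* a) refl
   zero+zero : ∀ p q {s t} → s ≡ 0ℚ → t ≡ 0ℚ → p * s + q * t ≡ 0ℚ
   zero+zero p q refl refl = cong₂ _+_ (*-zeroʳ p) (*-zeroʳ q)
   z-supp : ∀ i → (∀ l → i ≢ e l) → lookup z i ≡ 0ℤ
   z-supp i h = trans (lookup-z i) (trans
     (cong₂ (λ s t → c ℤ.* s ℤ.+ c′ ℤ.* t) (x-supp i (h ∘ suc)) (y-supp i (h ∘ punchIn (suc l))))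
     (cong₂ ℤ._+_ (ℤ.*-zeroʳ c) (ℤ.*-zeroʳ c′)))
   combine : Dec (a ≡ 0ℚ) → Dec (b ≡ 0ℚ) → Goal
   combine (yes a≡0) _ = x , (λ i h → x-supp i (h ∘ suc)) , (suc l , xₗ≢0) ,
     λ { zero → a≡0 ; (suc t) → fx≡0 t }
   combine (no _) (yes b≡0) = y , (λ i h → y-supp i (h ∘ punchIn (suc l))) , (punchIn (suc l) m , yₘ≢0) ,
     λ { zero → b≡0 ; (suc t) → fy≡0 t }
   combine (no _) (no b≢0) = z , z-supp , (suc l , zₗ≢0) ,
     λ { zero → trans (φ-z zero) kills₀ ; (suc t) → trans (φ-z (suc t)) (zero+zero (ι c) (ι c′) (fx≡0 t) (fy≡0 t)) }
     where
     zₗ≢0 : lookup z (e (suc l)) ≢ 0ℤ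
     zₗ≢0 eq with ℤ.i*j≡0⇒i≡0∨j≡0 c {lookup x (e (suc l))} (trans (sym (trans (lookup-z (e (suc l)))
       (trans (cong (λ s → c ℤ.* lookup x (e (suc l)) ℤ.+ c′ ℤ.* s) yₗ≡0)
         (trans (cong (ℤ._+_ (c ℤ.* lookup x (e (suc l)))) (ℤ.*-zeroʳ c′)) (ℤ.+-identityʳ _))))) eq)
     ... | inj₂ p = xₗ≢0 p
     ... | inj₁ p with ℤ.i*j≡0⇒i≡0∨j≡0 (↥ b) {↧ a} p
     ... | inj₁ r = b≢0 (↥p≡0⇒p≡0 b r)
     ... | inj₂ ()

 ℓ₁ : ∀ {s} → Vec ℤ s → ℕ
 ℓ₁ []      = 0
 ℓ₁ (c ∷ x) = ℤ.∣ c ∣ ℕ.+ ℓ₁ x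

 ∣lookup∣≤ℓ₁ : ∀ {s} (x : Vec ℤ s) i → ℤ.∣ lookup x i ∣ ℕ.≤ ℓ₁ x
 ∣lookup∣≤ℓ₁ (c ∷ x) zero    = ℕ.m≤m+n ℤ.∣ c ∣ (ℓ₁ x)
 ∣lookup∣≤ℓ₁ (c ∷ x) (suc i) = ℕ.≤-trans (∣lookup∣≤ℓ₁ x i) (ℕ.m≤n+m (ℓ₁ x) ℤ.∣ c ∣)

 ℓ₁-≤ : ∀ {s} (x : Vec ℤ s) {N} → (∀ i → ℤ.∣ lookup x i ∣ ℕ.≤ N) → ℓ₁ x ℕ.≤ s ℕ.* N
 ℓ₁-≤ []      h = ℕ.z≤n
 ℓ₁-≤ (c ∷ x) h = ℕ.+-mono-≤ (h zero) (ℓ₁-≤ x (h ∘ suc))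

 lin-approximation : ∀ {d s} (u : Vec (Vec ℤ d) s) (v : Fin s → ℚ) j ε → (∀ i → ∣ ι (lookup (lookup u i) j) - v i ∣ ≤ ε) →
   ∀ x → ∣ ι (lookup (lin x u) j) - Σℚ.sum (λ i → ι (lookup x i) * v i) ∣ ≤ ι (+ ℓ₁ x) * ε
 lin-approximation {d} [] v j ε h [] =
   ≤-reflexive (trans (cong (λ z → ∣ ι z - 0ℚ ∣) (lookup-𝟎 j)) (sym (*-zeroˡ ε)))
 lin-approximation (w ∷ u) v j ε h (c ∷ x) = begin
   ∣ ι (lookup (c ⊙ w ⊕ lin x u) j) - (ι c * v zero + S) ∣
     ≡⟨ cong (λ z → ∣ z - (ι c * v zero + S) ∣) (trans (cong ι (trans (lookup-⊕ (c ⊙ w) (lin x u) j)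
          (cong (ℤ._+ lookup (lin x u) j) (lookup-⊙ c w j))))
          (trans (ι-+ (c ℤ.* lookup w j) _) (cong (_+ L) (ι-* c (lookup w j))))) ⟩
   ∣ ι c * W + L - (ι c * v zero + S) ∣          ≡⟨ cong ∣_∣ (regroup (ι c) W L (v zero) S) ⟩
   ∣ ι c * (W - v zero) + (L - S) ∣              ≤⟨ ∣p+q∣≤∣p∣+∣q∣ (ι c * (W - v zero)) (L - S) ⟩
   ∣ ι c * (W - v zero) ∣ + ∣ L - S ∣            ≡⟨ cong (_+ ∣ L - S ∣) (trans (∣p*q∣≡∣p∣*∣q∣ (ι c) (W - v zero)) (cong (_* ∣ W - v zero ∣) (ι-∣∣ c))) ⟩
   C * ∣ W - v zero ∣ + ∣ L - S ∣                ≤⟨ +-mono-≤ (*-monoˡ-≤-nonNeg C {{ι-nonNeg ℤ.∣ c ∣}} (h zero)) (lin-approximation u (v ∘ suc) j ε (h ∘ suc) x) ⟩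
   C * ε + ι (+ ℓ₁ x) * ε                        ≡⟨ *-distribʳ-+ ε C (ι (+ ℓ₁ x)) ⟨
   (C + ι (+ ℓ₁ x)) * ε                          ≡⟨ cong (_* ε) (ι-+ (+ ℤ.∣ c ∣) (+ ℓ₁ x)) ⟨
   ι (+ (ℤ.∣ c ∣ ℕ.+ ℓ₁ x)) * ε                  ∎
   where
   open ≤-Reasoning
   W = ι (lookup w j)
   L = ι (lookup (lin x u) j)
   C = ι (+ ℤ.∣ c ∣)
   S = Σℚ.sum (λ i → ι (lookup x i) * v (suc i))
   regroup : ∀ c w l v s → c * w + l - (c * v + s) ≡ c * (w - v) + (l - s)
   regroup = solve 5 (λ c w l v s → c :* w :+ l :- (c :* v :+ s) := c :* (w :- v) :+ (l :- s)) refl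

 weighted-sum : ∀ {s} → (Fin s → ℚ) → Functional s
 weighted-sum τ = record
   { φ   = λ x → Σℚ.sum (λ i → ι (lookup x i) * τ i)
   ; φ-⊕ = λ x y → trans (Σℚ.sum-cong-≗ λ i → trans (cong (λ z → ι z * τ i) (lookup-⊕ x y i))
              (trans (cong (_* τ i) (ι-+ (lookup x i) (lookup y i))) (*-distribʳ-+ (τ i) (ι (lookup x i)) (ι (lookup y i)))))
              (Σℚ.∑-distrib-+ (λ i → ι (lookup x i) * τ i) (λ i → ι (lookup y i) * τ i))
   ; φ-⊙ = λ c x → trans (Σℚ.sum-cong-≗ λ i → trans (cong (λ z → ι z * τ i) (lookup-⊙ c x i))
              (trans (cong (_* τ i) (ι-* c (lookup x i))) (*-assoc (ι c) (ι (lookup x i)) (τ i))))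
              (sym (Σℚ.*-distribˡ-sum (ι c) (λ i → ι (lookup x i) * τ i)))
   }

 -- Reducedness bounds the coefficients of an exact dependency of approximate coordinates by the
 -- approximation error, which is absurd once the error is small.
 few-nonzero : ∀ {k d s} K (D : Fin k → Vector ℝ d) (u : Vec (Vec ℤ d) s) → SupReduced K u →
   (∀ i → OnDirections D (lookup u i)) → (e : Fin (suc k) → Fin s) → Injective _≡_ _≡_ e →
   (∀ i → (∃ λ l → i ≡ e l) ⊎ (∀ l → i ≢ e l)) → ¬ (∀ l → ‖ lookup u (e l) ‖ ≢ 0)
 few-nonzero {k} {d} {s} K D u red onD e inj e? nz
   with rational-approximation D u onD (recip (s ℕ.* K)) {{recip-pos (s ℕ.* K)}}
 ... | τ , E , close with dependence k (λ t → weighted-sum (λ i → τ i t)) e inj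
 ... | x , supp , (l , xₗ≢0) , zeros = contradiction (ℕ.≤-trans (∣lookup∣≤ℓ₁ x (e l)) A≤0)
         (λ le → xₗ≢0 (ℤ.∣i∣≡0⇒i≡0 (ℕ.n≤0⇒n≡0 le)))
   where
   M = s ℕ.* K
   A = ℓ₁ x
   N = ‖ lin x u ‖
   vanish : ∀ j → Σℚ.sum (λ i → ι (lookup x i) * Σℚ.sum (λ t → τ i t * E t j)) ≡ 0ℚ
   vanish j = begin
     Σℚ.sum (λ i → ι (lookup x i) * Σℚ.sum (λ t → τ i t * E t j))
       ≡⟨ Σℚ.sum-cong-≗ (λ i → trans (Σℚ.*-distribˡ-sum (ι (lookup x i)) (λ t → τ i t * E t j))
            (Σℚ.sum-cong-≗ λ t → sym (*-assoc (ι (lookup x i)) (τ i t) (E t j)))) ⟩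
     Σℚ.sum (λ i → Σℚ.sum (λ t → ι (lookup x i) * τ i t * E t j))
       ≡⟨ Σℚ.∑-comm (λ i t → ι (lookup x i) * τ i t * E t j) ⟩
     Σℚ.sum (λ t → Σℚ.sum (λ i → ι (lookup x i) * τ i t * E t j))
       ≡⟨ Σℚ.sum-cong-≗ (λ t → trans (sym (Σℚ.*-distribʳ-sum (E t j) (λ i → ι (lookup x i) * τ i t)))
            (trans (cong (_* E t j) (zeros t)) (*-zeroˡ (E t j)))) ⟩
     Σℚ.sum {k} (λ t → 0ℚ)
       ≡⟨ Σℚ.sum-replicate-zero k ⟩
     0ℚ ∎
     where open ≡-Reasoning
   small : ∀ j → ℤ.∣ lookup (lin x u) j ∣ ℕ.* suc M ℕ.≤ A
   small j = ℤ.drop‿+≤+ (ι-cancel-≤ (begin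
     ι (+ (m ℕ.* suc M))                        ≡⟨ trans (cong ι (ℤ.pos-* m (suc M))) (ι-* (+ m) (+ suc M)) ⟩
     ι (+ m) * ι (+ suc M)                      ≡⟨ cong (_* ι (+ suc M)) (ι-∣∣ (lookup (lin x u) j)) ⟨
     ∣ ι (lookup (lin x u) j) ∣ * ι (+ suc M)   ≤⟨ *-monoʳ-≤-nonNeg (ι (+ suc M)) {{ι-nonNeg (suc M)}}
         (subst (λ z → ∣ z ∣ ≤ ι (+ A) * recip M) (trans (cong (λ z → ι (lookup (lin x u) j) - z) (vanish j)) (+-identityʳ (ι (lookup (lin x u) j))))
           (lin-approximation u _ j (recip M) (λ i → close i j) x)) ⟩
     ι (+ A) * recip M * ι (+ suc M)            ≡⟨ trans (*-assoc (ι (+ A)) (recip M) (ι (+ suc M)))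
                                                     (trans (cong (_*_ (ι (+ A))) (recip-inverse M)) (*-identityʳ (ι (+ A)))) ⟩
     ι (+ A)                                    ∎))
     where
     open ≤-Reasoning
     m = ℤ.∣ lookup (lin x u) j ∣
   coefficient : ∀ i → ℤ.∣ lookup x i ∣ ℕ.≤ K ℕ.* N
   coefficient i with e? i
   ... | inj₂ out rewrite supp i out = ℕ.z≤n
   ... | inj₁ (l , refl) = ℕ.≤-trans (ℕ.m≤m*n ℤ.∣ lookup x (e l) ∣ ‖ lookup u (e l) ‖ {{ℕ.≢-nonZero (nz l)}}) (red x (e l))
   A≤MN : A ℕ.≤ M ℕ.* N
   A≤MN = ℕ.≤-trans (ℓ₁-≤ x coefficient) (ℕ.≤-reflexive (sym (ℕ.*-assoc s K N)))
   N*≤A : N ℕ.* suc M ℕ.≤ A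
   N*≤A = ℕ.≤-trans (ℕ.*-monoˡ-≤ (suc M) (‖‖-least (lin x u) {A ℕ./ suc M} λ j →
     subst (ℕ._≤ A ℕ./ suc M) (ℕ.m*n/n≡m _ (suc M)) (ℕ./-monoˡ-≤ (suc M) (small j)))) (ℕ.m/n*n≤m A (suc M))
   -- The tolerance was `recip M`, that is 1 / (M + 1), so that the lower bound (M + 1) N and the
   -- upper bound M N for `A` leave only `N = 0`.
   N≡0 : N ≡ 0
   N≡0 = ℕ.n≤0⇒n≡0 (ℕ.+-cancelʳ-≤ (M ℕ.* N) N 0 (subst (ℕ._≤ M ℕ.* N) (ℕ.*-comm N (suc M)) (ℕ.≤-trans N*≤A A≤MN)))
   A≤0 : A ℕ.≤ 0
   A≤0 = subst (A ℕ.≤_) (trans (cong (M ℕ.*_) N≡0) (ℕ.*-zeroʳ M)) A≤MN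

-- Difference matrices as short sums of rank-one terms.

module Factorization where

 open import Defs using (ℝ)
 open IntegerVectors
 open SupNorm
 open RealDependence using (OnDirections; span-onDirections; few-nonzero)
 open import Data.Nat.Base as ℕ using (ℕ; zero; suc)
 import Data.Nat.Properties as ℕ
 open import Data.Integer.Base hiding (suc)
 open import Data.Integer.Properties hiding (_≟_)
 open import Data.Integer.DivMod using (_/_; _%_; a≡a%n+[a/n]*n; n%d<d)
 open import Data.Integer.Tactic.RingSolver using (solve-∀)
 open import Data.Fin.Base using (Fin; zero; suc; inject≤)
 open import Data.Fin.Properties using (any?; inject≤-injective) renaming (_≟_ to _≟ᶠ_)
 open import Data.List.Base as List using (List; []; _∷_; length; filter; allFin)
 open import Data.List.Properties using (length-map; map-tabulate)
 open import Data.List.Membership.Propositional.Properties using (∈-filter⁻; ∈-lookup)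
 open import Data.List.Relation.Unary.All as All using (All; []; _∷_)
 import Data.List.Relation.Unary.All.Properties as All
 open import Data.List.Relation.Unary.AllPairs using ([]; _∷_)
 open import Data.List.Relation.Unary.Unique.Propositional using (Unique)
 import Data.List.Relation.Unary.Unique.Propositional.Properties as Unique
 open import Data.List.Relation.Binary.Permutation.Propositional using (_↭_; refl; prep; swap; trans)
 open import Data.Product.Base using (Σ; ∃; _×_; _,_; proj₁; proj₂)
 open import Data.Sum.Base using (_⊎_; inj₁; inj₂)
 open import Data.Vec.Base using (Vec; []; _∷_; lookup; tabulate)
 open import Data.Vec.Functional using (Vector)
 open import Data.Vec.Properties using (lookup∘tabulate)
 open import Function.Base using (_∘_)
 open import Relation.Binary.PropositionalEquality as ≡ hiding (trans)
 open import Relation.Nullary using (Dec; yes; no; contradiction)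
 open import Relation.Nullary.Decidable using (¬?; _×-dec_)
 open import Relation.Nullary.Negation using (DoubleNegation)

 Pair : ℕ → ℕ → Set
 Pair a b = Vec ℤ a × Vec ℤ b

 -- The entries of the matrix ∑ x yᵀ.
 entry : ∀ {a b} → List (Pair a b) → Fin a → Fin b → ℤ
 entry []             i j = 0ℤ
 entry ((x , y) ∷ ps) i j = lookup x i * lookup y j + entry ps i j

 entry-↭ : ∀ {a b} {ps qs : List (Pair a b)} → ps ↭ qs → ∀ i j → entry ps i j ≡ entry qs i j
 entry-↭ refl                       i j = refl
 entry-↭ (prep (x , y) p)           i j = cong (_+_ (lookup x i * lookup y j)) (entry-↭ p i j)
 entry-↭ (swap (x , y) (z , t) p)   i j = ≡.trans (cong (λ e → lookup x i * lookup y j + (lookup z i * lookup t j + e)) (entry-↭ p i j))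
   (exchange (lookup x i * lookup y j) (lookup z i * lookup t j) _)
   where
   exchange : ∀ p q r → p + (q + r) ≡ q + (p + r)
   exchange = solve-∀
 entry-↭ (trans p q)                i j = ≡.trans (entry-↭ p i j) (entry-↭ q i j)

 Good : ∀ {a b} → ℕ → Pair a b → Set
 Good X (x , y) = ‖ x ‖ ≢ 0 × ‖ y ‖ ≢ 0 × ‖ x ‖ ℕ.* ‖ y ‖ ℕ.≤ X

 Nonzero : ∀ {a b} → Pair a b → Set
 Nonzero (x , y) = ‖ x ‖ ≢ 0 × ‖ y ‖ ≢ 0

 abstract
   nonzero? : ∀ {a b} (p : Pair a b) → Dec (Nonzero p)
   nonzero? (x , y) = ¬? (‖ x ‖ ℕ.≟ 0) ×-dec ¬? (‖ y ‖ ℕ.≟ 0)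

 private
   lookup≡0 : ∀ {a} (x : Vec ℤ a) → ‖ x ‖ ≡ 0 → ∀ i → lookup x i ≡ 0ℤ
   lookup≡0 x eq i = ∣i∣≡0⇒i≡0 (ℕ.n≤0⇒n≡0 (subst (∣ lookup x i ∣ ℕ.≤_) eq (∣lookup∣≤‖‖ x i)))

 entry-filter : ∀ {A : Set} {a b} (f : A → Pair a b) (xs : List A) i j →
                entry (List.map f (filter (nonzero? ∘ f) xs)) i j ≡ entry (List.map f xs) i j
 entry-filter f []       i j = refl
 entry-filter f (x ∷ xs) i j with nonzero? (f x)
 ... | yes _ = cong (_+_ (lookup (proj₁ (f x)) i * lookup (proj₂ (f x)) j)) (entry-filter f xs i j)
 ... | no ¬nz = ≡.trans (entry-filter f xs i j) (sym (≡.trans (cong (_+ entry (List.map f xs) i j) term≡0) (+-identityˡ _)))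
   where
   term≡0 : lookup (proj₁ (f x)) i * lookup (proj₂ (f x)) j ≡ 0ℤ
   term≡0 with ‖ proj₁ (f x) ‖ ℕ.≟ 0 | ‖ proj₂ (f x) ‖ ℕ.≟ 0
   ... | yes p | _     rewrite lookup≡0 (proj₁ (f x)) p i = *-zeroˡ (lookup (proj₂ (f x)) j)
   ... | no _  | yes q rewrite lookup≡0 (proj₂ (f x)) q j = *-zeroʳ (lookup (proj₁ (f x)) i)
   ... | no p  | no q  = contradiction (p , q) ¬nz

 lookup-injective : ∀ {A : Set} {xs : List A} → Unique xs → ∀ {i j} → List.lookup xs i ≡ List.lookup xs j → i ≡ j
 lookup-injective (_ ∷ _)   {zero}  {zero}  eq = refl
 lookup-injective (x∉ ∷ _)  {zero}  {suc j} eq = contradiction eq (All.lookup x∉ (∈-lookup j))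
 lookup-injective (x∉ ∷ _)  {suc i} {zero}  eq = contradiction (sym eq) (All.lookup x∉ (∈-lookup i))
 lookup-injective (_ ∷ uq)  {suc i} {suc j} eq = cong suc (lookup-injective uq eq)

 *‖‖-least : ∀ {a} m (x : Vec ℤ a) {X} → (∀ i → m ℕ.* ∣ lookup x i ∣ ℕ.≤ X) → m ℕ.* ‖ x ‖ ℕ.≤ X
 *‖‖-least m []      h rewrite ℕ.*-zeroʳ m = ℕ.z≤n
 *‖‖-least m (p ∷ x) h rewrite ℕ.*-distribˡ-⊔ m ∣ p ∣ ‖ x ‖ = ℕ.⊔-lub (h zero) (*‖‖-least m x (h ∘ suc))

 -- Each reduced generator of the column lattice is paired with the vector of its coefficients in
 -- the s columns. Reducedness, applied to every column, bounds the product of the two norms. By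
 -- `few-nonzero` at most k pairs have both vectors nonzero, and the others do not affect the
 -- matrix.
 factorization : ∀ {k d s} n (D : Fin k → Vector ℝ d) (w : Vec (Vec ℤ d) s) →
   (∀ l → OnDirections D (lookup w l)) → (∀ l → ‖ lookup w l ‖ ℕ.≤ n) →
   DoubleNegation (Σ (List (Pair d s)) λ ps → length ps ℕ.≤ k × All (Good (supConstant d s ℕ.* n)) ps ×
     (∀ j l → entry ps j l ≡ lookup (lookup w l) j))
 factorization {k} {d} {s} n D w onD w≤n cont = sup-reduction w λ (u , u≅w , red) →
   let open Reduced u u≅w red in cont (List.map pair indices , few , good , entries)
   where
   K = supConstant d s
   module Reduced (u : Vec (Vec ℤ d) s) (u≅w : u ≅ w) (red : SupReduced K u) where
     coefficients : ∀ l → ∃ λ c → lin c u ≡ lookup w l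
     coefficients l = span⇒lin (gen (_≅_.from u≅w) l)
     pair : Fin s → Pair d s
     pair i = lookup u i , tabulate (λ l → lookup (proj₁ (coefficients l)) i)
     indices : List (Fin s)
     indices = filter (nonzero? ∘ pair) (allFin s)
     indices-unique : Unique indices
     indices-unique = Unique.filter⁺ (nonzero? ∘ pair) (Unique.allFin⁺ s)
     few : length (List.map pair indices) ℕ.≤ k
     few rewrite length-map pair indices with length indices ℕ.≤? k
     ... | yes p = p
     ... | no ¬p = contradiction (λ l → proj₁ (proj₂ (∈-filter⁻ (nonzero? ∘ pair) {xs = allFin s} (∈-lookup (inject≤ l k<)))))
           (few-nonzero K D u red (λ i → span-onDirections D onD (gen (_≅_.to u≅w) i)) e
             (λ eq → inject≤-injective k< k< _ _ (lookup-injective indices-unique eq)) e?)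
       where
       k< = ℕ.≰⇒> ¬p
       e : Fin (suc k) → Fin s
       e l = List.lookup indices (inject≤ l k<)
       e? : ∀ i → (∃ λ l → i ≡ e l) ⊎ (∀ l → i ≢ e l)
       e? i with any? (λ l → i ≟ᶠ e l)
       ... | yes p = inj₁ p
       ... | no ¬p = inj₂ (λ l eq → ¬p (l , eq))
     small : ∀ i → ‖ proj₁ (pair i) ‖ ℕ.* ‖ proj₂ (pair i) ‖ ℕ.≤ K ℕ.* n
     small i = *‖‖-least ‖ lookup u i ‖ (proj₂ (pair i)) λ l → begin
       ‖ lookup u i ‖ ℕ.* ∣ lookup (tabulate λ l → lookup (proj₁ (coefficients l)) i) l ∣
         ≡⟨ cong (λ z → ‖ lookup u i ‖ ℕ.* ∣ z ∣) (lookup∘tabulate (λ l → lookup (proj₁ (coefficients l)) i) l) ⟩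
       ‖ lookup u i ‖ ℕ.* ∣ lookup (proj₁ (coefficients l)) i ∣
         ≡⟨ ℕ.*-comm ‖ lookup u i ‖ _ ⟩
       ∣ lookup (proj₁ (coefficients l)) i ∣ ℕ.* ‖ lookup u i ‖
         ≤⟨ red (proj₁ (coefficients l)) i ⟩
       K ℕ.* ‖ lin (proj₁ (coefficients l)) u ‖
         ≡⟨ cong (λ z → K ℕ.* ‖ z ‖) (proj₂ (coefficients l)) ⟩
       K ℕ.* ‖ lookup w l ‖
         ≤⟨ ℕ.*-monoʳ-≤ K (w≤n l) ⟩
       K ℕ.* n ∎
       where open ℕ.≤-Reasoning
     good : All (Good (K ℕ.* n)) (List.map pair indices)
     good = All.map⁺ (All.map (λ {i} (p , q) → p , q , small i) (All.all-filter (nonzero? ∘ pair) (allFin s)))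
     entry-all : ∀ {b} (v : Vec (Vec ℤ d) b) (c : Fin b → Vec ℤ s) (c′ : Vec ℤ b) j l → (∀ i → lookup (c i) l ≡ lookup c′ i) →
                 entry (List.tabulate (λ i → lookup v i , c i)) j l ≡ lookup (lin c′ v) j
     entry-all []      c []        j l eq = sym (lookup-𝟎 j)
     entry-all (x ∷ v) c (γ ∷ c′) j l eq = begin
       lookup x j * lookup (c zero) l + _   ≡⟨ cong₂ _+_ (≡.trans (cong (lookup x j *_) (eq zero)) (*-comm (lookup x j) γ)) (entry-all v (c ∘ suc) c′ j l (eq ∘ suc)) ⟩
       γ * lookup x j + lookup (lin c′ v) j          ≡⟨ cong (_+ lookup (lin c′ v) j) (lookup-⊙ γ x j) ⟨
       lookup (γ ⊙ x) j + lookup (lin c′ v) j        ≡⟨ lookup-⊕ (γ ⊙ x) (lin c′ v) j ⟨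
       lookup (γ ⊙ x ⊕ lin c′ v) j                   ∎
       where open ≡-Reasoning
     entries : ∀ j l → entry (List.map pair indices) j l ≡ lookup (lookup w l) j
     entries j l = begin
       entry (List.map pair indices) j l       ≡⟨ entry-filter pair (allFin s) j l ⟩
       entry (List.map pair (allFin s)) j l    ≡⟨ cong (λ ps → entry ps j l) (map-tabulate (λ i → i) pair) ⟩
       entry (List.tabulate pair) j l          ≡⟨ entry-all u (proj₂ ∘ pair) (proj₁ (coefficients l)) j l
                                                    (λ i → lookup∘tabulate (λ l → lookup (proj₁ (coefficients l)) i) l) ⟩
       lookup (lin (proj₁ (coefficients l)) u) j ≡⟨ cong (λ z → lookup z j) (proj₂ (coefficients l)) ⟩
       lookup (lookup w l) j                   ∎
       where open ≡-Reasoning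

 extract-shortest : ∀ {a b} (p : Pair a b) ps → ∃ λ q → ∃ λ qs → p ∷ ps ↭ q ∷ qs ×
                    All (λ r → ‖ proj₁ q ‖ ℕ.≤ ‖ proj₁ r ‖) qs
 extract-shortest p []       = p , [] , refl , []
 extract-shortest p (r ∷ ps) with extract-shortest r ps
 ... | q , qs , perm , least with ‖ proj₁ p ‖ ℕ.≤? ‖ proj₁ q ‖
 ... | yes p≤q = p , q ∷ qs , prep p perm , p≤q ∷ All.map (ℕ.≤-trans p≤q) least
 ... | no ¬p≤q = q , p ∷ qs , trans (prep p perm) (swap p q refl) , ℕ.<⇒≤ (ℕ.≰⇒> ¬p≤q) ∷ least

 ‖⊕‖ : ∀ {a} (x y : Vec ℤ a) → ‖ x ⊕ y ‖ ℕ.≤ ‖ x ‖ ℕ.+ ‖ y ‖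
 ‖⊕‖ x y = ‖‖-least (x ⊕ y) λ i → subst (λ z → ∣ z ∣ ℕ.≤ _) (sym (lookup-⊕ x y i))
   (ℕ.≤-trans (∣i+j∣≤∣i∣+∣j∣ (lookup x i) (lookup y i)) (ℕ.+-mono-≤ (∣lookup∣≤‖‖ x i) (∣lookup∣≤‖‖ y i)))

 ‖⊙‖ : ∀ {a} c (x : Vec ℤ a) → ‖ c ⊙ x ‖ ℕ.≤ ∣ c ∣ ℕ.* ‖ x ‖
 ‖⊙‖ c x = ‖‖-least (c ⊙ x) λ i → subst (λ z → ∣ z ∣ ℕ.≤ _) (sym (lookup-⊙ c x i))
   (subst (ℕ._≤ _) (sym (abs-* c (lookup x i))) (ℕ.*-monoʳ-≤ ∣ c ∣ (∣lookup∣≤‖‖ x i)))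

 -- A pair whose left factor was reduced at coordinate c by a vector of norm N, and had norm M before.
 record Fits {a b} (c : Fin a) (N X : ℕ) (p : Pair a b) : Set where
   constructor fits
   field
     {M}     : ℕ
     N≤M     : N ℕ.≤ M
     product : M ℕ.* ‖ proj₂ p ‖ ℕ.≤ X
     y≢0     : ‖ proj₂ p ‖ ≢ 0
     x≤3M    : ‖ proj₁ p ‖ ℕ.≤ 3 ℕ.* M
     x[c]≤N  : ∣ lookup (proj₁ p) c ∣ ℕ.≤ N

 attained-nonZero : ∀ {a} (c : Fin a) (x : Vec ℤ a) → ∣ lookup x c ∣ ≡ ‖ x ‖ → ‖ x ‖ ≢ 0 → NonZero (lookup x c)
 attained-nonZero c x top x≢0 = ≢-nonZero {lookup x c} (λ e → x≢0 (≡.trans (sym top) (cong ∣_∣ e)))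

 -- The rank-one terms satisfy x₀ y₀ᵀ + x yᵀ = x₀ (y₀ + t y)ᵀ + (x - t x₀) yᵀ. With `t` the integer
 -- quotient of the entries at `c`, the new left factor has at `c` a remainder below `‖ x₀ ‖`. As
 -- `x₀` attains its norm there and is not longer than `x`, `∣ t ∣ * ‖ x₀ ‖` is at most `2 * ‖ x ‖`.
 -- This gives the factor 3 in `Fits` and the increment `2 * X` of the leading product.
 reduce : ∀ {a b} X (c : Fin a) (x₀ : Vec ℤ a) → ∣ lookup x₀ c ∣ ≡ ‖ x₀ ‖ → ‖ x₀ ‖ ≢ 0 →
   (y₀ : Vec ℤ b) (ps : List (Pair a b)) → All (Good X) ps → All (λ p → ‖ x₀ ‖ ℕ.≤ ‖ proj₁ p ‖) ps →
   ∃ λ y₀′ → ∃ λ ps′ → length ps′ ≡ length ps × (∀ i j → entry ((x₀ , y₀) ∷ ps) i j ≡ entry ((x₀ , y₀′) ∷ ps′) i j) ×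
   ‖ x₀ ‖ ℕ.* ‖ y₀′ ‖ ℕ.≤ ‖ x₀ ‖ ℕ.* ‖ y₀ ‖ ℕ.+ length ps ℕ.* (2 ℕ.* X) × All (Fits c ‖ x₀ ‖ X) ps′
 reduce X c x₀ top x₀≢0 y₀ [] [] [] = y₀ , [] , refl , (λ _ _ → refl) , ℕ.m≤m+n _ 0 , []
 reduce X c x₀ top x₀≢0 y₀ ((x , y) ∷ ps) ((x≢0 , y≢0 , xy≤X) ∷ good) (x₀≤x ∷ long)
   with reduce X c x₀ top x₀≢0 (y₀ ⊕ (lookup x c / lookup x₀ c) {{attained-nonZero c x₀ top x₀≢0}} ⊙ y) ps good long
 ... | y₀′ , ps′ , len , ent , y₀′≤ , fit =
   y₀′ , (x′ , y) ∷ ps′ , cong suc len , entries , bound , fits x₀≤x xy≤X y≢0 x′≤ x′[c]≤ ∷ fit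
   where
   instance _ = attained-nonZero c x₀ top x₀≢0
   N = ‖ x₀ ‖
   t = lookup x c / lookup x₀ c
   r = lookup x c % lookup x₀ c
   x′ = x ⊕ (- t) ⊙ x₀
   division : lookup x c ≡ + r + t * lookup x₀ c
   division = a≡a%n+[a/n]*n (lookup x c) (lookup x₀ c)
   r<N : r ℕ.< N
   r<N = subst (r ℕ.<_) top (n%d<d (lookup x c) (lookup x₀ c))
   tN≤2x : ∣ t ∣ ℕ.* N ℕ.≤ 2 ℕ.* ‖ x ‖
   tN≤2x = begin
     ∣ t ∣ ℕ.* N                    ≡⟨ ≡.trans (cong (∣ t ∣ ℕ.*_) (sym top)) (sym (abs-* t (lookup x₀ c))) ⟩
     ∣ t * lookup x₀ c ∣            ≡⟨ cong ∣_∣ (≡.trans (cancel (+ r) (t * lookup x₀ c)) (cong (_- + r) (sym division))) ⟩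
     ∣ lookup x c - + r ∣           ≤⟨ ∣i-j∣≤∣i∣+∣j∣ (lookup x c) (+ r) ⟩
     ∣ lookup x c ∣ ℕ.+ r           ≤⟨ ℕ.+-mono-≤ (∣lookup∣≤‖‖ x c) (ℕ.≤-trans (ℕ.<⇒≤ r<N) x₀≤x) ⟩
     ‖ x ‖ ℕ.+ ‖ x ‖                ≡⟨ cong (‖ x ‖ ℕ.+_) (sym (ℕ.+-identityʳ ‖ x ‖)) ⟩
     2 ℕ.* ‖ x ‖                    ∎
     where
     open ℕ.≤-Reasoning
     cancel : ∀ r s → s ≡ r + s - r
     cancel = solve-∀
   x′≤ : ‖ x′ ‖ ℕ.≤ 3 ℕ.* ‖ x ‖
   x′≤ = ℕ.≤-trans (‖⊕‖ x ((- t) ⊙ x₀)) (ℕ.+-monoʳ-≤ ‖ x ‖ (ℕ.≤-trans (‖⊙‖ (- t) x₀)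
           (subst (λ z → z ℕ.* N ℕ.≤ 2 ℕ.* ‖ x ‖) (sym (∣-i∣≡∣i∣ t)) tN≤2x)))
   x′-at : ∀ i → lookup x′ i ≡ lookup x i + - t * lookup x₀ i
   x′-at i = ≡.trans (lookup-⊕ x ((- t) ⊙ x₀) i) (cong (_+_ (lookup x i)) (lookup-⊙ (- t) x₀ i))
   x′[c]≤ : ∣ lookup x′ c ∣ ℕ.≤ N
   x′[c]≤ = subst (λ z → ∣ z ∣ ℕ.≤ N) (sym (≡.trans (x′-at c) (≡.trans (cong (_+ - t * lookup x₀ c) division) (cancel (+ r) t (lookup x₀ c)))))
              (ℕ.<⇒≤ r<N)
     where
     cancel : ∀ r t s → r + t * s + - t * s ≡ r
     cancel = solve-∀
   entries : ∀ i j → entry ((x₀ , y₀) ∷ (x , y) ∷ ps) i j ≡ entry ((x₀ , y₀′) ∷ (x′ , y) ∷ ps′) i j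
   entries i j = begin
     p * q + (ξ * η + E)                           ≡⟨ shear p q ξ η t E ⟩
     (ξ + - t * p) * η + (p * (q + t * η) + E)     ≡⟨ cong₂ (λ s z → s * η + (p * z + E)) (x′-at i)
                                                        (≡.trans (lookup-⊕ y₀ (t ⊙ y) j) (cong (_+_ q) (lookup-⊙ t y j))) ⟨
     lookup x′ i * η + (p * lookup (y₀ ⊕ t ⊙ y) j + E) ≡⟨ cong (_+_ (lookup x′ i * η)) (ent i j) ⟩
     lookup x′ i * η + (p * lookup y₀′ j + entry ps′ i j) ≡⟨ exchange (lookup x′ i * η) (p * lookup y₀′ j) (entry ps′ i j) ⟩
     p * lookup y₀′ j + (lookup x′ i * η + entry ps′ i j) ∎
     where
     open ≡-Reasoning
     p = lookup x₀ i
     q = lookup y₀ j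
     ξ = lookup x i
     η = lookup y j
     E = entry ps i j
     shear : ∀ p q ξ η t E → p * q + (ξ * η + E) ≡ (ξ + - t * p) * η + (p * (q + t * η) + E)
     shear = solve-∀
     exchange : ∀ p q r → p + (q + r) ≡ q + (p + r)
     exchange = solve-∀
   bound : N ℕ.* ‖ y₀′ ‖ ℕ.≤ N ℕ.* ‖ y₀ ‖ ℕ.+ (2 ℕ.* X ℕ.+ length ps ℕ.* (2 ℕ.* X))
   bound = begin
     N ℕ.* ‖ y₀′ ‖                                       ≤⟨ y₀′≤ ⟩
     N ℕ.* ‖ y₀ ⊕ t ⊙ y ‖ ℕ.+ R                          ≤⟨ ℕ.+-monoˡ-≤ R (ℕ.*-monoʳ-≤ N (ℕ.≤-trans (‖⊕‖ y₀ (t ⊙ y)) (ℕ.+-monoʳ-≤ ‖ y₀ ‖ (‖⊙‖ t y)))) ⟩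
     N ℕ.* (‖ y₀ ‖ ℕ.+ ∣ t ∣ ℕ.* ‖ y ‖) ℕ.+ R            ≡⟨ cong (ℕ._+ R) (ℕ.*-distribˡ-+ N ‖ y₀ ‖ (∣ t ∣ ℕ.* ‖ y ‖)) ⟩
     N ℕ.* ‖ y₀ ‖ ℕ.+ N ℕ.* (∣ t ∣ ℕ.* ‖ y ‖) ℕ.+ R      ≤⟨ ℕ.+-monoˡ-≤ R (ℕ.+-monoʳ-≤ (N ℕ.* ‖ y₀ ‖) step) ⟩
     N ℕ.* ‖ y₀ ‖ ℕ.+ 2 ℕ.* X ℕ.+ R                      ≡⟨ ℕ.+-assoc (N ℕ.* ‖ y₀ ‖) (2 ℕ.* X) R ⟩
     N ℕ.* ‖ y₀ ‖ ℕ.+ (2 ℕ.* X ℕ.+ R)                    ∎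
     where
     open ℕ.≤-Reasoning
     R = length ps ℕ.* (2 ℕ.* X)
     step : N ℕ.* (∣ t ∣ ℕ.* ‖ y ‖) ℕ.≤ 2 ℕ.* X
     step = begin
       N ℕ.* (∣ t ∣ ℕ.* ‖ y ‖)     ≡⟨ ℕ.*-assoc N ∣ t ∣ ‖ y ‖ ⟨
       N ℕ.* ∣ t ∣ ℕ.* ‖ y ‖       ≡⟨ cong (ℕ._* ‖ y ‖) (ℕ.*-comm N ∣ t ∣) ⟩
       ∣ t ∣ ℕ.* N ℕ.* ‖ y ‖       ≤⟨ ℕ.*-monoˡ-≤ ‖ y ‖ tN≤2x ⟩
       2 ℕ.* ‖ x ‖ ℕ.* ‖ y ‖       ≡⟨ ℕ.*-assoc 2 ‖ x ‖ ‖ y ‖ ⟩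
       2 ℕ.* (‖ x ‖ ℕ.* ‖ y ‖)     ≤⟨ ℕ.*-monoʳ-≤ 2 xy≤X ⟩
       2 ℕ.* X                     ∎

-- A finite list of codes for the difference matrices.

module Encoding where

 open SupNorm
 open Factorization
 open import Data.Nat.Base
 open import Data.Nat.Properties
 open import Data.Nat.DivMod using (_/_; m*n/n≡m; /-monoˡ-≤; m/n*n≤m; m≥n⇒m/n>0)
 open import Data.Nat.Tactic.RingSolver using (solve-∀)
 open import Data.Integer.Base as ℤ using (ℤ; -[1+_])
 open import Data.Fin.Base using (Fin; zero; suc)
 open import Data.Fin.Properties using () renaming (_≟_ to _≟ᶠ_)
 open import Data.List.Base using (List; []; _∷_; length; map; _++_; upTo; allFin; concatMap; cartesianProduct; cartesianProductWith)
 open import Data.List.Properties using (length-map; length-++; length-upTo)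
 open import Data.List.Membership.Propositional using (_∈_)
 open import Data.List.Membership.Propositional.Properties
 open import Data.List.Relation.Unary.All as All using (All; []; _∷_)
 open import Data.List.Relation.Unary.Any using (here; there)
 open import Data.List.Relation.Binary.Permutation.Propositional.Properties using (All-resp-↭; ↭-length)
 open import Data.Product.Base using (∃; _×_; _,_; proj₁)
 open import Data.Vec.Base using (Vec; []; _∷_; lookup; replicate; _[_]≔_)
 open import Data.Vec.Properties using (lookup-replicate; lookup∘updateAt; lookup∘updateAt′)
 open import Function.Base using (_∘_)
 open import Relation.Binary.PropositionalEquality
 open import Relation.Nullary using (yes; no; contradiction)

 sumUpTo : (ℕ → ℕ) → ℕ → ℕ
 sumUpTo f zero    = 0
 sumUpTo f (suc n) = f n + sumUpTo f n

 sumUpTo-mono : ∀ {f g} n → (∀ i → i < n → f i ≤ g i) → sumUpTo f n ≤ sumUpTo g n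
 sumUpTo-mono zero    h = z≤n
 sumUpTo-mono (suc n) h = +-mono-≤ (h n ≤-refl) (sumUpTo-mono n (λ i i<n → h i (m<n⇒m<1+n i<n)))

 sumUpTo-*ˡ : ∀ c f n → sumUpTo (λ i → c * f i) n ≡ c * sumUpTo f n
 sumUpTo-*ˡ c f zero    = sym (*-zeroʳ c)
 sumUpTo-*ˡ c f (suc n) = trans (cong (_+_ (c * f n)) (sumUpTo-*ˡ c f n)) (sym (*-distribˡ-+ c (f n) (sumUpTo f n)))

 sumUpTo-const : ∀ c n → sumUpTo (λ _ → c) n ≡ n * c
 sumUpTo-const c zero    = refl
 sumUpTo-const c (suc n) = cong (c +_) (sumUpTo-const c n)

 2^>0 : ∀ n → 0 < 2 ^ n
 2^>0 n = m^n>0 2 n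

 -- Inductively S + 2Z / 2^n ≤ 2Z for the sum S of n terms, cleared of its denominator; the extra
 -- summand is the room left for the remaining terms.
 sumUpTo-geometric : ∀ f Z n → (∀ i → f i * 2 ^ i ≤ Z) → sumUpTo f n ≤ 2 * Z
 sumUpTo-geometric f Z n h = *-cancelʳ-≤ (sumUpTo f n) (2 * Z) (2 ^ n) {{>-nonZero (2^>0 n)}}
   (≤-trans (m≤m+n _ (2 * Z)) (go n))
   where
   go : ∀ n → sumUpTo f n * 2 ^ n + 2 * Z ≤ 2 * Z * 2 ^ n
   go zero    = ≤-reflexive (sym (*-identityʳ (2 * Z)))
   go (suc n) = begin
     (f n + sumUpTo f n) * (2 * 2 ^ n) + 2 * Z                  ≡⟨ regroup (f n) (sumUpTo f n) (2 ^ n) Z ⟩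
     2 * (f n * 2 ^ n) + 2 * (sumUpTo f n * 2 ^ n) + 2 * Z      ≤⟨ +-monoˡ-≤ (2 * Z) (+-monoˡ-≤ _ (*-monoʳ-≤ 2 (h n))) ⟩
     2 * Z + 2 * (sumUpTo f n * 2 ^ n) + 2 * Z                  ≡⟨ regroup₂ Z (sumUpTo f n * 2 ^ n) ⟩
     2 * (sumUpTo f n * 2 ^ n + 2 * Z)                          ≤⟨ *-monoʳ-≤ 2 (go n) ⟩
     2 * (2 * Z * 2 ^ n)                                        ≡⟨ regroup₃ Z (2 ^ n) ⟩
     2 * Z * (2 * 2 ^ n)                                        ∎
     where
     open ≤-Reasoning
     regroup : ∀ a s p z → (a + s) * (2 * p) + 2 * z ≡ 2 * (a * p) + 2 * (s * p) + 2 * z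
     regroup = solve-∀
     regroup₂ : ∀ z t → 2 * z + 2 * t + 2 * z ≡ 2 * (t + 2 * z)
     regroup₂ = solve-∀
     regroup₃ : ∀ z p → 2 * (2 * z * p) ≡ 2 * z * (2 * p)
     regroup₃ = solve-∀

 length-cartesianProductWith : ∀ {A B C : Set} (f : A → B → C) xs ys →
                               length (cartesianProductWith f xs ys) ≡ length xs * length ys
 length-cartesianProductWith f []       ys = refl
 length-cartesianProductWith f (x ∷ xs) ys = trans (length-++ (map (f x) ys))
   (cong₂ _+_ (length-map (f x) ys) (length-cartesianProductWith f xs ys))

 length-concatMap-≤ : ∀ {A B : Set} (f : A → List B) xs {N} → (∀ x → length (f x) ≤ N) → length (concatMap f xs) ≤ length xs * N
 length-concatMap-≤ f []       h = z≤n
 length-concatMap-≤ f (x ∷ xs) h = subst (_≤ _) (sym (length-++ (f x))) (+-mono-≤ (h x) (length-concatMap-≤ f xs h))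

 concatUpTo : ∀ {A : Set} → (ℕ → List A) → ℕ → List A
 concatUpTo f zero    = []
 concatUpTo f (suc n) = f n ++ concatUpTo f n

 length-concatUpTo : ∀ {A : Set} (f : ℕ → List A) n → length (concatUpTo f n) ≡ sumUpTo (length ∘ f) n
 length-concatUpTo f zero    = refl
 length-concatUpTo f (suc n) = trans (length-++ (f n)) (cong (_+_ (length (f n))) (length-concatUpTo f n))

 ∈-concatUpTo : ∀ {A : Set} (f : ℕ → List A) {x n} i → i < n → x ∈ f i → x ∈ concatUpTo f n
 ∈-concatUpTo f {n = suc n} i i<1+n x∈ with i ≟ n
 ... | yes refl = ∈-++⁺ˡ x∈
 ... | no i≢n   = ∈-++⁺ʳ (f n) (∈-concatUpTo f i (≤∧≢⇒< (s≤s⁻¹ i<1+n) i≢n) x∈)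

 ∈-concatMap : ∀ {A B : Set} (f : A → List B) {xs x y} → x ∈ xs → y ∈ f x → y ∈ concatMap f xs
 ∈-concatMap f (here refl) y∈ = ∈-++⁺ˡ y∈
 ∈-concatMap f {x ∷ _} (there x∈) y∈ = ∈-++⁺ʳ (f x) (∈-concatMap f x∈ y∈)

 lists≤ : ∀ {A : Set} → List A → ℕ → List (List A)
 lists≤ xs zero    = [] ∷ []
 lists≤ xs (suc m) = [] ∷ cartesianProductWith _∷_ xs (lists≤ xs m)

 length-lists≤ : ∀ {A : Set} (xs : List A) m → length (lists≤ xs m) ≤ suc (length xs) ^ m
 length-lists≤ xs zero    = ≤-refl
 length-lists≤ xs (suc m) = +-mono-≤ (m^n>0 (suc (length xs)) m)
   (subst (_≤ length xs * suc (length xs) ^ m) (sym (length-cartesianProductWith _∷_ xs (lists≤ xs m)))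
     (*-monoʳ-≤ (length xs) (length-lists≤ xs m)))

 ∈-lists≤ : ∀ {A : Set} {xs ys : List A} {m} → All (_∈ xs) ys → length ys ≤ m → ys ∈ lists≤ xs m
 ∈-lists≤ {m = zero}  []          len = here refl
 ∈-lists≤ {m = suc m} []          len = here refl
 ∈-lists≤ {m = suc m} (y∈ ∷ ys∈) len = there (∈-cartesianProductWith⁺ _∷_ y∈ (∈-lists≤ ys∈ (s≤s⁻¹ len)))

 width : ℕ → ℕ
 width N = suc N + N

 interval : ℕ → List ℤ
 interval N = map ℤ.+_ (upTo (suc N)) ++ map -[1+_] (upTo N)

 length-interval : ∀ N → length (interval N) ≡ width N
 length-interval N = trans (length-++ (map ℤ.+_ (upTo (suc N)))) (cong₂ _+_
   (trans (length-map ℤ.+_ (upTo (suc N))) (length-upTo (suc N))) (trans (length-map -[1+_] (upTo N)) (length-upTo N)))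

 ∈-interval : ∀ {N} z → ℤ.∣ z ∣ ≤ N → z ∈ interval N
 ∈-interval {N} (ℤ.+ n)    n≤N = ∈-++⁺ˡ (∈-map⁺ ℤ.+_ (∈-upTo⁺ (s≤s n≤N)))
 ∈-interval {N} -[1+ n ] n<N = ∈-++⁺ʳ (map ℤ.+_ (upTo (suc N))) (∈-map⁺ -[1+_] (∈-upTo⁺ n<N))

 box : ∀ {a} → Vec ℕ a → List (Vec ℤ a)
 box []       = [] ∷ []
 box (N ∷ Ns) = cartesianProductWith _∷_ (interval N) (box Ns)

 ∈-box : ∀ {a} (Ns : Vec ℕ a) x → (∀ i → ℤ.∣ lookup x i ∣ ≤ lookup Ns i) → x ∈ box Ns
 ∈-box []       []      h = here refl
 ∈-box (N ∷ Ns) (z ∷ x) h = ∈-cartesianProductWith⁺ _∷_ (∈-interval z (h zero)) (∈-box Ns x (h ∘ suc))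

 cube : ∀ a → ℕ → List (Vec ℤ a)
 cube a N = box (replicate a N)

 length-cube : ∀ a N → length (cube a N) ≡ width N ^ a
 length-cube zero    N = refl
 length-cube (suc a) N = trans (length-cartesianProductWith _∷_ (interval N) (cube a N)) (cong₂ _*_ (length-interval N) (length-cube a N))

 ∈-cube : ∀ {a N} (x : Vec ℤ a) → ‖ x ‖ ≤ N → x ∈ cube a N
 ∈-cube {a} {N} x h = ∈-box (replicate a N) x λ i → subst (ℤ.∣ lookup x i ∣ ≤_) (sym (lookup-replicate i N)) (≤-trans (∣lookup∣≤‖‖ x i) h)

 slab : ∀ {a} → Fin a → ℕ → ℕ → List (Vec ℤ a)
 slab {a} c N′ N = box (replicate a N [ c ]≔ N′)

 length-slab : ∀ {a} (c : Fin (suc a)) N′ N → length (slab c N′ N) ≡ width N′ * width N ^ a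
 length-slab {a}     zero    N′ N = trans (length-cartesianProductWith _∷_ (interval N′) (cube a N)) (cong₂ _*_ (length-interval N′) (length-cube a N))
 length-slab {suc a} (suc c) N′ N = trans (length-cartesianProductWith _∷_ (interval N) (slab c N′ N))
   (trans (cong₂ _*_ (length-interval N) (length-slab c N′ N)) (exchange (width N) (width N′) (width N ^ a)))
   where
   exchange : ∀ p q r → p * (q * r) ≡ q * (p * r)
   exchange = solve-∀

 ∈-slab : ∀ {a} (c : Fin a) {N′ N} (x : Vec ℤ a) → ‖ x ‖ ≤ N → ℤ.∣ lookup x c ∣ ≤ N′ → x ∈ slab c N′ N
 ∈-slab {a} c {N′} {N} x h h′ = ∈-box (replicate a N [ c ]≔ N′) x bound
   where
   bound : ∀ i → ℤ.∣ lookup x i ∣ ≤ lookup (replicate a N [ c ]≔ N′) i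
   bound i with i ≟ᶠ c
   ... | yes refl = subst (ℤ.∣ lookup x i ∣ ≤_) (sym (lookup∘updateAt i (replicate a N))) h′
   ... | no i≢c   = subst (ℤ.∣ lookup x i ∣ ≤_) (sym (trans (lookup∘updateAt′ i c i≢c (replicate a N)) (lookup-replicate i N)))
                      (≤-trans (∣lookup∣≤‖‖ x i) h)

 dyadic : ∀ M → 1 ≤ M → ∃ λ j → 2 ^ j ≤ M × M < 2 ^ suc j
 dyadic (suc zero)        _ = 0 , ≤-refl , ≤-refl
 dyadic (suc M@(suc _))   _ with dyadic M (s≤s z≤n)
 ... | j , lo , hi with suc M <? 2 ^ suc j
 ... | yes p = j , m≤n⇒m≤1+n lo , p
 ... | no ¬p = suc j , ≮⇒≥ ¬p , <-≤-trans (s≤s hi) (begin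
     suc (2 ^ suc j)         ≤⟨ +-monoˡ-≤ (2 ^ suc j) (2^>0 (suc j)) ⟩
     2 ^ suc j + 2 ^ suc j   ≡⟨ cong (_+_ (2 ^ suc j)) (+-identityʳ (2 ^ suc j)) ⟨
     2 ^ suc (suc j)         ∎)
   where open ≤-Reasoning

 2^-cancel-< : ∀ {i j} → 2 ^ i < 2 ^ j → i < j
 2^-cancel-< {i} {j} h with i <? j
 ... | yes p = p
 ... | no ¬p = contradiction h (≤⇒≯ (^-monoʳ-≤ 2 (≮⇒≥ ¬p)))

 module Codes (a b : ℕ) (X L m : ℕ) where

   -- The largest second norm possible next to a first norm of at least 2^j when the product is at
   -- most `X`.
   Y : ℕ → ℕ
   Y j = (X / 2 ^ j) {{m^n≢0 2 j}}

   leads : ℕ → List (Pair a b)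
   leads j = cartesianProduct (cube a (6 * 2 ^ j)) (cube b (Y j))

   -- `j` is the dyadic scale of the lead and `j + i` that of the follower before its reduction; the
   -- latter is not smaller because the lead is shortest. Reduction may triple a norm below 2^(j + i
   -- + 1), whence the side 6 * 2^(j + i), while coordinate `c` stays within the norm of the lead.
   followersAt : Fin a → ℕ → ℕ → List (Pair a b)
   followersAt c j i = cartesianProduct (slab c (6 * 2 ^ j) (6 * 2 ^ (j + i))) (cube b (Y (j + i)))

   followers : Fin a → ℕ → List (Pair a b)
   followers c j = concatUpTo (followersAt c j) (suc (L ∸ j))

   codesAt : ℕ → Fin a → List (List (Pair a b))
   codesAt j c = cartesianProductWith _∷_ (leads j) (lists≤ (followers c j) m)

   codes : List (List (Pair a b))
   codes = [] ∷ concatUpTo (λ j → concatMap (codesAt j) (allFin a)) (suc L)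

   Y-greatest : ∀ {M} j y → 2 ^ j ≤ M → M * y ≤ X → y ≤ Y j
   Y-greatest j y 2^j≤M My≤X = subst (_≤ Y j) (m*n/n≡m y (2 ^ j) {{m^n≢0 2 j}})
     (/-monoˡ-≤ (2 ^ j) {{m^n≢0 2 j}} (≤-trans (≤-reflexive (*-comm y (2 ^ j))) (≤-trans (*-monoˡ-≤ y 2^j≤M) My≤X)))

   Y-* : ∀ j → Y j * 2 ^ j ≤ X
   Y-* j = m/n*n≤m X (2 ^ j) {{m^n≢0 2 j}}

   Y-pos : ∀ j → 2 ^ j ≤ X → 1 ≤ Y j
   Y-pos j = m≥n⇒m/n>0 {X} {2 ^ j} {{m^n≢0 2 j}}

   Y≤X : ∀ j → Y j ≤ X
   Y≤X j = ≤-trans (m≤m*n (Y j) (2 ^ j) {{m^n≢0 2 j}}) (Y-* j)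

   private
     left-≤ : ∀ {M} j → M < 2 ^ suc j → 3 * M ≤ 6 * 2 ^ j
     left-≤ {M} j h = ≤-trans (*-monoʳ-≤ 3 (<⇒≤ h)) (≤-reflexive (sym (*-assoc 3 2 (2 ^ j))))

   -- The scale is read off from the norm `M` before reduction, since the reduced vector may be
   -- arbitrarily short. It is at most `L` because `y` is nonzero and hence `M ≤ X`.
   follower : ∀ {c N X₀} j {p} → X₀ ≤ X → X < 2 ^ suc L → 1 ≤ N → 2 ^ j ≤ N → N < 2 ^ suc j →
              Fits c N X₀ p → p ∈ followers c j
   follower {c} {N} j {x , y} X₀≤X X<2^ 1≤N lo hi (fits {M} N≤M prod y≢0 x≤3M xc≤N) with dyadic M (≤-trans 1≤N N≤M)
   ... | j′ , lo′ , hi′ = ∈-concatUpTo (followersAt c j) (j′ ∸ j) (s≤s (∸-monoˡ-≤ j j′≤L))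
     (subst (λ t → (x , y) ∈ cartesianProduct (slab c (6 * 2 ^ j) (6 * 2 ^ t)) (cube b (Y t))) (sym (m+[n∸m]≡n j≤j′))
       (∈-cartesianProduct⁺ (∈-slab c x (≤-trans x≤3M (left-≤ j′ hi′)) (≤-trans xc≤N (≤-trans (m≤m+n N (2 * N)) (left-≤ j hi))))
         (∈-cube y (Y-greatest j′ ‖ y ‖ lo′ (≤-trans prod X₀≤X)))))
     where
     j≤j′ : j ≤ j′
     j≤j′ = s≤s⁻¹ (2^-cancel-< {j} {suc j′} (≤-<-trans lo (≤-<-trans N≤M hi′)))
     j′≤L : j′ ≤ L
     j′≤L = s≤s⁻¹ (2^-cancel-< {j′} {suc L} (≤-<-trans lo′ (≤-<-trans (≤-trans (m≤m*n M ‖ y ‖ {{≢-nonZero y≢0}}) (≤-trans prod X₀≤X)) X<2^)))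

   -- Each of at most `m` reductions adds up to `2 * X₀` to the product of the norms of the lead,
   -- and the first hypothesis makes room for this. The empty list of pairs is a code of its own,
   -- having no lead.
   encode : ∀ X₀ → X₀ + m * (2 * X₀) ≤ X → X < 2 ^ suc L → (ps : List (Pair a b)) → length ps ≤ suc m → All (Good X₀) ps →
            ∃ λ qs → qs ∈ codes × (∀ i j → entry qs i j ≡ entry ps i j)
   encode X₀ X₀≤ X<2^ []       _   _    = [] , here refl , λ _ _ → refl
   encode X₀ X₀≤ X<2^ (p ∷ ps) len good with extract-shortest p ps
   ... | (x , y) , rest , perm , long with All-resp-↭ perm good
   ... | (x≢0 , y≢0 , xy≤) ∷ good′ = result x x≢0 xy≤ long (λ i j → entry-↭ perm i j)
     where
     rest≤ : length rest ≤ m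
     rest≤ = s≤s⁻¹ (subst (_≤ suc m) (↭-length perm) len)
     X₀≤X : X₀ ≤ X
     X₀≤X = ≤-trans (m≤m+n X₀ _) X₀≤
     result : ∀ x → ‖ x ‖ ≢ 0 → ‖ x ‖ * ‖ y ‖ ≤ X₀ → All (λ r → ‖ x ‖ ≤ ‖ proj₁ r ‖) rest →
              (∀ i j → entry (p ∷ ps) i j ≡ entry ((x , y) ∷ rest) i j) →
              ∃ λ qs → qs ∈ codes × (∀ i j → entry qs i j ≡ entry (p ∷ ps) i j)
     result []        x≢0 _   _    _   = contradiction refl x≢0
     result x@(_ ∷ _) x≢0 xy≤ long ent with ‖‖-attained x
     ... | c , top with reduce X₀ c x top x≢0 y rest good′ long | dyadic ‖ x ‖ (n≢0⇒n>0 x≢0)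
     ... | y′ , rest′ , len′ , ent′ , y′≤ , fit | j , lo , hi = (x , y′) ∷ rest′ ,
       there (∈-concatUpTo _ j (s≤s j≤L) (∈-concatMap (codesAt j) (∈-allFin c)
         (∈-cartesianProductWith⁺ _∷_
           (∈-cartesianProduct⁺ (∈-cube x (≤-trans (m≤m+n ‖ x ‖ (2 * ‖ x ‖)) (left-≤ j hi))) (∈-cube y′ (Y-greatest j ‖ y′ ‖ lo xy′≤)))
           (∈-lists≤ (All.map (follower j X₀≤X X<2^ (n≢0⇒n>0 x≢0) lo hi) fit) (subst (_≤ m) (sym len′) rest≤))))) ,
       λ i k → sym (trans (ent i k) (ent′ i k))
       where
       xy′≤ : ‖ x ‖ * ‖ y′ ‖ ≤ X
       xy′≤ = ≤-trans y′≤ (≤-trans (+-mono-≤ xy≤ (*-monoˡ-≤ (2 * X₀) rest≤)) X₀≤)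
       j≤L : j ≤ L
       j≤L = s≤s⁻¹ (2^-cancel-< {j} {suc L} (≤-<-trans lo (≤-<-trans (≤-trans (m≤m*n ‖ x ‖ ‖ y ‖ {{≢-nonZero y≢0}}) (≤-trans xy≤ X₀≤X)) X<2^)))

-- The number of codes.

module Counting where

 open Encoding
 open import Data.Nat.Base
 open import Data.Nat.Properties
 open import Data.Nat.Tactic.RingSolver using (solve-∀)
 open import Data.List.Base using (List; length; allFin; concatMap)
 open import Data.List.Properties using (length-tabulate)
 open import Function.Base using (_∘_)
 open import Relation.Binary.PropositionalEquality

 ^-distribʳ-* : ∀ m n o → (m * n) ^ o ≡ m ^ o * n ^ o
 ^-distribʳ-* m n zero    = refl
 ^-distribʳ-* m n (suc o) = trans (cong (m * n *_) (^-distribʳ-* m n o)) (exchange m n (m ^ o) (n ^ o))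
   where
   exchange : ∀ p q r s → p * q * (r * s) ≡ p * r * (q * s)
   exchange = solve-∀

 -- Bounds the sum of (Y j / X)^e over the scales j ≤ L: every scale may count fully when e = 0, and
 -- the sum is geometric otherwise. This is the only source of the logarithm.
 scales : ℕ → ℕ → ℕ
 scales zero    L = suc L
 scales (suc e) L = 2

 -- With a = 1 + a′, b = a + e and k = 1 + m.
 countConstant : ℕ → ℕ → ℕ → ℕ
 countConstant a′ e m = 2 * (suc a′ * G * (3 * G) ^ m)
   where G = 13 ^ suc a′ * 3 ^ suc (a′ + e)

 module Count (a′ e m X L : ℕ) (1≤X : 1 ≤ X) (2^L≤X : 2 ^ L ≤ X) where
   a = suc a′
   b = suc (a′ + e)
   open Codes a b X L m

   G = 13 ^ a * 3 ^ b

   private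
     width-6 : ∀ {S} T → 1 ≤ S → S ≤ T → width (6 * T) ≤ 13 * T
     width-6 T 1≤S S≤T = begin
       suc (6 * T) + 6 * T   ≡⟨ regroup T ⟩
       1 + 12 * T            ≤⟨ +-monoˡ-≤ (12 * T) (≤-trans 1≤S S≤T) ⟩
       T + 12 * T            ∎
       where
       open ≤-Reasoning
       regroup : ∀ T → suc (6 * T) + 6 * T ≡ 1 + 12 * T
       regroup = solve-∀

     width-Y : ∀ Z → 1 ≤ Z → width Z ≤ 3 * Z
     width-Y Z 1≤Z = begin
       suc Z + Z    ≡⟨ regroup Z ⟩
       1 + 2 * Z    ≤⟨ +-monoˡ-≤ (2 * Z) 1≤Z ⟩
       Z + 2 * Z    ∎
       where
       open ≤-Reasoning
       regroup : ∀ Z → suc Z + Z ≡ 1 + 2 * Z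
       regroup = solve-∀

     2^≤X : ∀ {j} → j ≤ L → 2 ^ j ≤ X
     2^≤X j≤L = ≤-trans (^-monoʳ-≤ 2 j≤L) 2^L≤X

     1≤X^ : ∀ n → 1 ≤ X ^ n
     1≤X^ n = m^n>0 X {{>-nonZero 1≤X}} n

     1≤G : 1 ≤ G
     1≤G = *-mono-≤ (m^n>0 13 a) (m^n>0 3 b)

     Y-power : ∀ j n → (2 ^ j * Y j) ^ n ≤ X ^ n
     Y-power j n = ^-monoˡ-≤ n (≤-trans (≤-reflexive (*-comm (2 ^ j) (Y j))) (Y-* j))

   -- Of the b = a + e sides of order `Y j`, a are matched with the sides of order 2^j, each product
   -- being at most `X`; the e sides left over keep the dependence on `j`.
   length-leads : ∀ j → j ≤ L → length (leads j) ≤ G * X ^ a * Y j ^ e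
   length-leads j j≤L = begin
     length (leads j)                       ≡⟨ length-cartesianProductWith _ (cube a (6 * T)) (cube b (Y j)) ⟩
     length (cube a (6 * T)) * length (cube b (Y j)) ≡⟨ cong₂ _*_ (length-cube a (6 * T)) (length-cube b (Y j)) ⟩
     width (6 * T) ^ a * width (Y j) ^ b    ≤⟨ *-mono-≤ (^-monoˡ-≤ a (width-6 T (2^>0 j) ≤-refl)) (^-monoˡ-≤ b (width-Y (Y j) (Y-pos j (2^≤X j≤L)))) ⟩
     (13 * T) ^ a * (3 * Y j) ^ b           ≡⟨ cong₂ _*_ (^-distribʳ-* 13 T a) (^-distribʳ-* 3 (Y j) b) ⟩
     13 ^ a * T ^ a * (3 ^ b * Y j ^ b)     ≡⟨ cong (λ z → 13 ^ a * T ^ a * (3 ^ b * z)) (^-distribˡ-+-* (Y j) a e) ⟩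
     13 ^ a * T ^ a * (3 ^ b * (Y j ^ a * Y j ^ e)) ≡⟨ regroup (13 ^ a) (T ^ a) (3 ^ b) (Y j ^ a) (Y j ^ e) ⟩
     G * (T ^ a * Y j ^ a) * Y j ^ e        ≡⟨ cong (λ z → G * z * Y j ^ e) (^-distribʳ-* T (Y j) a) ⟨
     G * (T * Y j) ^ a * Y j ^ e            ≤⟨ *-monoˡ-≤ (Y j ^ e) (*-monoʳ-≤ G (Y-power j a)) ⟩
     G * X ^ a * Y j ^ e                    ∎
     where
     open ≤-Reasoning
     T = 2 ^ j
     regroup : ∀ p q r s t → p * q * (r * (s * t)) ≡ p * r * (q * s) * t
     regroup = solve-∀

   -- Here a′ sides of order 2^(j + i) are matched with `Y (j + i)`, and e further sides are bounded
   -- by `X`. The last `Y (j + i)` only meets the short side 2^j at `c`; their product is at most X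
   -- / 2^i, which makes the sum over `i` converge.
   length-followersAt : ∀ c j i → j + i ≤ L → length (followersAt c j i) ≤ G * X ^ (a′ + e) * (2 ^ j * Y (j + i))
   length-followersAt c j i j+i≤L = begin
     length (followersAt c j i)             ≡⟨ length-cartesianProductWith _ (slab c (6 * S) (6 * T)) (cube b Z) ⟩
     length (slab c (6 * S) (6 * T)) * length (cube b Z) ≡⟨ cong₂ _*_ (length-slab c (6 * S) (6 * T)) (length-cube b Z) ⟩
     width (6 * S) * width (6 * T) ^ a′ * width Z ^ b
       ≤⟨ *-mono-≤ (*-mono-≤ (width-6 S (2^>0 j) ≤-refl) (^-monoˡ-≤ a′ (width-6 T (2^>0 (j + i)) ≤-refl)))
                   (^-monoˡ-≤ b (width-Y Z (Y-pos (j + i) (2^≤X j+i≤L)))) ⟩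
     13 * S * (13 * T) ^ a′ * (3 * Z) ^ b   ≡⟨ cong₂ (λ p q → 13 * S * p * q) (^-distribʳ-* 13 T a′) (^-distribʳ-* 3 Z b) ⟩
     13 * S * (13 ^ a′ * T ^ a′) * (3 ^ b * (Z * Z ^ (a′ + e)))
       ≡⟨ cong (λ z → 13 * S * (13 ^ a′ * T ^ a′) * (3 ^ b * (Z * z))) (^-distribˡ-+-* Z a′ e) ⟩
     13 * S * (13 ^ a′ * T ^ a′) * (3 ^ b * (Z * (Z ^ a′ * Z ^ e)))
       ≡⟨ regroup 13 S (13 ^ a′) (T ^ a′) (3 ^ b) Z (Z ^ a′) (Z ^ e) ⟩
     G * (T ^ a′ * Z ^ a′ * Z ^ e) * (S * Z)
       ≤⟨ *-monoˡ-≤ (S * Z) (*-monoʳ-≤ G (*-mono-≤ (≤-trans (≤-reflexive (sym (^-distribʳ-* T Z a′))) (Y-power (j + i) a′)) (^-monoˡ-≤ e (Y≤X (j + i))))) ⟩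
     G * (X ^ a′ * X ^ e) * (S * Z)         ≡⟨ cong (λ z → G * z * (S * Z)) (^-distribˡ-+-* X a′ e) ⟨
     G * X ^ (a′ + e) * (S * Z)             ∎
     where
     open ≤-Reasoning
     S = 2 ^ j
     T = 2 ^ (j + i)
     Z = Y (j + i)
     regroup : ∀ c s p t q z y w → c * s * (p * t) * (q * (z * (y * w))) ≡ c * p * q * (t * y * w) * (s * z)
     regroup = solve-∀

   length-followers : ∀ c j → j ≤ L → suc (length (followers c j)) ≤ 3 * G * X ^ b
   length-followers c j j≤L = begin
     suc (length (followers c j))           ≡⟨ cong suc (length-concatUpTo (followersAt c j) (suc (L ∸ j))) ⟩
     suc (sumUpTo (length ∘ followersAt c j) (suc (L ∸ j)))
       ≤⟨ s≤s (sumUpTo-mono (suc (L ∸ j)) λ i i< → length-followersAt c j i (bounded i (s≤s⁻¹ i<))) ⟩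
     suc (sumUpTo (λ i → P * (2 ^ j * Y (j + i))) (suc (L ∸ j)))
       ≡⟨ cong suc (sumUpTo-*ˡ P (λ i → 2 ^ j * Y (j + i)) (suc (L ∸ j))) ⟩
     suc (P * sumUpTo (λ i → 2 ^ j * Y (j + i)) (suc (L ∸ j)))
       ≤⟨ s≤s (*-monoʳ-≤ P (sumUpTo-geometric (λ i → 2 ^ j * Y (j + i)) X (suc (L ∸ j)) decay)) ⟩
     suc (P * (2 * X))                      ≡⟨ cong suc (regroup G (X ^ (a′ + e)) X) ⟩
     -- The `suc` comes from `length-lists≤`, where a list of followers may also end early; one more
     -- `G * X ^ b` absorbs it.
     suc (2 * (G * X ^ b))                  ≤⟨ +-monoˡ-≤ (2 * (G * X ^ b)) (*-mono-≤ 1≤G (1≤X^ b)) ⟩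
     G * X ^ b + 2 * (G * X ^ b)            ≡⟨ *-assoc 3 G (X ^ b) ⟨
     3 * G * X ^ b                          ∎
     where
     open ≤-Reasoning
     P = G * X ^ (a′ + e)
     bounded : ∀ i → i ≤ L ∸ j → j + i ≤ L
     bounded i i≤ = ≤-trans (+-monoʳ-≤ j i≤) (≤-reflexive (m+[n∸m]≡n j≤L))
     decay : ∀ i → 2 ^ j * Y (j + i) * 2 ^ i ≤ X
     decay i = ≤-trans (≤-reflexive (trans (rotate (2 ^ j) (Y (j + i)) (2 ^ i)) (cong (Y (j + i) *_) (sym (^-distribˡ-+-* 2 j i))))) (Y-* (j + i))
       where
       rotate : ∀ p q r → p * q * r ≡ q * (p * r)
       rotate = solve-∀
     regroup : ∀ g x z → g * x * (2 * z) ≡ 2 * (g * (z * x))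
     regroup = solve-∀

   sum-Y : ∀ e → sumUpTo (λ j → Y j ^ e) (suc L) ≤ scales e L * X ^ e
   sum-Y zero    = ≤-reflexive (sumUpTo-const 1 (suc L))
   sum-Y (suc e) = begin
     sumUpTo (λ j → Y j * Y j ^ e) (suc L)   ≤⟨ sumUpTo-mono (suc L) (λ j _ → ≤-trans (≤-reflexive (*-comm (Y j) _)) (*-monoˡ-≤ (Y j) (^-monoˡ-≤ e (Y≤X j)))) ⟩
     sumUpTo (λ j → X ^ e * Y j) (suc L)     ≡⟨ sumUpTo-*ˡ (X ^ e) Y (suc L) ⟩
     X ^ e * sumUpTo Y (suc L)               ≤⟨ *-monoʳ-≤ (X ^ e) (sumUpTo-geometric Y X (suc L) Y-*) ⟩
     X ^ e * (2 * X)                         ≡⟨ regroup (X ^ e) X ⟩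
     2 * (X * X ^ e)                         ∎
     where
     open ≤-Reasoning
     regroup : ∀ p x → p * (2 * x) ≡ 2 * (x * p)
     regroup = solve-∀

   1≤scales : ∀ e → 1 ≤ scales e L
   1≤scales zero    = s≤s z≤n
   1≤scales (suc e) = s≤s z≤n

   length-codes : length codes ≤ countConstant a′ e m * (scales e L * (X ^ b) ^ suc m)
   length-codes = begin
     suc (length (concatUpTo at (suc L)))      ≡⟨ cong suc (length-concatUpTo at (suc L)) ⟩
     suc (sumUpTo (length ∘ at) (suc L))       ≤⟨ s≤s (sumUpTo-mono (suc L) (λ j j< → at-≤ j (s≤s⁻¹ j<))) ⟩
     suc (sumUpTo (λ j → P * Y j ^ e) (suc L)) ≡⟨ cong suc (sumUpTo-*ˡ P (λ j → Y j ^ e) (suc L)) ⟩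
     suc (P * sumUpTo (λ j → Y j ^ e) (suc L)) ≤⟨ s≤s (*-monoʳ-≤ P (sum-Y e)) ⟩
     -- The `suc` counts the empty code of the zero matrix. Doubling absorbs it and explains the 2
     -- in `countConstant`.
     suc (P * (W * X ^ e))                     ≤⟨ +-monoˡ-≤ (P * (W * X ^ e)) (*-mono-≤ 1≤P (*-mono-≤ (1≤scales e) (1≤X^ e))) ⟩
     P * (W * X ^ e) + P * (W * X ^ e)         ≡⟨ collect a G (X ^ a) F ((X ^ b) ^ m) W (X ^ e) ⟩
     2 * (a * G * F) * (W * (X ^ a * X ^ e * (X ^ b) ^ m)) ≡⟨ cong (λ z → 2 * (a * G * F) * (W * (z * (X ^ b) ^ m))) (^-distribˡ-+-* X a e) ⟨
     2 * (a * G * F) * (W * (X ^ b * (X ^ b) ^ m)) ∎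
     where
     open ≤-Reasoning
     W = scales e L
     F = (3 * G) ^ m
     at = λ j → concatMap (codesAt j) (allFin a)
     P = a * (G * X ^ a * (F * (X ^ b) ^ m))
     1≤P : 1 ≤ P
     1≤P = *-mono-≤ {1} {a} (s≤s z≤n) (*-mono-≤ {1} {G * X ^ a} (*-mono-≤ {1} {G} 1≤G (1≤X^ a))
       (*-mono-≤ {1} {F} (m^n>0 (3 * G) {{>-nonZero (*-mono-≤ {1} {3} (s≤s z≤n) 1≤G)}} m) (m^n>0 (X ^ b) {{>-nonZero (1≤X^ b)}} m)))
     collect : ∀ a g x f y w z → a * (g * x * (f * y)) * (w * z) + a * (g * x * (f * y)) * (w * z) ≡ 2 * (a * g * f) * (w * (x * z * y))
     collect = solve-∀
     codesAt-≤ : ∀ j → j ≤ L → ∀ c → length (codesAt j c) ≤ G * X ^ a * Y j ^ e * (F * (X ^ b) ^ m)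
     codesAt-≤ j j≤L c = begin
       length (codesAt j c)          ≡⟨ length-cartesianProductWith _ (leads j) (lists≤ (followers c j) m) ⟩
       length (leads j) * length (lists≤ (followers c j) m)
         ≤⟨ *-mono-≤ (length-leads j j≤L) (≤-trans (length-lists≤ (followers c j) m) (^-monoˡ-≤ m (length-followers c j j≤L))) ⟩
       G * X ^ a * Y j ^ e * (3 * G * X ^ b) ^ m
         ≡⟨ cong (G * X ^ a * Y j ^ e *_) (^-distribʳ-* (3 * G) (X ^ b) m) ⟩
       G * X ^ a * Y j ^ e * (F * (X ^ b) ^ m) ∎
     at-≤ : ∀ j → j ≤ L → length (at j) ≤ P * Y j ^ e
     at-≤ j j≤L = begin
       length (at j)                                             ≤⟨ length-concatMap-≤ (codesAt j) (allFin a) (codesAt-≤ j j≤L) ⟩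
       length (allFin a) * (G * X ^ a * Y j ^ e * (F * (X ^ b) ^ m)) ≡⟨ cong (_* (G * X ^ a * Y j ^ e * (F * (X ^ b) ^ m))) (length-tabulate {n = a} (λ i → i)) ⟩
       a * (G * X ^ a * Y j ^ e * (F * (X ^ b) ^ m))               ≡⟨ rotate a (G * X ^ a) (Y j ^ e) (F * (X ^ b) ^ m) ⟩
       P * Y j ^ e                                               ∎
       where
       rotate : ∀ a g y f → a * (g * y * f) ≡ a * (g * f) * y
       rotate = solve-∀

-- Derandomized deletion in uniform hypergraphs.

module RandomDeletion where

 open import Data.Nat.Base
 open import Data.Nat.Properties hiding (_≟_)
 open import Data.Nat.Tactic.RingSolver using (solve-∀)
 open import Data.List.Base using (List; []; _∷_; length; map; _++_; filter)
 open import Data.List.Properties using (length-++; filter-++; map-++)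
 open import Data.Nat.ListAction using (sum)
 open import Data.Nat.ListAction.Properties using (sum-++)
 open import Data.List.Membership.Propositional using (_∈_; _∉_)
 open import Data.List.Membership.Propositional.Properties using (∈-filter⁻)
 import Data.List.Membership.DecPropositional as DecMembership
 open import Data.List.Relation.Unary.All as All using (All; []; _∷_; all?)
 import Data.List.Relation.Unary.All.Properties as All
 open import Data.List.Relation.Unary.Any using (here; there)
 open import Data.List.Relation.Unary.AllPairs using ([]; _∷_)
 open import Data.List.Relation.Unary.Unique.Propositional using (Unique)
 import Data.List.Relation.Unary.Unique.Propositional.Properties as Unique
 open import Data.Product.Base using (∃; _×_; _,_; proj₁; proj₂)
 open import Function.Base using (_∘_)
 open import Relation.Binary.Definitions using (DecidableEquality)
 open import Relation.Binary.PropositionalEquality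
 open import Relation.Nullary using (¬_; Dec; yes; no; contradiction)
 open import Relation.Nullary.Decidable using (¬?)

 module Hypergraph {A : Set} (_≟_ : DecidableEquality A) where
   open DecMembership _≟_ using (_∈?_)

   Edges : Set
   Edges = List (List A)

   remove : A → List A → List A
   remove x = filter (λ y → ¬? (y ≟ x))

   remove-∉ : ∀ x e → x ∉ remove x e
   remove-∉ x e x∈ = proj₂ (∈-filter⁻ (λ y → ¬? (y ≟ x)) {xs = e} x∈) refl

   length-remove-∉ : ∀ x e → x ∉ e → length (remove x e) ≡ length e
   length-remove-∉ x []      x∉ = refl
   length-remove-∉ x (y ∷ e) x∉ with y ≟ x
   ... | yes refl = contradiction (here refl) x∉
   ... | no _     = cong suc (length-remove-∉ x e (x∉ ∘ there))

   length-remove-∈ : ∀ {x e} → Unique e → x ∈ e → suc (length (remove x e)) ≡ length e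
   length-remove-∈ {x} {y ∷ e} (y∉ ∷ uq) x∈ with y ≟ x | x∈
   ... | yes refl | _          = cong suc (length-remove-∉ x e λ p → All.lookup y∉ p refl)
   ... | no y≢x   | here refl  = contradiction refl y≢x
   ... | no _     | there p    = cong suc (length-remove-∈ uq p)

   length-remove : ∀ {x e} → Unique e → length e ≤ suc (length (remove x e))
   length-remove {x} {e} uq with x ∈? e
   ... | yes x∈ = ≤-reflexive (sym (length-remove-∈ uq x∈))
   ... | no x∉  = m≤n⇒m≤1+n (≤-reflexive (sym (length-remove-∉ x e x∉)))

   Contained : List A → List A → Set
   Contained S e = All (_∈ S) e

   abstract
     contained? : ∀ S e → Dec (Contained S e)
     contained? S = all? (_∈? S)

   contained : List A → Edges → ℕ
   contained S E = length (filter (contained? S) E)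

   contained-mono : ∀ {S S′} E → (∀ {x} → x ∈ S → x ∈ S′) → contained S E ≤ contained S′ E
   contained-mono []      S⊆S′ = z≤n
   contained-mono {S} {S′} (e ∷ E) S⊆S′ with contained? S e | contained? S′ e
   ... | yes _ | yes _  = s≤s (contained-mono E S⊆S′)
   ... | yes p | no ¬p  = contradiction (All.map S⊆S′ p) ¬p
   ... | no _  | yes _  = m≤n⇒m≤1+n (contained-mono E S⊆S′)
   ... | no _  | no _   = contained-mono E S⊆S′

   -- Once `x` is kept, an edge through `x` only constrains its remaining vertices; `link` collects
   -- these shortened edges.
   avoiding meeting link : A → Edges → Edges
   avoiding x = filter (λ e → ¬? (x ∈? e))
   meeting  x = filter (λ e → x ∈? e)
   link     x E = map (remove x) (meeting x E)

   contained-out : ∀ {x S} E → x ∉ S → contained S E ≤ contained S (avoiding x E)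
   contained-out []      x∉S = z≤n
   contained-out {x} {S} (e ∷ E) x∉S with x ∈? e
   ... | no _ with contained? S e
   ...   | yes _ = s≤s (contained-out E x∉S)
   ...   | no _  = contained-out E x∉S
   contained-out {x} {S} (e ∷ E) x∉S | yes x∈e with contained? S e
   ...   | yes p = contradiction (All.lookup p x∈e) x∉S
   ...   | no _  = contained-out E x∉S

   Contained-∷ : ∀ {x S} e → x ∉ e → Contained (x ∷ S) e → Contained S e
   Contained-∷ []      x∉e []             = []
   Contained-∷ (y ∷ e) x∉e (here refl ∷ p) = contradiction (here refl) x∉e
   Contained-∷ (y ∷ e) x∉e (there q ∷ p)   = q ∷ Contained-∷ e (x∉e ∘ there) p

   contained-in : ∀ x S E → contained (x ∷ S) E ≤ contained S (avoiding x E) + contained S (link x E)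
   contained-in x S []      = z≤n
   contained-in x S (e ∷ E) with x ∈? e
   ... | no x∉e with contained? (x ∷ S) e | contained? S e
   ...   | yes p | yes _ = s≤s (contained-in x S E)
   ...   | yes p | no ¬p = contradiction (Contained-∷ e x∉e p) ¬p
   ...   | no _  | yes _ = m≤n⇒m≤1+n (contained-in x S E)
   ...   | no _  | no _  = contained-in x S E
   contained-in x S (e ∷ E) | yes x∈e with contained? (x ∷ S) e | contained? S (remove x e)
   ...   | yes p | yes _ = ≤-trans (s≤s (contained-in x S E)) (≤-reflexive (sym (+-suc _ _)))
   ...   | yes p | no ¬p = contradiction (Contained-∷ (remove x e) (remove-∉ x e) (All.filter⁺ (λ y → ¬? (y ≟ x)) p)) ¬p
   ...   | no _  | yes _ = ≤-trans (contained-in x S E) (+-monoʳ-≤ _ (n≤1+n _))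
   ...   | no _  | no _  = contained-in x S E

   record Bounded (R : ℕ) (e : List A) : Set where
     constructor _,_
     field
       unique  : Unique e
       length≤ : length e ≤ R

   -- R-uniform weights: q ^ R times the expected number of edges inside a random set of density 1 / q.
   weight : ℕ → ℕ → Edges → ℕ
   weight q R E = sum (map (λ e → q ^ (R ∸ length e)) E)

   module _ (q R : ℕ) where

     weight-++ : ∀ E F → weight q R (E ++ F) ≡ weight q R E + weight q R F
     weight-++ E F = trans (cong sum (map-++ (λ e → q ^ (R ∸ length e)) E F)) (sum-++ (map _ E) (map _ F))

     weight-split : ∀ x E → weight q R E ≡ weight q R (avoiding x E) + weight q R (meeting x E)
     weight-split x []      = refl
     weight-split x (e ∷ E) with x ∈? e
     ... | yes _ = trans (cong (q ^ (R ∸ length e) +_) (weight-split x E)) (exchange (q ^ (R ∸ length e)) (weight q R (avoiding x E)) _)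
       where
       exchange : ∀ p s t → p + (s + t) ≡ s + (p + t)
       exchange = solve-∀
     ... | no _  = trans (cong (q ^ (R ∸ length e) +_) (weight-split x E)) (sym (+-assoc (q ^ (R ∸ length e)) (weight q R (avoiding x E)) _))

     -- An edge that loses one vertex is q times as likely to lie inside a random set of density
     -- 1/q.
     weight-link : ∀ x E → All (Bounded R) E → weight q R (link x E) ≡ q * weight q R (meeting x E)
     weight-link x []      []        = sym (*-zeroʳ q)
     weight-link x (e ∷ E) ((uq , len) ∷ h) with x ∈? e
     ... | no _   = weight-link x E h
     ... | yes x∈ = trans (cong₂ _+_ (cong (q ^_) one-more) (weight-link x E h)) (sym (*-distribˡ-+ q _ (weight q R (meeting x E))))
       where
       one-more : R ∸ length (remove x e) ≡ suc (R ∸ length e)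
       one-more = trans (+-∸-assoc 1 (subst (_≤ R) (sym (length-remove-∈ uq x∈)) len)) (cong (λ z → suc (R ∸ z)) (length-remove-∈ uq x∈))

     weight-[] : ∀ E → q ^ R * contained [] E ≤ weight q R E
     weight-[] []            = ≤-reflexive (*-zeroʳ (q ^ R))
     weight-[] (e ∷ E) with contained? [] e
     ... | no _           = ≤-trans (weight-[] E) (m≤n+m (weight q R E) _)
     ... | yes []         = ≤-trans (≤-reflexive (*-suc (q ^ R) (contained [] E))) (+-monoʳ-≤ (q ^ R) (weight-[] E))
     ... | yes (() ∷ _)

     weight-uniform : ∀ E → All (λ e → length e ≡ R) E → weight q R E ≡ length E
     weight-uniform []      []       = refl
     weight-uniform (e ∷ E) (p ∷ ps) = cong₂ _+_ (trans (cong (λ z → q ^ (R ∸ z)) p) (cong (q ^_) (n∸n≡0 R))) (weight-uniform E ps)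

   link-Bounded : ∀ {R} x E → All (Bounded R) E → All (Bounded R) (link x E)
   link-Bounded x E h = All.map⁺ (All.map (λ {e} (uq , len) → Unique.filter⁺ _ uq , ≤-trans (All-length e) len) (All.filter⁺ (λ e → x ∈? e) h))
     where
     open import Data.List.Properties using (length-filter)
     All-length : ∀ e → length (remove x e) ≤ length e
     All-length = length-filter (λ y → ¬? (y ≟ x))

   -- The method of conditional expectations: each vertex is kept or dropped so that
   -- q ^ R (length S - contained S E) does not fall below its expectation.
   conditional-expectations : ∀ q′ R xs → Unique xs → ∀ E → All (Bounded R) E → let q = suc q′ in
     ∃ λ S → Unique S × All (_∈ xs) S ×
     length xs * q ^ R + q * q ^ R * contained S E ≤ length S * (q * q ^ R) + q * weight q R E
   conditional-expectations q′ R [] _ E h = [] , [] , [] ,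
     ≤-trans (≤-reflexive (*-assoc (suc q′) (suc q′ ^ R) (contained [] E))) (*-monoʳ-≤ (suc q′) (weight-[] (suc q′) R E))
   -- Scaled by q^(R + 1), keeping `x` changes the expectation by (q - 1)(q^R - q W) and dropping it
   -- by q W - q^R, where W is the weight of the edges through `x`. One of the two is not negative,
   -- and the test decides which.
   conditional-expectations q′ R (x ∷ xs) (x∉ ∷ uq) E h with suc q′ * weight (suc q′) R (meeting x E) ≤? suc q′ ^ R
   ... | yes light = keep (conditional-expectations q′ R xs uq (avoiding x E ++ link x E)
                             (All.++⁺ (All.filter⁺ (λ e → ¬? (x ∈? e)) h) (link-Bounded x E h)))
     where
     q = suc q′
     T = q ^ R
     W₀ = weight q R (avoiding x E)
     W₁ = weight q R (meeting x E)
     keep : _ → _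
     keep (S , uqS , S⊆ , ineq) = x ∷ S , All.map (λ y∈ x≡y → All.lookup x∉ y∈ x≡y) S⊆ ∷ uqS , here refl ∷ All.map there S⊆ , (begin
       T + length xs * T + q * T * contained (x ∷ S) E
         ≤⟨ +-monoʳ-≤ (T + length xs * T) (*-monoʳ-≤ (q * T) (≤-trans (contained-in x S E) (≤-reflexive (sym count-++)))) ⟩
       T + length xs * T + q * T * contained S (avoiding x E ++ link x E)
         ≡⟨ +-assoc T (length xs * T) _ ⟩
       T + (length xs * T + q * T * contained S (avoiding x E ++ link x E))
         ≤⟨ +-monoʳ-≤ T ineq ⟩
       T + (length S * (q * T) + q * weight q R (avoiding x E ++ link x E))
         ≡⟨ cong (λ w → T + (length S * (q * T) + q * w)) (trans (weight-++ q R (avoiding x E) (link x E)) (cong (W₀ +_) (weight-link q R x E h))) ⟩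
       T + (length S * (q * T) + q * (W₀ + q * W₁))
         ≡⟨ regroup T (length S) q′ W₀ W₁ ⟩
       length S * (q * T) + q * (W₀ + W₁) + T + q′ * (q * W₁)
         ≤⟨ +-monoʳ-≤ (length S * (q * T) + q * (W₀ + W₁) + T) (*-monoʳ-≤ q′ light) ⟩
       length S * (q * T) + q * (W₀ + W₁) + T + q′ * T
         ≡⟨ regroup₂ T (length S) q′ (W₀ + W₁) ⟩
       q * T + length S * (q * T) + q * (W₀ + W₁)
         ≡⟨ cong (λ w → q * T + length S * (q * T) + q * w) (weight-split q R x E) ⟨
       q * T + length S * (q * T) + q * weight q R E ∎)
       where
       open ≤-Reasoning
       count-++ : contained S (avoiding x E ++ link x E) ≡ contained S (avoiding x E) + contained S (link x E)
       count-++ = trans (cong length (filter-++ (contained? S) (avoiding x E) (link x E))) (length-++ (filter (contained? S) (avoiding x E)))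
       regroup : ∀ t l q v w → t + (l * (suc q * t) + suc q * (v + suc q * w)) ≡ l * (suc q * t) + suc q * (v + w) + t + q * (suc q * w)
       regroup = solve-∀
       regroup₂ : ∀ t l q v → l * (suc q * t) + suc q * v + t + q * t ≡ suc q * t + l * (suc q * t) + suc q * v
       regroup₂ = solve-∀
   ... | no heavy = drop (conditional-expectations q′ R xs uq (avoiding x E) (All.filter⁺ (λ e → ¬? (x ∈? e)) h))
     where
     q = suc q′
     T = q ^ R
     W₀ = weight q R (avoiding x E)
     W₁ = weight q R (meeting x E)
     drop : _ → _
     drop (S , uqS , S⊆ , ineq) = S , uqS , All.map there S⊆ , (begin
       T + length xs * T + q * T * contained S E
         ≡⟨ +-assoc T (length xs * T) _ ⟩
       T + (length xs * T + q * T * contained S E)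
         ≤⟨ +-mono-≤ (<⇒≤ (≰⇒> heavy)) (+-monoʳ-≤ (length xs * T) (*-monoʳ-≤ (q * T) (contained-out E (λ x∈S → All.lookup x∉ (All.lookup S⊆ x∈S) refl)))) ⟩
       q * W₁ + (length xs * T + q * T * contained S (avoiding x E))
         ≤⟨ +-monoʳ-≤ (q * W₁) ineq ⟩
       q * W₁ + (length S * (q * T) + q * W₀)
         ≡⟨ regroup q W₁ (length S * (q * T)) W₀ ⟩
       length S * (q * T) + q * (W₀ + W₁)
         ≡⟨ cong (λ w → length S * (q * T) + q * w) (weight-split q R x E) ⟨
       length S * (q * T) + q * weight q R E ∎)
       where
       open ≤-Reasoning
       regroup : ∀ q w l v → q * w + (l + q * v) ≡ l + q * (v + w)
       regroup = solve-∀

   -- Dropping the first vertex of each edge still contained in the current set costs at most one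
   -- vertex per edge contained in `S`, since shrinking the set never brings in new edges.
   delete : ∀ S → Unique S → ∀ E → All (λ e → length e ≢ 0) E →
            ∃ λ S′ → Unique S′ × (∀ {x} → x ∈ S′ → x ∈ S) × All (λ e → ¬ Contained S′ e) E × length S ≤ length S′ + contained S E
   delete S uq []            []        = S , uq , (λ x∈ → x∈) , [] , m≤m+n _ 0
   delete S uq ([] ∷ E)      (ne ∷ _)  = contradiction refl ne
   delete S uq (e@(y ∷ _) ∷ E) (_ ∷ nes) with contained? S e
   ... | no ¬p with delete S uq E nes
   ...   | S′ , uq′ , S′⊆S , indep , len = S′ , uq′ , S′⊆S , (λ p → ¬p (All.map S′⊆S p)) ∷ indep , len
   delete S uq (e@(y ∷ _) ∷ E) (_ ∷ nes) | yes p with delete (remove y S) (Unique.filter⁺ _ uq) E nes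
   ...   | S′ , uq′ , S′⊆S , indep , len = S′ , uq′ , ⊆S , (λ { (y∈ ∷ _) → remove-∉ y S (S′⊆S y∈) }) ∷ indep , (begin
       length S                                              ≤⟨ length-remove uq ⟩
       suc (length (remove y S))                             ≤⟨ s≤s len ⟩
       suc (length S′ + contained (remove y S) E)            ≤⟨ s≤s (+-monoʳ-≤ (length S′) (contained-mono E (proj₁ ∘ ∈-filter⁻ _))) ⟩
       suc (length S′ + contained S E)                       ≡⟨ +-suc (length S′) _ ⟨
       length S′ + suc (contained S E)                       ∎)
       where
       open ≤-Reasoning
       ⊆S : ∀ {x} → x ∈ S′ → x ∈ S
       ⊆S x∈ = proj₁ (∈-filter⁻ (λ z → ¬? (z ≟ y)) (S′⊆S x∈))

   -- At density 1/q the expected number of vertices is `length xs / q`, and the bound on `length E`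
   -- makes the expected number of edges at most half of it. Deletion then leaves
   -- `length xs / (2 * q)` vertices.
   independent-set : ∀ q s (xs : List A) → 1 ≤ q → Unique xs → ∀ E → All (λ e → Unique e × length e ≡ suc s) E → 2 * length E ≤ length xs * q ^ s →
     ∃ λ S → Unique S × All (λ e → ¬ Contained S e) E × length xs ≤ 2 * q * length S
   independent-set q@(suc q′) s xs _ uq E h few
     with conditional-expectations q′ (suc s) xs uq E (All.map (λ (u , eq) → u , ≤-reflexive eq) h)
   ... | S , uqS , _ , ineq with delete S uqS E (All.map (λ (_ , eq) l≡0 → contradiction (trans (sym eq) l≡0) λ ()) h)
   ... | S′ , uq′ , _ , indep , len = S′ , uq′ , indep , *-cancelʳ-≤ (length xs) (2 * q * length S′) T {{m^n≢0 q (suc s)}}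
       (+-cancelˡ-≤ (length xs * T) _ _ (begin
     length xs * T + length xs * T             ≡⟨ regroup₁ (length xs * T) ⟩
     2 * (length xs * T)                       ≤⟨ *-monoʳ-≤ 2 (+-cancelʳ-≤ (q * T * c) _ _ step) ⟩
     2 * (length S′ * (q * T) + q * length E)  ≡⟨ regroup₂ (length S′) q T (length E) ⟩
     2 * q * length S′ * T + q * (2 * length E) ≤⟨ +-monoʳ-≤ (2 * q * length S′ * T) (*-monoʳ-≤ q few) ⟩
     2 * q * length S′ * T + q * (length xs * q ^ s) ≡⟨ regroup₃ (2 * q * length S′ * T) q (length xs) (q ^ s) ⟩
     length xs * T + 2 * q * length S′ * T     ∎))
     where
     open ≤-Reasoning
     T = q * q ^ s
     c = contained S E
     step : length xs * T + q * T * c ≤ length S′ * (q * T) + q * length E + q * T * c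
     step = begin
       length xs * T + q * T * c                      ≤⟨ ineq ⟩
       length S * (q * T) + q * weight q (suc s) E    ≡⟨ cong (λ w → length S * (q * T) + q * w) (weight-uniform q (suc s) E (All.map proj₂ h)) ⟩
       length S * (q * T) + q * length E              ≤⟨ +-monoˡ-≤ (q * length E) (*-monoˡ-≤ (q * T) len) ⟩
       (length S′ + c) * (q * T) + q * length E       ≡⟨ regroup (length S′) c (q * T) (q * length E) ⟩
       length S′ * (q * T) + q * length E + q * T * c ∎
       where
       regroup : ∀ l c t e → (l + c) * t + e ≡ l * t + e + t * c
       regroup = solve-∀
     regroup₁ : ∀ x → x + x ≡ 2 * x
     regroup₁ = solve-∀
     regroup₂ : ∀ l q t e → 2 * (l * (q * t) + q * e) ≡ 2 * q * l * t + q * (2 * e)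
     regroup₂ = solve-∀
     regroup₃ : ∀ a q x p → a + q * (x * p) ≡ x * (q * p) + a
     regroup₃ = solve-∀

-- From codes to subsets of the grid without r points on a k-flat.

module AdmissibleSets where

 open import Defs
 open Rationals
 open SupNorm
 open RealDependence
 open Factorization
 open Encoding
 open Counting
 open RandomDeletion
 open import Data.Nat.Base as ℕ using (ℕ; zero; suc; _^_; _∸_; _≤_; _<_)
 import Data.Nat.Properties as ℕ
 open import Data.Nat.DivMod using (_mod_; m<n⇒m%n≡m; m%n<n)
 open import Data.Nat.Tactic.RingSolver using (solve-∀)
 open import Data.Integer.Base as ℤ using (ℤ; +_)
 import Data.Integer.Properties as ℤ
 import Data.Integer.Tactic.RingSolver as ℤSolver
 open import Data.Rational.Base as ℚ using (ℚ)
 import Data.Rational.Properties as ℚ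
 open import Algebra.Bundles using (CommutativeRing)
 import Algebra.Properties.Semiring.Sum as Sum
 open import Data.Fin.Base using (Fin; zero; suc; toℕ)
 open import Data.Fin.Properties using (toℕ-injective; toℕ-fromℕ<; toℕ<n) renaming (_≟_ to _≟ᶠ_)
 open import Data.List.Base as List using (List; []; _∷_; length; filter; allFin; cartesianProductWith)
 open import Data.List.Properties using (length-tabulate; length-filter; length-map; tabulate-cong)
 open import Data.List.Membership.Propositional using (_∈_)
 open import Data.List.Membership.Propositional.Properties using (∈-cartesianProductWith⁺; ∈-cartesianProductWith⁻; ∈-filter⁺; ∈-allFin)
 open import Data.List.Relation.Unary.All as All using (All; []; _∷_)
 import Data.List.Relation.Unary.All.Properties as All
 open import Data.List.Relation.Unary.Any using (here)
 open import Data.List.Relation.Unary.AllPairs using ([]; _∷_)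
 open import Data.List.Relation.Unary.Unique.Propositional using (Unique)
 import Data.List.Relation.Unary.Unique.Propositional.Properties as Unique
 import Data.List.Relation.Unary.Unique.DecPropositional as DecUnique
 open import Data.Product.Base using (∃; _×_; _,_; proj₁; proj₂; swap)
 open import Data.Sum.Base using (inj₁; inj₂)
 open import Data.Vec.Base as Vec using (Vec; []; _∷_; lookup; tabulate)
 open import Data.Vec.Functional using (Vector)
 open import Data.Vec.Properties using (≡-dec; lookup∘tabulate; tabulate∘lookup; ∷-injective) renaming (tabulate-cong to vtabulate-cong)
 open import Function.Base using (_∘_)
 open import Relation.Binary.Definitions using (DecidableEquality)
 open import Relation.Binary.PropositionalEquality
 open import Relation.Nullary using (¬_)
 open import Relation.Nullary.Negation using (DoubleNegation)

 grid : ∀ n d → List (GridPoint n d)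
 grid n zero    = [] ∷ []
 grid n (suc d) = cartesianProductWith _∷_ (allFin n) (grid n d)

 length-grid : ∀ n d → length (grid n d) ≡ n ^ d
 length-grid n zero    = refl
 length-grid n (suc d) = trans (length-cartesianProductWith _∷_ (allFin n) (grid n d))
   (cong₂ ℕ._*_ (length-tabulate {n = n} (λ i → i)) (length-grid n d))

 ∈-grid : ∀ {n d} (x : GridPoint n d) → x ∈ grid n d
 ∈-grid []      = here refl
 ∈-grid (i ∷ x) = ∈-cartesianProductWith⁺ _∷_ (∈-allFin i) (∈-grid x)

 grid-unique : ∀ n d → Unique (grid n d)
 grid-unique n zero    = [] ∷ []
 grid-unique n (suc d) = Unique.cartesianProductWith⁺ _∷_ ∷-injective (Unique.allFin⁺ n) (grid-unique n d)

 _≟ᵍ_ : ∀ {n d} → DecidableEquality (GridPoint n d)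
 _≟ᵍ_ = ≡-dec _≟ᶠ_

 coordinate : ∀ {n d} → GridPoint n d → Fin d → ℤ
 coordinate x j = + toℕ (lookup x j)

 -- Wraps around outside the grid, where its value is irrelevant.
 shift : ∀ {n} → Fin n → ℤ → Fin n
 shift {suc n} x z = ℤ.∣ + toℕ x ℤ.+ z ∣ mod suc n

 shift-difference : ∀ {n} (x y : Fin n) → shift x (+ toℕ y ℤ.- + toℕ x) ≡ y
 shift-difference {suc n} x y = toℕ-injective (begin
   toℕ (ℤ.∣ + toℕ x ℤ.+ (+ toℕ y ℤ.- + toℕ x) ∣ mod suc n)  ≡⟨ cong (λ z → toℕ (ℤ.∣ z ∣ mod suc n)) (cancel (+ toℕ x) (+ toℕ y)) ⟩
   toℕ (toℕ y mod suc n)                                    ≡⟨ toℕ-fromℕ< (m%n<n (toℕ y) (suc n)) ⟩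
   toℕ y ℕ.% suc n                                          ≡⟨ m<n⇒m%n≡m (toℕ<n y) ⟩
   toℕ y                                                    ∎)
   where
   open ≡-Reasoning
   cancel : ∀ p q → p ℤ.+ (q ℤ.- p) ≡ q
   cancel = ℤSolver.solve-∀

 translate : ∀ {n d s} → GridPoint n d → (Fin s → Fin d → ℤ) → List (GridPoint n d)
 translate p N = p ∷ List.tabulate (λ l → tabulate (λ j → shift (lookup p j) (N l j)))

 translate-differences : ∀ {n d s} (p : Fin (suc s) → GridPoint n d) (N : Fin s → Fin d → ℤ) →
   (∀ l j → N l j ≡ coordinate (p (suc l)) j ℤ.- coordinate (p zero) j) → translate (p zero) N ≡ List.tabulate p
 translate-differences p N eq = cong (p zero ∷_) (tabulate-cong λ l → trans
   (vtabulate-cong (λ j → trans (cong (shift (lookup (p zero) j)) (eq l j)) (shift-difference (lookup (p zero) j) (lookup (p (suc l)) j))))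
   (tabulate∘lookup (p (suc l))))

 differences : ∀ {n d s} → (Fin (suc s) → GridPoint n d) → Vec (Vec ℤ d) s
 differences p = tabulate λ l → tabulate λ j → coordinate (p (suc l)) j ℤ.- coordinate (p zero) j

 lookup-differences : ∀ {n d s} (p : Fin (suc s) → GridPoint n d) l j →
                      lookup (lookup (differences p) l) j ≡ coordinate (p (suc l)) j ℤ.- coordinate (p zero) j
 lookup-differences p l j = trans (cong (λ v → lookup v j) (lookup∘tabulate _ l)) (lookup∘tabulate _ j)

 differences-small : ∀ {n d s} (p : Fin (suc s) → GridPoint n d) l → ‖ lookup (differences p) l ‖ ≤ n
 differences-small {n} p l = ‖‖-least (lookup (differences p) l) λ j → subst (λ z → ℤ.∣ z ∣ ≤ n) (sym (lookup-differences p l j))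
   (bound (toℕ (lookup (p (suc l)) j)) (toℕ (lookup (p zero) j)) (ℕ.<⇒≤ (toℕ<n _)) (ℕ.<⇒≤ (toℕ<n _)))
   where
   bound : ∀ x y → x ≤ n → y ≤ n → ℤ.∣ + x ℤ.- + y ∣ ≤ n
   bound x y x≤n y≤n rewrite ℤ.m-n≡m⊖n x y | ℤ.∣m⊖n∣≡∣n⊖m∣ x y with ℕ.≤-total x y
   ... | inj₁ x≤y rewrite ℤ.⊖-≥ x≤y = ℕ.≤-trans (ℕ.m∸n≤m y x) y≤n
   ... | inj₂ y≤x rewrite ℤ.⊖-≤ y≤x | ℤ.∣-i∣≡∣i∣ (+ (x ∸ y)) = ℕ.≤-trans (ℕ.m∸n≤m x y) x≤n

 module CombinationDifference {c ℓ} (R : CommutativeRing c ℓ) where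
   open CommutativeRing R renaming (sym to ≈-sym; trans to ≈-trans) hiding (refl; setoid; zero)
   open Sum semiring using (sum; sum-cong-≋; ∑-distrib-+)
   open import Algebra.Properties.Ring ring using (-‿+-comm; -‿distribˡ-*; -0#≈0#)
   open import Relation.Binary.Reasoning.Setoid (CommutativeRing.setoid R)

   sum-neg : ∀ {k} (f : Vector Carrier k) → sum (λ i → - f i) ≈ - sum f
   sum-neg {zero}  f = ≈-sym (-0#≈0#)
   sum-neg {suc k} f = ≈-trans (+-congˡ (sum-neg (f ∘ suc))) (-‿+-comm (f zero) (sum (f ∘ suc)))

   combination-difference : ∀ {k} {x x₀} b (t s v : Vector Carrier k) →
     x ≈ b + sum (λ i → t i * v i) → x₀ ≈ b + sum (λ i → s i * v i) →
     x - x₀ ≈ sum (λ i → (t i - s i) * v i)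
   combination-difference {x = x} {x₀} b t s v p q = begin
     x - x₀                                   ≈⟨ +-cong p (-‿cong q) ⟩
     (b + S) - (b + S₀)                       ≈⟨ +-cong (+-comm b S) (≈-sym (-‿+-comm b S₀)) ⟩
     (S + b) + (- b - S₀)                     ≈⟨ +-assoc S b (- b - S₀) ⟩
     S + (b + (- b - S₀))                     ≈⟨ +-congˡ (+-assoc b (- b) (- S₀)) ⟨
     S + ((b - b) - S₀)                       ≈⟨ +-congˡ (≈-trans (+-congʳ (-‿inverseʳ b)) (+-identityˡ (- S₀))) ⟩
     S - S₀                                   ≈⟨ +-congˡ (sum-neg (λ i → s i * v i)) ⟨
     S + sum (λ i → - (s i * v i))            ≈⟨ ∑-distrib-+ (λ i → t i * v i) (λ i → - (s i * v i)) ⟨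
     sum (λ i → t i * v i + - (s i * v i))    ≈⟨ sum-cong-≋ (λ i → ≈-sym (≈-trans (distribʳ (v i) (t i) (- s i)) (+-congˡ (≈-sym (-‿distribˡ-* (s i) (v i)))))) ⟩
     sum (λ i → (t i - s i) * v i)            ∎
     where
     S  = sum (λ i → t i * v i)
     S₀ = sum (λ i → s i * v i)

 Null-resp : ∀ {s t : ℕ → ℚ} → (∀ n → s n ≡ t n) → Null s → Null t
 Null-resp eq h ε = proj₁ (h ε) , λ n N≤n → subst (λ z → ℚ.∣ z ∣ ℚ.< ε) (eq n) (proj₂ (h ε) n N≤n)

 difference-cong : ∀ x x′ y y′ → x ≈ᴿ x′ → y ≈ᴿ y′ → (x +ᴿ -ᴿ y) ≈ᴿ (x′ +ᴿ -ᴿ y′)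
 difference-cong x x′ y y′ p q = Rᴿ.+-cong {x} {x′} { -ᴿ y} { -ᴿ y′} p (Rᴿ.-‿cong {y} {y′} q)

 coordinate-difference : ∀ {n d} (x y : GridPoint n d) j →
   ι (coordinate x j ℤ.- coordinate y j) ≡ fromℕ (suc (toℕ (lookup x j))) ℚ.- fromℕ (suc (toℕ (lookup y j)))
 coordinate-difference x y j = trans (cong ι (unshift a b)) (trans (ι-+ (ℤ.1ℤ ℤ.+ a) (ℤ.- (ℤ.1ℤ ℤ.+ b))) (cong (ℚ._+_ (ι (ℤ.1ℤ ℤ.+ a))) (ι-neg (ℤ.1ℤ ℤ.+ b))))
   where
   a = coordinate x j
   b = coordinate y j
   unshift : ∀ a b → a ℤ.- b ≡ (ℤ.1ℤ ℤ.+ a) ℤ.+ ℤ.- (ℤ.1ℤ ℤ.+ b)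
   unshift = ℤSolver.solve-∀

 -- The identity is checked on the representing sequences.
 combination-difference : ∀ {k d} (z x x₀ b : ℝ) (t₁ t₀ : Vector ℝ k) (D : Fin k → Vector ℝ d) j →
   (∀ n → seq z n ≡ seq x n ℚ.- seq x₀ n) → x ≈ᴿ (b +ᴿ combination t₁ D j) → x₀ ≈ᴿ (b +ᴿ combination t₀ D j) →
   z ≈ᴿ combination (λ i → t₁ i +ᴿ -ᴿ t₀ i) D j
 combination-difference z x x₀ b t₁ t₀ D j eq p q =
   Null-resp (λ n → cong₂ ℚ._-_ (sym (eq n)) (pointwise n))
     (difference-cong x (b +ᴿ combination t₁ D j) x₀ (b +ᴿ combination t₀ D j) p q)
   where
   pointwise : ∀ n → (seq b n ℚ.+ seq (combination t₁ D j) n) ℚ.- (seq b n ℚ.+ seq (combination t₀ D j) n)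
                   ≡ seq (combination (λ i → t₁ i +ᴿ -ᴿ t₀ i) D j) n
   pointwise n = trans
     (CombinationDifference.combination-difference ℚ.+-*-commutativeRing (seq b n)
       (λ i → seq (t₁ i) n) (λ i → seq (t₀ i) n) (λ i → seq (D i j) n)
       (cong (ℚ._+_ (seq b n)) (seq-∑ (λ i → t₁ i *ᴿ D i j) n))
       (cong (ℚ._+_ (seq b n)) (seq-∑ (λ i → t₀ i *ᴿ D i j) n)))
     (sym (seq-∑ (λ i → (t₁ i +ᴿ -ᴿ t₀ i) *ᴿ D i j) n))

 differences-onDirections : ∀ {n d s k} (p : Fin (suc s) → GridPoint n d) (A : AffineSubspace k d) →
   (∀ i → toℝ^ (p i) liesOn A) → ∀ l → OnDirections (AffineSubspace.direction A) (lookup (differences p) l)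
 differences-onDirections p A on l =
   (λ i → proj₁ (on (suc l)) i +ᴿ -ᴿ proj₁ (on zero) i) , λ j →
   combination-difference (fromℚ (ι (lookup (lookup (differences p) l) j))) (toℝ^ (p (suc l)) j) (toℝ^ (p zero) j) (base j)
     (proj₁ (on (suc l))) (proj₁ (on zero)) direction j
     (λ _ → trans (cong ι (lookup-differences p l j)) (coordinate-difference (p (suc l)) (p zero) j))
     (proj₂ (on (suc l)) j) (proj₂ (on zero) j)
   where open AffineSubspace A

 -- Double negation is enough, because a cover only serves to refute a flat through r points, and
 -- the lattice reduction behind it gives no more.
 Covers : ∀ {C : Set} (n d s k : ℕ) → List C → (C → Fin s → Fin d → ℤ) → Set
 Covers n d s k codes decode = (D : Fin k → Vector ℝ d) (w : Vec (Vec ℤ d) s) →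
   (∀ l → OnDirections D (lookup w l)) → (∀ l → ‖ lookup w l ‖ ≤ n) →
   DoubleNegation (∃ λ c → c ∈ codes × (∀ l j → decode c l j ≡ lookup (lookup w l) j))

 -- An r-tuple on a k-flat is its first point together with the shifts of it by a coded difference
 -- matrix, so these tuples are among `n ^ d * length codes` candidates. Codes may also produce
 -- tuples on no flat, and forbidding those is harmless. Candidates with a repeated point are
 -- filtered out, as edges must consist of s + 1 distinct points.
 large-admissible : ∀ {C : Set} n d s k (codes : List C) decode q → Covers n d s k codes decode →
   1 ≤ q → 2 ℕ.* length codes ≤ q ^ s → ∃ λ m → AdmissibleSize n d k (suc s) m × n ^ d ≤ 2 ℕ.* q ℕ.* m
 large-admissible n d s k codes decode q covers 1≤q few =
   let S , uqS , indep , large = independent-set q s (grid n d) 1≤q (grid-unique n d) edges edges-uniform edges-few in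
   length S , (S , uqS , refl , no-flat S indep) , subst (ℕ._≤ 2 ℕ.* q ℕ.* length S) (length-grid n d) large
   where
   open Hypergraph {GridPoint n d} _≟ᵍ_
   open DecUnique (_≟ᵍ_ {n} {d}) using (unique?)
   tuple : GridPoint n d → _ → List (GridPoint n d)
   tuple p c = translate p (decode c)
   all-tuples : Edges
   all-tuples = cartesianProductWith tuple (grid n d) codes
   edges : Edges
   edges = filter unique? all-tuples
   edges-uniform : All (λ e → Unique e × length e ≡ suc s) edges
   edges-uniform = All.zip (All.all-filter unique? all-tuples , All.filter⁺ unique? (All.tabulate uniform))
     where
     uniform : ∀ {e} → e ∈ all-tuples → length e ≡ suc s
     uniform e∈ with ∈-cartesianProductWith⁻ tuple (grid n d) codes e∈
     ... | p , c , _ , _ , refl = cong suc (length-tabulate _)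
   edges-few : 2 ℕ.* length edges ≤ length (grid n d) ℕ.* q ^ s
   edges-few = begin
     2 ℕ.* length edges                            ≤⟨ ℕ.*-monoʳ-≤ 2 (length-filter unique? all-tuples) ⟩
     2 ℕ.* length all-tuples                       ≡⟨ cong (2 ℕ.*_) (length-cartesianProductWith tuple (grid n d) codes) ⟩
     2 ℕ.* (length (grid n d) ℕ.* length codes)    ≡⟨ exchange (length (grid n d)) (length codes) ⟩
     length (grid n d) ℕ.* (2 ℕ.* length codes)    ≤⟨ ℕ.*-monoʳ-≤ (length (grid n d)) few ⟩
     length (grid n d) ℕ.* q ^ s                 ∎
     where
     open ℕ.≤-Reasoning
     exchange : ∀ x y → 2 ℕ.* (x ℕ.* y) ≡ x ℕ.* (2 ℕ.* y)
     exchange = solve-∀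
   no-flat : ∀ S → All (λ e → ¬ Contained S e) edges → NoRPointsOnCommonFlat k (suc s) S
   no-flat S indep p p-inj p∈S (A , on) =
     covers (AffineSubspace.direction A) (differences p) (differences-onDirections p A on) (differences-small p) λ (c , c∈ , eq) →
       let same = translate-differences p (decode c) (λ l j → trans (eq l j) (lookup-differences p l j)) in
       All.lookup indep
         (∈-filter⁺ unique? (∈-cartesianProductWith⁺ tuple (∈-grid (p zero)) c∈) (subst Unique (sym same) (Unique.tabulate⁺ p-inj)))
         (subst (Contained S) (sym same) (All.tabulate⁺ p∈S))

 entry-swap : ∀ {a b} (ps : List (Pair a b)) i j → entry (List.map swap ps) j i ≡ entry ps i j
 entry-swap []             i j = refl
 entry-swap ((x , y) ∷ ps) i j = cong₂ ℤ._+_ (ℤ.*-comm (lookup y j) (lookup x i)) (entry-swap ps i j)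

 Good-swap : ∀ {a b X} {p : Pair a b} → Good X p → Good X (swap p)
 Good-swap {X = X} {p = x , y} (x≢0 , y≢0 , le) = y≢0 , x≢0 , subst (ℕ._≤ X) (ℕ.*-comm ‖ x ‖ ‖ y ‖) le

 Good-mono : ∀ {a b X Z} {p : Pair a b} → X ≤ Z → Good X p → Good Z p
 Good-mono X≤Z (x≢0 , y≢0 , le) = x≢0 , y≢0 , ℕ.≤-trans le X≤Z

 -- scaleConstant · n bounds the products of the norms of the paired vectors after normalization.
 scaleConstant : ℕ → ℕ → ℕ → ℕ
 scaleConstant d s m = suc (supConstant d s) ℕ.* suc (2 ℕ.* m)

 module _ {d s m n L : ℕ} (X<2^L : scaleConstant d s m ℕ.* n < 2 ^ suc L) where
   private
     X₀ = suc (supConstant d s) ℕ.* n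
     X  = scaleConstant d s m ℕ.* n
     X₀≤ : X₀ ℕ.+ m ℕ.* (2 ℕ.* X₀) ≤ X
     X₀≤ = ℕ.≤-reflexive (regroup (suc (supConstant d s)) n m)
       where
       regroup : ∀ K n m → K ℕ.* n ℕ.+ m ℕ.* (2 ℕ.* (K ℕ.* n)) ≡ K ℕ.* suc (2 ℕ.* m) ℕ.* n
       regroup = solve-∀

   covers-columns : Covers n d s (suc m) (Codes.codes d s X L m) (λ qs l j → entry qs j l)
   covers-columns D w onD w≤n cont = factorization n D w onD w≤n λ (ps , len , good , eq) →
     let qs , qs∈ , eq′ = Codes.encode d s X L m X₀ X₀≤ X<2^L ps len (All.map (λ {p} → Good-mono {p = p} (ℕ.*-monoˡ-≤ n (ℕ.n≤1+n (supConstant d s)))) good) in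
     cont (qs , qs∈ , λ l j → trans (eq′ j l) (eq j l))

   -- Swapping each pair transposes the matrix, so that the leads and their scales live in ℤ^s. The
   -- count needs them in the smaller dimension, so this is the version for s < d.
   covers-rows : Covers n d s (suc m) (Codes.codes s d X L m) (λ qs l j → entry qs l j)
   covers-rows D w onD w≤n cont = factorization n D w onD w≤n λ (ps , len , good , eq) →
     let qs , qs∈ , eq′ = Codes.encode s d X L m X₀ X₀≤ X<2^L (List.map swap ps)
           (subst (ℕ._≤ suc m) (sym (length-map swap ps)) len)
           (All.map⁺ (All.map (λ {p} g → Good-swap {p = p} (Good-mono {p = p} (ℕ.*-monoˡ-≤ n (ℕ.n≤1+n (supConstant d s))) g)) good)) in
     cont (qs , qs∈ , λ l j → trans (eq′ l j) (trans (entry-swap ps j l) (eq j l)))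

 -- κ is a scaleConstant and a = 1 + a′, b = a + e, k = 1 + m.
 sizeConstant : ℕ → ℕ → ℕ → ℕ → ℕ
 sizeConstant κ a′ e m = 2 ℕ.* (countConstant a′ e m ℕ.* suc κ ℕ.* (κ ^ suc (a′ ℕ.+ e)) ^ suc m)

 -- Replaces `X = κ * n` by `n`. Powers of `κ` go into the constant; for the number of scales,
 -- `κ ≤ 2 ^ κ` gives `L ≤ κ + λ′` and so a loss of at most `suc κ`.
 few-codes : ∀ κ a′ e m n L λ′ → 1 ≤ κ ℕ.* n → 2 ^ L ≤ κ ℕ.* n → n < 2 ^ suc λ′ →
   2 ℕ.* length (Codes.codes (suc a′) (suc (a′ ℕ.+ e)) (κ ℕ.* n) L m)
     ≤ sizeConstant κ a′ e m ℕ.* (scales e λ′ ℕ.* n ^ (suc (a′ ℕ.+ e) ℕ.* suc m))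
 few-codes κ a′ e m n L λ′ 1≤X 2^L≤X n<2^ = begin
   2 ℕ.* length (Codes.codes (suc a′) b X L m)                       ≤⟨ ℕ.*-monoʳ-≤ 2 (Count.length-codes a′ e m X L 1≤X 2^L≤X) ⟩
   2 ℕ.* (C ℕ.* (scales e L ℕ.* (X ^ b) ^ suc m))                ≤⟨ ℕ.*-monoʳ-≤ 2 (ℕ.*-monoʳ-≤ C (ℕ.*-monoˡ-≤ _ (scales-≤ e))) ⟩
   2 ℕ.* (C ℕ.* (suc κ ℕ.* W ℕ.* (X ^ b) ^ suc m))               ≡⟨ cong (λ z → 2 ℕ.* (C ℕ.* (suc κ ℕ.* W ℕ.* z)))
       (trans (cong (ℕ._^ suc m) (^-distribʳ-* κ n b)) (trans (^-distribʳ-* (κ ^ b) (n ^ b) (suc m)) (cong ((κ ^ b) ^ suc m ℕ.*_) (ℕ.^-*-assoc n b (suc m))))) ⟩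
   2 ℕ.* (C ℕ.* (suc κ ℕ.* W ℕ.* ((κ ^ b) ^ suc m ℕ.* n ^ (b ℕ.* suc m)))) ≡⟨ regroup C (suc κ) W ((κ ^ b) ^ suc m) (n ^ (b ℕ.* suc m)) ⟩
   2 ℕ.* (C ℕ.* suc κ ℕ.* (κ ^ b) ^ suc m) ℕ.* (W ℕ.* n ^ (b ℕ.* suc m)) ∎
   where
   open ℕ.≤-Reasoning
   b = suc (a′ ℕ.+ e)
   X = κ ℕ.* n
   C = countConstant a′ e m
   W = scales e λ′
   regroup : ∀ c k w p q → 2 ℕ.* (c ℕ.* (k ℕ.* w ℕ.* (p ℕ.* q))) ≡ 2 ℕ.* (c ℕ.* k ℕ.* p) ℕ.* (w ℕ.* q)
   regroup = solve-∀
   κ≤2^ : ∀ κ → κ ≤ 2 ^ κ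
   κ≤2^ zero    = ℕ.z≤n
   κ≤2^ (suc κ) = ℕ.+-mono-≤ (2^>0 κ) (ℕ.≤-trans (κ≤2^ κ) (ℕ.m≤m+n (2 ^ κ) 0))
   L≤ : L ≤ κ ℕ.+ λ′
   L≤ = ℕ.s≤s⁻¹ (2^-cancel-< {L} {suc (κ ℕ.+ λ′)} (ℕ.≤-<-trans 2^L≤X (ℕ.<-≤-trans (κn< κ 1≤X) (ℕ.≤-trans (ℕ.*-monoˡ-≤ (2 ^ suc λ′) (κ≤2^ κ))
           (ℕ.≤-reflexive (trans (sym (ℕ.^-distribˡ-+-* 2 κ (suc λ′))) (cong (2 ^_) (ℕ.+-suc κ λ′))))))))
     where
     κn< : ∀ κ → 1 ≤ κ ℕ.* n → κ ℕ.* n < κ ℕ.* 2 ^ suc λ′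
     κn< κ@(suc _) _ = ℕ.*-monoʳ-< κ n<2^
   scales-≤ : ∀ e → scales e L ≤ suc κ ℕ.* scales e λ′
   scales-≤ zero    = begin
     suc L                     ≤⟨ ℕ.s≤s L≤ ⟩
     suc (κ ℕ.+ λ′)            ≡⟨ cong suc (ℕ.+-comm κ λ′) ⟩
     suc λ′ ℕ.+ κ              ≤⟨ ℕ.+-monoʳ-≤ (suc λ′) (ℕ.m≤m*n κ (suc λ′)) ⟩
     suc λ′ ℕ.+ κ ℕ.* suc λ′   ∎
   scales-≤ (suc e) = ℕ.m≤m+n 2 (κ ℕ.* 2)

-- Powers, integer roots and a lower bound for the logarithm.

module Powers where

 open import Defs using (_^ℚ_; _^ᶜ_; root; log)
 open Rationals
 open import Data.Nat.Base as ℕ using (ℕ; zero; suc)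
 import Data.Nat.Properties as ℕ
 open import Data.Nat.Tactic.RingSolver using (solve-∀)
 open import Data.Integer.Base as ℤ using (ℤ; +_; -[1+_])
 import Data.Integer.Properties as ℤ
 open import Data.Rational.Base as ℚ hiding (_⊔_)
 open import Data.Rational.Properties
 open import Algebra.Bundles using (CommutativeRing)
 open import Algebra.Properties.CommutativeSemiring.Exp (CommutativeRing.commutativeSemiring +-*-commutativeRing) using (^-distrib-*; ^-assocʳ)
 open import Data.Product.Base using (∃; _×_; _,_)
 open import Relation.Binary.PropositionalEquality hiding (J)
 open import Relation.Nullary using (yes; no; contradiction)


 0≤ι : ∀ m → 0ℚ ≤ ι (+ m)
 0≤ι m = nonNegative⁻¹ (ι (+ m)) {{ι-nonNeg m}}

 ι-mono : ∀ {m n} → m ℕ.≤ n → ι (+ m) ≤ ι (+ n)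
 ι-mono m≤n = ι-mono-≤ (ℤ.+≤+ m≤n)

 ι-cancel : ∀ {m n} → ι (+ m) ≤ ι (+ n) → m ℕ.≤ n
 ι-cancel h = ℤ.drop‿+≤+ (ι-cancel-≤ h)

 ι-*ℕ : ∀ m n → ι (+ (m ℕ.* n)) ≡ ι (+ m) * ι (+ n)
 ι-*ℕ m n = trans (cong ι (ℤ.pos-* m n)) (ι-* (+ m) (+ n))

 ι-^ : ∀ m n → ι (+ m) ^ℚ n ≡ ι (+ (m ℕ.^ n))
 ι-^ m zero    = refl
 ι-^ m (suc n) = trans (cong (_*_ (ι (+ m))) (ι-^ m n)) (sym (ι-*ℕ m (m ℕ.^ n)))

 private
   *-mono-≤ : ∀ {p q r s} → 0ℚ ≤ p → 0ℚ ≤ s → p ≤ q → r ≤ s → p * r ≤ q * s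
   *-mono-≤ {p} {q} {r} {s} 0≤p 0≤s p≤q r≤s =
     ≤-trans (*-monoˡ-≤-nonNeg p {{nonNegative 0≤p}} r≤s) (*-monoʳ-≤-nonNeg s {{nonNegative 0≤s}} p≤q)

 ^-nonNeg : ∀ {p} n → 0ℚ ≤ p → 0ℚ ≤ p ^ℚ n
 ^-nonNeg zero    0≤p = nonNegative⁻¹ 1ℚ
 ^-nonNeg {p} (suc n) 0≤p = subst (_≤ p * p ^ℚ n) (*-zeroʳ p) (*-monoˡ-≤-nonNeg p {{nonNegative 0≤p}} (^-nonNeg n 0≤p))

 ^-mono-≤ : ∀ {p q} n → 0ℚ ≤ p → p ≤ q → p ^ℚ n ≤ q ^ℚ n
 ^-mono-≤ zero    0≤p p≤q = ≤-refl
 ^-mono-≤ (suc n) 0≤p p≤q = *-mono-≤ 0≤p (^-nonNeg n (≤-trans 0≤p p≤q)) p≤q (^-mono-≤ n 0≤p p≤q)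

 ^-mono-< : ∀ {p q} n → 0ℚ ≤ p → p < q → p ^ℚ suc n < q ^ℚ suc n
 ^-mono-< {p} {q} zero    0≤p p<q = subst₂ _<_ (sym (*-identityʳ p)) (sym (*-identityʳ q)) p<q
 ^-mono-< {p} {q} (suc n) 0≤p p<q = ≤-<-trans
   (*-monoˡ-≤-nonNeg p {{nonNegative 0≤p}} (<⇒≤ (^-mono-< n 0≤p p<q)))
   (*-monoˡ-<-pos (q ^ℚ suc n) {{positive (≤-<-trans (^-nonNeg (suc n) 0≤p) (^-mono-< n 0≤p p<q))}} p<q)

 ^-cancel-≤ : ∀ {p q} n → 0ℚ ≤ q → p ^ℚ suc n ≤ q ^ℚ suc n → p ≤ q
 ^-cancel-≤ n 0≤q h = ≮⇒≥ λ q<p → <-irrefl refl (<-≤-trans (^-mono-< n 0≤q q<p) h)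

 ^-exchange : ∀ p m n → (p ^ℚ m) ^ℚ n ≡ (p ^ℚ n) ^ℚ m
 ^-exchange p m n = trans (^-assocʳ p m n) (trans (cong (p ^ℚ_) (ℕ.*-comm m n)) (sym (^-assocʳ p n m)))

 -- The cut uses the exponent in lowest terms a / b, while the size bound has denominator `suc s`.
 -- As a * suc s = A * b, raising to the power `suc s` and then taking a b-th root converts one into
 -- the other. A negative numerator is impossible because `A` is a natural number.
 cut-power : ∀ α A s → α * ι (+ suc s) ≡ ι (+ A) → ∀ n {x} → (n ^ᶜ α) x → 0ℚ ≤ x × x ^ℚ suc s ≤ ι (+ (n ℕ.^ A))
 cut-power α@(mkℚ (+ a) b-1 _) A s eq n {x} (0≤x , h) = 0≤x , ^-cancel-≤ b-1 (0≤ι (n ℕ.^ A)) (begin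
   (x ^ℚ suc s) ^ℚ b              ≡⟨ ^-exchange x (suc s) b ⟩
   (x ^ℚ b) ^ℚ suc s              ≤⟨ ^-mono-≤ (suc s) (^-nonNeg b 0≤x) h ⟩
   ι (+ (n ℕ.^ a)) ^ℚ suc s       ≡⟨ ι-^ (n ℕ.^ a) (suc s) ⟩
   ι (+ ((n ℕ.^ a) ℕ.^ suc s))    ≡⟨ cong (λ z → ι (+ z)) (trans (ℕ.^-*-assoc n a (suc s)) (trans (cong (n ℕ.^_) same) (sym (ℕ.^-*-assoc n A b)))) ⟩
   ι (+ ((n ℕ.^ A) ℕ.^ b))        ≡⟨ ι-^ (n ℕ.^ A) b ⟨
   ι (+ (n ℕ.^ A)) ^ℚ b           ∎)
   where
   open ≤-Reasoning
   b = suc b-1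
   same : a ℕ.* suc s ≡ A ℕ.* b
   same = ℕ.≤-antisym (ι-cancel {a ℕ.* suc s} {A ℕ.* b} (≤-reflexive eq′)) (ι-cancel {A ℕ.* b} {a ℕ.* suc s} (≤-reflexive (sym eq′)))
     where
     eq′ : ι (+ (a ℕ.* suc s)) ≡ ι (+ (A ℕ.* b))
     eq′ = trans (ι-*ℕ a (suc s)) (trans (cong (_* ι (+ suc s)) (↥≡p*↧ α)) (trans (*-assoc α (ι (+ b)) (ι (+ suc s)))
       (trans (cong (α *_) (*-comm (ι (+ b)) (ι (+ suc s)))) (trans (sym (*-assoc α (ι (+ suc s)) (ι (+ b))))
       (trans (cong (_* ι (+ b)) eq) (sym (ι-*ℕ A b)))))))
 cut-power α@(mkℚ -[1+ a ] b-1 _) A s eq n h = contradiction (ι-cancel-≤ {+ (A ℕ.* suc b-1)} { -[1+ a ] ℤ.* + suc s} (≤-reflexive eq′)) λ ()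
   where
   b = suc b-1
   eq′ : ι (+ (A ℕ.* b)) ≡ ι (-[1+ a ] ℤ.* + suc s)
   eq′ = trans (ι-*ℕ A b) (trans (cong (_* ι (+ b)) (sym eq)) (trans (*-assoc α (ι (+ suc s)) (ι (+ b)))
       (trans (cong (α *_) (*-comm (ι (+ suc s)) (ι (+ b)))) (trans (sym (*-assoc α (ι (+ b)) (ι (+ suc s))))
       (trans (cong (_* ι (+ suc s)) (sym (↥≡p*↧ α))) (sym (ι-* -[1+ a ] (+ suc s))))))))

 integer-root : ∀ s N → ∃ λ t → t ℕ.^ suc s ℕ.≤ N × N ℕ.< suc t ℕ.^ suc s
 integer-root s zero    = 0 , ℕ.z≤n , ℕ.m^n>0 1 (suc s)
 integer-root s (suc N) with integer-root s N
 ... | t , lo , hi with suc N ℕ.<? suc t ℕ.^ suc s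
 ... | yes p = t , ℕ.m≤n⇒m≤1+n lo , p
 ... | no ¬p = suc t , ℕ.≮⇒≥ ¬p , ℕ.≤-<-trans hi (ℕ.^-monoˡ-< (suc s) (ℕ.n<1+n (suc t)))

 suc≤2* : ∀ t → 1 ℕ.≤ t → suc t ℕ.≤ 2 ℕ.* t
 suc≤2* t 1≤t = ℕ.≤-trans (ℕ.+-monoˡ-≤ t 1≤t) (ℕ.≤-reflexive (cong (t ℕ.+_) (sym (ℕ.+-identityʳ t))))

 self-≤-^ : ∀ A s → 1 ℕ.≤ A → A ℕ.≤ A ℕ.^ suc s
 self-≤-^ A s 1≤A = ℕ.≤-trans (ℕ.≤-reflexive (sym (ℕ.^-identityʳ A))) (ℕ.^-monoʳ-≤ A {{ℕ.>-nonZero 1≤A}} {1} {suc s} (ℕ.s≤s ℕ.z≤n))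

 -- (4J + ℓ)/(4J) raised to the power J is at most 2 ^ ℓ, without division.
 compound : ∀ J ℓ → (4 ℕ.* J ℕ.+ ℓ) ℕ.^ J ℕ.≤ 2 ℕ.^ ℓ ℕ.* (4 ℕ.* J) ℕ.^ J
 compound J zero    = ℕ.≤-reflexive (trans (cong (ℕ._^ J) (ℕ.+-identityʳ (4 ℕ.* J))) (sym (ℕ.+-identityʳ _)))
 compound J (suc ℓ) = begin
   (4 ℕ.* J ℕ.+ suc ℓ) ℕ.^ J                ≡⟨ cong (ℕ._^ J) (ℕ.+-suc (4 ℕ.* J) ℓ) ⟩
   suc (4 ℕ.* J ℕ.+ ℓ) ℕ.^ J                ≡⟨ cong (λ z → suc z ℕ.^ J) (ℕ.+-assoc J (3 ℕ.* J) ℓ) ⟩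
   suc (J ℕ.+ (3 ℕ.* J ℕ.+ ℓ)) ℕ.^ J        ≤⟨ double J (3 ℕ.* J ℕ.+ ℓ) (ℕ.≤-trans (ℕ.m≤m+n J (2 ℕ.* J)) (ℕ.m≤m+n (3 ℕ.* J) ℓ)) ⟩
   2 ℕ.* (J ℕ.+ (3 ℕ.* J ℕ.+ ℓ)) ℕ.^ J      ≡⟨ cong (λ z → 2 ℕ.* z ℕ.^ J) (sym (ℕ.+-assoc J (3 ℕ.* J) ℓ)) ⟩
   2 ℕ.* (4 ℕ.* J ℕ.+ ℓ) ℕ.^ J              ≤⟨ ℕ.*-monoʳ-≤ 2 (compound J ℓ) ⟩
   2 ℕ.* (2 ℕ.^ ℓ ℕ.* (4 ℕ.* J) ℕ.^ J)      ≡⟨ ℕ.*-assoc 2 (2 ℕ.^ ℓ) _ ⟨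
   2 ℕ.^ suc ℓ ℕ.* (4 ℕ.* J) ℕ.^ J          ∎
   where
   open ℕ.≤-Reasoning
   -- Bernoulli's inequality (1 + 1/m)^i (1 - i/m) ≤ 1 for m = i + t
   bernoulli : ∀ m i t → m ≡ i ℕ.+ t → suc m ℕ.^ i ℕ.* t ℕ.≤ m ℕ.^ i ℕ.* m
   bernoulli m zero    t eq = ℕ.+-monoˡ-≤ 0 (ℕ.≤-reflexive (sym eq))
   bernoulli m (suc i) t eq = begin
     suc m ℕ.* suc m ℕ.^ i ℕ.* t        ≡⟨ rotate (suc m) (suc m ℕ.^ i) t ⟩
     suc m ℕ.^ i ℕ.* (suc m ℕ.* t)      ≤⟨ ℕ.*-monoʳ-≤ (suc m ℕ.^ i) (ℕ.≤-trans (ℕ.+-monoˡ-≤ (m ℕ.* t) t≤m) (ℕ.≤-reflexive (sym (ℕ.*-suc m t)))) ⟩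
     suc m ℕ.^ i ℕ.* (m ℕ.* suc t)      ≡⟨ rotate₂ (suc m ℕ.^ i) m (suc t) ⟩
     m ℕ.* (suc m ℕ.^ i ℕ.* suc t)      ≤⟨ ℕ.*-monoʳ-≤ m (bernoulli m i (suc t) (trans eq (sym (ℕ.+-suc i t)))) ⟩
     m ℕ.* (m ℕ.^ i ℕ.* m)              ≡⟨ ℕ.*-assoc m (m ℕ.^ i) m ⟨
     m ℕ.* m ℕ.^ i ℕ.* m                ∎
     where
     t≤m : t ℕ.≤ m
     t≤m = subst (t ℕ.≤_) (sym eq) (ℕ.m≤n+m t (suc i))
     rotate : ∀ p q t → p ℕ.* q ℕ.* t ≡ q ℕ.* (p ℕ.* t)
     rotate = solve-∀
     rotate₂ : ∀ p m t → p ℕ.* (m ℕ.* t) ≡ m ℕ.* (p ℕ.* t)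
     rotate₂ = solve-∀
   double : ∀ J t → J ℕ.≤ t → suc (J ℕ.+ t) ℕ.^ J ℕ.≤ 2 ℕ.* (J ℕ.+ t) ℕ.^ J
   double .0 zero       ℕ.z≤n = ℕ.s≤s ℕ.z≤n
   double J  t@(suc _)  J≤t   = ℕ.*-cancelʳ-≤ _ _ t (begin
     suc (J ℕ.+ t) ℕ.^ J ℕ.* t           ≤⟨ bernoulli (J ℕ.+ t) J t refl ⟩
     (J ℕ.+ t) ℕ.^ J ℕ.* (J ℕ.+ t)       ≤⟨ ℕ.*-monoʳ-≤ ((J ℕ.+ t) ℕ.^ J) (ℕ.+-monoˡ-≤ t J≤t) ⟩
     (J ℕ.+ t) ℕ.^ J ℕ.* (t ℕ.+ t)       ≡⟨ rotate ((J ℕ.+ t) ℕ.^ J) t ⟩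
     2 ℕ.* (J ℕ.+ t) ℕ.^ J ℕ.* t         ∎)
     where
     rotate : ∀ p t → p ℕ.* (t ℕ.+ t) ≡ 2 ℕ.* p ℕ.* t
     rotate = solve-∀

 -- This is `compound` for J = suc j, divided by (4J)^J. As `recip 3` is 1/4, it places ℓ / 4 below
 -- the logarithm of 2^ℓ, through the powers that define the cut `log`.
 compound-ι : ∀ j ℓ {y} → 0ℚ ≤ y → y ≤ ι (+ ℓ) * recip 3 → (1ℚ + y * recip j) ^ℚ suc j ≤ ι (+ (2 ℕ.^ ℓ))
 compound-ι j ℓ {y} 0≤y y≤ = *-cancelʳ-≤-pos D {{D>0}} (begin
   β ^ℚ J * D                                    ≡⟨ cong (_*_ (β ^ℚ J)) (ι-^ (4 ℕ.* J) J) ⟨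
   β ^ℚ J * ι (+ (4 ℕ.* J)) ^ℚ J                 ≡⟨ ^-distrib-* β (ι (+ (4 ℕ.* J))) J ⟨
   (β * ι (+ (4 ℕ.* J))) ^ℚ J                    ≤⟨ ^-mono-≤ J 0≤βJ base ⟩
   ι (+ (4 ℕ.* J ℕ.+ ℓ)) ^ℚ J                    ≡⟨ ι-^ (4 ℕ.* J ℕ.+ ℓ) J ⟩
   ι (+ ((4 ℕ.* J ℕ.+ ℓ) ℕ.^ J))                 ≤⟨ ι-mono (compound J ℓ) ⟩
   ι (+ (2 ℕ.^ ℓ ℕ.* (4 ℕ.* J) ℕ.^ J))           ≡⟨ ι-*ℕ (2 ℕ.^ ℓ) ((4 ℕ.* J) ℕ.^ J) ⟩
   ι (+ (2 ℕ.^ ℓ)) * D                           ∎)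
   where
   open ≤-Reasoning
   J = suc j
   β = 1ℚ + y * recip j
   D = ι (+ ((4 ℕ.* J) ℕ.^ J))
   D>0 : Positive D
   D>0 = positive (<-≤-trans (positive⁻¹ 1ℚ) (ι-mono {1} (ℕ.m^n>0 (4 ℕ.* J) J)))
   4J : ι (+ (4 ℕ.* J)) ≡ ι (+ 4) * ι (+ J)
   4J = ι-*ℕ 4 J
   expand : β * ι (+ (4 ℕ.* J)) ≡ ι (+ (4 ℕ.* J)) + ι (+ 4) * y
   expand = trans (cong (β *_) 4J) (trans (distribute (y) (recip j) (ι (+ 4)) (ι (+ J)))
     (cong₂ _+_ (sym 4J) (trans (cong (λ z → ι (+ 4) * y * z) (recip-inverse j)) (*-identityʳ (ι (+ 4) * y)))))
     where
     open import Data.Rational.Solver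
     open +-*-Solver
     distribute : ∀ y r f J → (1ℚ + y * r) * (f * J) ≡ f * J + f * y * (r * J)
     distribute = solve 4 (λ y r f J → (con 1ℚ :+ y :* r) :* (f :* J) := f :* J :+ f :* y :* (r :* J)) refl
   base : β * ι (+ (4 ℕ.* J)) ≤ ι (+ (4 ℕ.* J ℕ.+ ℓ))
   base = begin
     β * ι (+ (4 ℕ.* J))                         ≡⟨ expand ⟩
     ι (+ (4 ℕ.* J)) + ι (+ 4) * y               ≤⟨ +-monoʳ-≤ (ι (+ (4 ℕ.* J))) (*-monoˡ-≤-nonNeg (ι (+ 4)) y≤) ⟩
     ι (+ (4 ℕ.* J)) + ι (+ 4) * (ι (+ ℓ) * recip 3) ≡⟨ cong (_+_ (ι (+ (4 ℕ.* J)))) (trans (*-comm (ι (+ 4)) (ι (+ ℓ) * recip 3))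
         (trans (*-assoc (ι (+ ℓ)) (recip 3) (ι (+ 4))) (trans (cong (ι (+ ℓ) *_) (recip-inverse 3)) (*-identityʳ (ι (+ ℓ)))))) ⟩
     ι (+ (4 ℕ.* J)) + ι (+ ℓ)                   ≡⟨ trans (cong ι (ℤ.pos-+ (4 ℕ.* J) ℓ)) (ι-+ (+ (4 ℕ.* J)) (+ ℓ)) ⟨
     ι (+ (4 ℕ.* J ℕ.+ ℓ))                       ∎
   0≤βJ : 0ℚ ≤ β * ι (+ (4 ℕ.* J))
   0≤βJ = subst (0ℚ ≤_) (sym expand) (+-mono-≤ (0≤ι (4 ℕ.* J)) (subst (_≤ ι (+ 4) * y) (*-zeroʳ (ι (+ 4))) (*-monoˡ-≤-nonNeg (ι (+ 4)) 0≤y)))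

 -- (t / 4)^(d + 1) ≤ t^(d + 1) / 4 ≤ ℓ / 4 ≤ log n. A lower bound for the logarithm is the useful
 -- direction, since the target divides by its root.
 root-log : ∀ d n ℓ t → 2 ℕ.^ ℓ ℕ.≤ n → t ℕ.^ suc d ℕ.≤ ℓ → root (suc d) (log n) (ι (+ t) * recip 3)
 root-log d n ℓ t 2^ℓ≤n t≤ℓ = 0≤p , ^-nonNeg (suc d) 0≤p , λ j → ≤-trans (compound-ι j ℓ (^-nonNeg (suc d) 0≤p) small) (ι-mono 2^ℓ≤n)
   where
   0≤r : 0ℚ ≤ recip 3
   0≤r = <⇒≤ (positive⁻¹ (recip 3))
   0≤p : 0ℚ ≤ ι (+ t) * recip 3
   0≤p = subst (_≤ ι (+ t) * recip 3) (*-zeroˡ (recip 3)) (*-monoʳ-≤-nonNeg (recip 3) (0≤ι t))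
   r^≤ : ∀ d → recip 3 ^ℚ suc d ≤ recip 3
   r^≤ zero    = ≤-reflexive (*-identityʳ (recip 3))
   r^≤ (suc d) = ≤-trans (*-monoˡ-≤-nonNeg (recip 3) (≤-trans (r^≤ d) r≤1)) (≤-reflexive (*-identityʳ (recip 3)))
     where
     r≤1 : recip 3 ≤ 1ℚ
     r≤1 = *≤* (ℤ.+≤+ (ℕ.s≤s ℕ.z≤n))
   small : (ι (+ t) * recip 3) ^ℚ suc d ≤ ι (+ ℓ) * recip 3
   small = begin
     (ι (+ t) * recip 3) ^ℚ suc d                ≡⟨ ^-distrib-* (ι (+ t)) (recip 3) (suc d) ⟩
     ι (+ t) ^ℚ suc d * recip 3 ^ℚ suc d         ≡⟨ cong (_* recip 3 ^ℚ suc d) (ι-^ t (suc d)) ⟩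
     ι (+ (t ℕ.^ suc d)) * recip 3 ^ℚ suc d      ≤⟨ *-mono-≤ (0≤ι (t ℕ.^ suc d)) 0≤r (ι-mono t≤ℓ) (r^≤ d) ⟩
     ι (+ ℓ) * recip 3                           ∎
     where open ≤-Reasoning

-- Sizes of admissible sets in the three regimes.

module SizeBounds where

 open import Defs
 open Rationals
 open Encoding using (dyadic)
 open Counting using (^-distribʳ-*; scales)
 open AdmissibleSets
 open Powers
 open import Data.Nat.Base as ℕ using (ℕ; zero; suc; _+_; _*_; _^_; _∸_; _≤_; _<_; z≤n; s≤s)
 import Data.Nat.Properties as ℕ
 open import Data.Nat.Tactic.RingSolver using (solve-∀)
 open import Data.Integer.Base as ℤ using (ℤ) renaming (+_ to pos)
 open import Data.Rational.Base as ℚ using (ℚ; 0ℚ; 1ℚ)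
 import Data.Rational.Properties as ℚ
 open import Data.Product.Base using (∃; _×_; _,_; proj₁; proj₂)
 open import Relation.Binary.PropositionalEquality hiding (J)
 open import Relation.Nullary using (contradiction)

 record BoundedBySize (n d k r : ℕ) (g : Cut) (Z : ℕ) : Set where
   constructor bounded-by
   field
     size       : ℕ
     admissible : AdmissibleSize n d k r size
     bound      : ∀ q → g q → q ℚ.≤ ι (pos (Z * size))

 bounded⇒Ω : ∀ d k r (g : ℕ → Cut) Z N → (∀ n → N ≤ n → BoundedBySize n d k r (g n) (suc Z)) →
             (λ n m → f-aff[ n , d , k , r ]≡ m) =Ω g
 bounded⇒Ω d k r g Z N h = recip Z , recip-pos Z , N , λ n m N≤n (_ , greatest) q gq →
   let open BoundedBySize (h n N≤n) in ℚ.≤-trans (scaled size (bound q gq)) (ι-mono (greatest size admissible))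
   where
   scaled : ∀ m {q} → q ℚ.≤ ι (pos (suc Z * m)) → recip Z ℚ.* q ℚ.≤ ι (pos m)
   scaled m {q} q≤ = begin
     recip Z ℚ.* q                                   ≤⟨ ℚ.*-monoˡ-≤-nonNeg (recip Z) {{ℚ.pos⇒nonNeg (recip Z) {{recip-pos Z}}}} q≤ ⟩
     recip Z ℚ.* ι (pos (suc Z * m))               ≡⟨ cong (recip Z ℚ.*_) (ι-*ℕ (suc Z) m) ⟩
     recip Z ℚ.* (ι (pos (suc Z)) ℚ.* ι (pos m))     ≡⟨ ℚ.*-assoc (recip Z) (ι (pos (suc Z))) (ι (pos m)) ⟨
     recip Z ℚ.* ι (pos (suc Z)) ℚ.* ι (pos m)       ≡⟨ cong (ℚ._* ι (pos m)) (recip-inverse Z) ⟩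
     1ℚ ℚ.* ι (pos m)                                ≡⟨ ℚ.*-identityˡ (ι (pos m)) ⟩
     ι (pos m)                                       ∎
     where open ℚ.≤-Reasoning

 1≤scaleConstant : ∀ d s m n → 1 ≤ n → 1 ≤ scaleConstant d s m * n
 1≤scaleConstant d s m n 1≤n = ℕ.*-mono-≤ {1} {scaleConstant d s m} (s≤s z≤n) 1≤n

 -- As used below with b′ = a′ + e, `suc a′` is the smaller and `suc b′` the larger of d and s = r -
 -- 1: `WideSize` has d as the smaller one, `TallSize` has s. The power of `q` is s in both.
 WideSize TallSize : (a′ b′ e m : ℕ) → Set
 WideSize a′ b′ e m = ∃ λ A → ∀ n ℓ q → 1 ≤ n → n < 2 ^ suc ℓ → 1 ≤ q →
   suc A * (scales e ℓ * n ^ (suc b′ * suc m)) ≤ q ^ suc b′ →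
   ∃ λ M → AdmissibleSize n (suc a′) (suc m) (suc (suc b′)) M × n ^ suc a′ ≤ 2 * q * M
 TallSize a′ b′ e m = ∃ λ A → ∀ n ℓ q → 1 ≤ n → n < 2 ^ suc ℓ → 1 ≤ q →
   suc A * (scales e ℓ * n ^ (suc b′ * suc m)) ≤ q ^ suc a′ →
   ∃ λ M → AdmissibleSize n (suc b′) (suc m) (suc (suc a′)) M × n ^ suc b′ ≤ 2 * q * M

 wide-size : ∀ a′ e m → WideSize a′ (a′ + e) e m
 wide-size a′ e m = sizeConstant κ a′ e m , λ n ℓ q 1≤n n<2^ 1≤q big →
   let 1≤X = 1≤scaleConstant d s m n 1≤n
       L , lo , hi = dyadic (κ * n) 1≤X in
   large-admissible n d s (suc m) _ _ q (covers-columns {d} {s} {m} {n} {L} hi) 1≤q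
     (ℕ.≤-trans (few-codes κ a′ e m n L ℓ 1≤X lo n<2^) (ℕ.≤-trans (ℕ.m≤n+m _ _) big))
   where
   d = suc a′
   s = suc (a′ + e)
   κ = scaleConstant d s m

 tall-size : ∀ a′ e m → TallSize a′ (a′ + e) e m
 tall-size a′ e m = sizeConstant κ a′ e m , λ n ℓ q 1≤n n<2^ 1≤q big →
   let 1≤X = 1≤scaleConstant d s m n 1≤n
       L , lo , hi = dyadic (κ * n) 1≤X in
   large-admissible n d s (suc m) _ _ q (covers-rows {d} {s} {m} {n} {L} hi) 1≤q
     (ℕ.≤-trans (few-codes κ a′ e m n L ℓ 1≤X lo n<2^) (ℕ.≤-trans (ℕ.m≤n+m _ _) big))
   where
   s = suc a′
   d = suc (a′ + e)
   κ = scaleConstant d s m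

 ^≥1 : ∀ n k → 1 ≤ n → 1 ≤ n ^ k
 ^≥1 n k 1≤n = ℕ.m^n>0 n {{ℕ.>-nonZero 1≤n}} k

 dense-enough : ∀ B s N Q → 1 ≤ B → N ≤ Q ^ suc s → B * N ≤ (B * Q) ^ suc s
 dense-enough B s N Q 1≤B N≤ = ℕ.≤-trans (ℕ.*-mono-≤ (self-≤-^ B s 1≤B) N≤) (ℕ.≤-reflexive (sym (^-distribʳ-* B Q (suc s))))

 -- The lower cut of the root of `N` of order `suc s`, in the form that `cut-power` delivers.
 PowerCut : ℕ → ℕ → Cut
 PowerCut s N x = 0ℚ ℚ.≤ x × x ^ℚ suc s ℚ.≤ ι (pos N)

 -- The case r ≤ d, where d = 1 + b′, k = 1 + m and r = 2 + a′.
 tall-bounded : ∀ a′ b′ m → a′ < b′ → suc m ≤ suc a′ → ∃ λ Z → ∀ n → 1 ≤ n →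
   BoundedBySize n (suc b′) (suc m) (suc (suc a′))
     (PowerCut a′ (n ^ (suc b′ * (suc a′ ∸ suc m)))) (suc Z)
 tall-bounded a′ b′ m a′<b′ k≤s = ℕ.pred (4 * B) , bound
   where
   s = suc a′
   d = suc b′
   k = suc m
   sized : TallSize a′ b′ (suc (b′ ∸ suc a′)) m
   sized = subst (λ b → TallSize a′ b (suc (b′ ∸ suc a′)) m)
     (trans (ℕ.+-suc a′ (b′ ∸ suc a′)) (ℕ.m+[n∸m]≡n a′<b′)) (tall-size a′ (suc (b′ ∸ suc a′)) m)
   -- The factor 2 is the value of `scales` for positive `e`.
   B = suc (proj₁ sized) * 2
   Goal : ℕ → Set
   Goal n = BoundedBySize n d k (suc s) (PowerCut a′ (n ^ (d * (s ∸ k)))) (4 * B)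
   scaled : ∀ n → 1 ≤ n → (∃ λ ℓ → 2 ^ ℓ ≤ n × n < 2 ^ suc ℓ) →
            (∃ λ t → t ^ s ≤ n ^ (d * k) × n ^ (d * k) < suc t ^ s) → Goal n
   scaled n 1≤n (ℓ , _ , n<2^) (t , t≤ , <t) = bounded-by M (proj₁ (proj₂ size)) λ x (0≤x , x≤) →
       ^-cancel-≤ a′ (0≤ι (4 * B * M)) (ℚ.≤-trans x≤ (ℚ.≤-trans (ι-mono main) (ℚ.≤-reflexive (sym (ι-^ (4 * B * M) s)))))
     where
     N = n ^ (d * k)
     -- `suc t` is just above the s-th root of `N`, so `q = B * suc t` is large enough. As
     -- `suc t ≤ 2 * t`, going back to `N` loses only a factor 2, which with the 2 from deletion
     -- makes the 4 in `4 * B`.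
     size = proj₂ sized n ℓ (B * suc t) 1≤n n<2^ (s≤s z≤n)
       (subst (_≤ (B * suc t) ^ s) (ℕ.*-assoc (suc (proj₁ sized)) 2 N) (dense-enough B a′ N (suc t) (s≤s z≤n) (ℕ.<⇒≤ <t)))
     M = proj₁ size
     1≤t : 1 ≤ t
     1≤t = positive t <t
       where
       positive : ∀ t → N < suc t ^ s → 1 ≤ t
       positive zero    N< = contradiction (subst (N <_) (ℕ.^-zeroˡ s) N<) (ℕ.≤⇒≯ (^≥1 n (d * k) 1≤n))
       positive (suc t) _  = s≤s z≤n
     main : n ^ (d * (s ∸ k)) ≤ (4 * B * M) ^ s
     main = ℕ.*-cancelʳ-≤ _ _ N {{ℕ.>-nonZero (^≥1 n (d * k) 1≤n)}} (begin
       n ^ (d * (s ∸ k)) * N                        ≡⟨ ℕ.^-distribˡ-+-* n (d * (s ∸ k)) (d * k) ⟨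
       n ^ (d * (s ∸ k) + d * k)                    ≡⟨ cong (n ^_) (trans (sym (ℕ.*-distribˡ-+ d (s ∸ k) k)) (cong (d *_) (ℕ.m∸n+n≡m k≤s))) ⟩
       n ^ (d * s)                                    ≡⟨ ℕ.^-*-assoc n d s ⟨
       (n ^ d) ^ s                                    ≤⟨ ℕ.^-monoˡ-≤ s (proj₂ (proj₂ size)) ⟩
       (2 * (B * suc t) * M) ^ s                  ≤⟨ ℕ.^-monoˡ-≤ s (ℕ.*-monoˡ-≤ M (ℕ.*-monoʳ-≤ 2 (ℕ.*-monoʳ-≤ B (suc≤2* t 1≤t)))) ⟩
       (2 * (B * (2 * t)) * M) ^ s              ≡⟨ cong (ℕ._^ s) (regroup B t M) ⟩
       (4 * B * M * t) ^ s                        ≡⟨ ^-distribʳ-* (4 * B * M) t s ⟩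
       (4 * B * M) ^ s * t ^ s                  ≤⟨ ℕ.*-monoʳ-≤ ((4 * B * M) ^ s) t≤ ⟩
       (4 * B * M) ^ s * N                        ∎)
       where
       open ℕ.≤-Reasoning
       regroup : ∀ b t m → 2 * (b * (2 * t)) * m ≡ 4 * b * m * t
       regroup = solve-∀

   bound : ∀ n → 1 ≤ n → Goal n
   bound n 1≤n = scaled n 1≤n (dyadic n 1≤n) (integer-root a′ (n ^ (d * k)))

 cancel-power : ∀ n a′ m Q M → 1 ≤ n → suc m ≤ suc a′ → n ^ suc a′ ≤ 2 * (Q * n ^ suc m) * M →
                n ^ (suc a′ ∸ suc m) ≤ 2 * Q * M
 cancel-power n a′ m Q M 1≤n k≤d h = ℕ.*-cancelʳ-≤ _ _ (n ^ suc m) {{ℕ.>-nonZero (^≥1 n (suc m) 1≤n)}} (begin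
   n ^ (suc a′ ∸ suc m) * n ^ suc m    ≡⟨ ℕ.^-distribˡ-+-* n (suc a′ ∸ suc m) (suc m) ⟨
   n ^ (suc a′ ∸ suc m + suc m)            ≡⟨ cong (n ^_) (ℕ.m∸n+n≡m k≤d) ⟩
   n ^ suc a′                              ≤⟨ h ⟩
   2 * (Q * n ^ suc m) * M           ≡⟨ regroup Q (n ^ suc m) M ⟩
   2 * Q * M * n ^ suc m             ∎)
   where
   open ℕ.≤-Reasoning
   regroup : ∀ q p m → 2 * (q * p) * m ≡ 2 * q * m * p
   regroup = solve-∀

 -- The case r ≥ d + 2, where d = 1 + a′, k = 1 + m and r = 2 + b′.
 wide-bounded : ∀ a′ b′ m → a′ < b′ → suc m ≤ suc a′ → ∃ λ Z → ∀ n → 1 ≤ n →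
   BoundedBySize n (suc a′) (suc m) (suc (suc b′)) ⟦ n ^ (suc a′ ∸ suc m) ⟧ (suc Z)
 wide-bounded a′ b′ m a′<b′ k≤d = ℕ.pred (2 * B) , bound
   where
   sized : WideSize a′ b′ (suc (b′ ∸ suc a′)) m
   sized = subst (λ b → WideSize a′ b (suc (b′ ∸ suc a′)) m)
     (trans (ℕ.+-suc a′ (b′ ∸ suc a′)) (ℕ.m+[n∸m]≡n a′<b′)) (wide-size a′ (suc (b′ ∸ suc a′)) m)
   B = suc (proj₁ sized) * 2
   Goal : ℕ → Set
   Goal n = BoundedBySize n (suc a′) (suc m) (suc (suc b′)) ⟦ n ^ (suc a′ ∸ suc m) ⟧ (2 * B)
   scaled : ∀ n → 1 ≤ n → (∃ λ ℓ → 2 ^ ℓ ≤ n × n < 2 ^ suc ℓ) → Goal n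
   scaled n 1≤n (ℓ , _ , n<2^) = bounded-by M (proj₁ (proj₂ size)) λ x (_ , x≤) → ℚ.≤-trans x≤ (ι-mono (cancel-power n a′ m B M 1≤n k≤d (proj₂ (proj₂ size))))
     where
     N = n ^ (suc b′ * suc m)
     Q = n ^ suc m
     N≤ : N ≤ Q ^ suc b′
     N≤ = ℕ.≤-reflexive (trans (cong (n ^_) (ℕ.*-comm (suc b′) (suc m))) (sym (ℕ.^-*-assoc n (suc m) (suc b′))))
     -- `N` is exactly the power `Q ^ suc b′`, so no root has to be rounded and `q` is a constant
     -- times n^k.
     size = proj₂ sized n ℓ (B * Q) 1≤n n<2^ (ℕ.*-mono-≤ {1} {B} (s≤s z≤n) (^≥1 n (suc m) 1≤n))
       (subst (_≤ (B * Q) ^ suc b′) (ℕ.*-assoc (suc (proj₁ sized)) 2 N) (dense-enough B b′ N Q (s≤s z≤n) N≤))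
     M = proj₁ size

   bound : ∀ n → 1 ≤ n → Goal n
   bound n 1≤n = scaled n 1≤n (dyadic n 1≤n)

 -- The case r = d + 1, where d = 1 + a′ and k = 1 + m.
 square-bounded : ∀ a′ m → suc m ≤ suc a′ → ∃ λ Z → ∀ n → 2 ≤ n →
   BoundedBySize n (suc a′) (suc m) (suc (suc a′)) ((n ^ (suc a′ ∸ suc m)) ÷ᶜ root (suc a′) (log n)) (suc Z)
 -- 16 = 2 * 2 * 4, from deletion, from the passage from `suc t` to `2 * t`, and from the quarter in
 -- `root-log`. The bound `2 ≤ n` makes ℓ, the integer part of log₂ n, positive, and with it the
 -- integer root `t` of ℓ.
 square-bounded a′ m k≤d = ℕ.pred (16 * suc A) , λ n 2≤n → bound n 2≤n (dyadic n (ℕ.<⇒≤ 2≤n))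
   where
   d = suc a′
   sized : WideSize a′ a′ 0 m
   sized = subst (λ b → WideSize a′ b 0 m) (ℕ.+-identityʳ a′) (wide-size a′ 0 m)
   A = proj₁ sized
   Goal : ℕ → Set
   Goal n = BoundedBySize n d (suc m) (suc d) ((n ^ (d ∸ suc m)) ÷ᶜ root d (log n)) (16 * suc A)
   scaled : ∀ n → 2 ≤ n → ∀ ℓ t′ → 2 ^ ℓ ≤ n → n < 2 ^ suc ℓ → suc t′ ^ d ≤ ℓ → ℓ < suc (suc t′) ^ d → Goal n
   scaled n 2≤n ℓ t′ 2^≤n n<2^ t≤ <t = bounded-by M (proj₁ (proj₂ size)) λ x (_ , h) →
       ℚ.*-cancelʳ-≤-pos (ι (pos t)) {{ι-pos t′}} (begin
         x ℚ.* ι (pos t)                                            ≡⟨ quarter x ⟩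
         x ℚ.* (ι (pos t) ℚ.* recip 3) ℚ.* ι (pos 4)                ≤⟨ ℚ.*-monoʳ-≤-nonNeg (ι (pos 4)) (h _ (root-log a′ n ℓ t 2^≤n t≤)) ⟩
         ι (pos (n ^ (d ∸ suc m))) ℚ.* ι (pos 4)                  ≤⟨ ℚ.*-monoʳ-≤-nonNeg (ι (pos 4)) (ι-mono (cancel-power n a′ m (suc A * (2 * t)) M 1≤n k≤d large)) ⟩
         ι (pos (2 * (suc A * (2 * t)) * M)) ℚ.* ι (pos 4)  ≡⟨ ι-*ℕ (2 * (suc A * (2 * t)) * M) 4 ⟨
         ι (pos (2 * (suc A * (2 * t)) * M * 4))          ≡⟨ cong (λ z → ι (pos z)) (regroup (suc A) t M) ⟩
         ι (pos (16 * suc A * M * t))                         ≡⟨ ι-*ℕ (16 * suc A * M) t ⟩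
         ι (pos (16 * suc A * M)) ℚ.* ι (pos t)                 ∎)
     where
     open ℚ.≤-Reasoning
     t = suc t′
     1≤n = ℕ.<⇒≤ 2≤n
     -- (2t)^d is at least the number `suc ℓ` of scales, so the factor `2 * t` in `q` pays for the
     -- logarithm.
     Q = 2 * t * n ^ suc m
     N = suc ℓ * n ^ (d * suc m)
     N≤ : N ≤ Q ^ d
     N≤ = ℕ.≤-trans (ℕ.*-mono-≤ (ℕ.≤-trans <t (ℕ.^-monoˡ-≤ d (suc≤2* t (s≤s z≤n))))
            (ℕ.≤-reflexive (trans (cong (n ^_) (ℕ.*-comm d (suc m))) (sym (ℕ.^-*-assoc n (suc m) d)))))
            (ℕ.≤-reflexive (sym (^-distribʳ-* (2 * t) (n ^ suc m) d)))
     size = proj₂ sized n ℓ (suc A * Q) 1≤n n<2^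
       (ℕ.*-mono-≤ {1} {suc A} (s≤s z≤n) (ℕ.*-mono-≤ {1} {2 * t} (s≤s z≤n) (^≥1 n (suc m) 1≤n)))
       (dense-enough (suc A) a′ N Q (s≤s z≤n) N≤)
     M = proj₁ size
     large : n ^ d ≤ 2 * (suc A * (2 * t) * n ^ suc m) * M
     large = ℕ.≤-trans (proj₂ (proj₂ size)) (ℕ.≤-reflexive (cong (λ z → 2 * z * M) (sym (ℕ.*-assoc (suc A) (2 * t) (n ^ suc m)))))
     regroup : ∀ a t m → 2 * (a * (2 * t)) * m * 4 ≡ 16 * a * m * t
     regroup = solve-∀
     quarter : ∀ x → x ℚ.* ι (pos t) ≡ x ℚ.* (ι (pos t) ℚ.* recip 3) ℚ.* ι (pos 4)
     quarter x = sym (trans (ℚ.*-assoc x (ι (pos t) ℚ.* recip 3) (ι (pos 4)))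
       (cong (x ℚ.*_) (trans (ℚ.*-assoc (ι (pos t)) (recip 3) (ι (pos 4))) (trans (cong (ι (pos t) ℚ.*_) (recip-inverse 3)) (ℚ.*-identityʳ (ι (pos t)))))))
   rooted : ∀ n → 2 ≤ n → ∀ ℓ → 1 ≤ ℓ → 2 ^ ℓ ≤ n → n < 2 ^ suc ℓ → (∃ λ t → t ^ d ≤ ℓ × ℓ < suc t ^ d) → Goal n
   rooted n 2≤n ℓ 1≤ℓ 2^≤n n<2^ (zero , _ , ℓ<1)   = contradiction (subst (ℓ <_) (ℕ.^-zeroˡ d) ℓ<1) (ℕ.≤⇒≯ 1≤ℓ)
   rooted n 2≤n ℓ 1≤ℓ 2^≤n n<2^ (suc t′ , t≤ , <t) = scaled n 2≤n ℓ t′ 2^≤n n<2^ t≤ <t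
   bound : ∀ n → 2 ≤ n → (∃ λ ℓ → 2 ^ ℓ ≤ n × n < 2 ^ suc ℓ) → Goal n
   bound n 2≤n (zero , _ , n<2)             = contradiction 2≤n (ℕ.<⇒≱ n<2)
   bound n 2≤n (ℓ@(suc _) , 2^≤n , n<2^)    = rooted n 2≤n ℓ (s≤s z≤n) 2^≤n n<2^ (integer-root a′ ℓ)

-- Matching the size bounds with the growth functions of the statement.

module Conclusion where

 open import Defs
 open Rationals
 open AdmissibleSets
 open Powers
 open SizeBounds
 open import Data.Bool.Base using (true; false; T; if_then_else_)
 open import Data.Nat.Base as ℕ using (ℕ; suc; _+_; _∸_; _≤_; _<_; _≤ᵇ_; _≡ᵇ_; s≤s)
 import Data.Nat.Properties as ℕ
 open import Data.Integer.Base as ℤ using (ℤ) renaming (+_ to pos)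
 import Data.Integer.Properties as ℤ
 open import Data.Rational.Base as ℚ using (ℚ; 0ℚ; 1ℚ)
 import Data.Rational.Properties as ℚ
 open import Data.Product.Base using (_,_)
 open import Data.Unit.Base using (tt)
 open import Relation.Binary.Definitions using (tri<; tri≈; tri>)
 open import Relation.Binary.PropositionalEquality hiding (J)
 open import Relation.Nullary using (¬_; yes; no; contradiction)

 if-true : ∀ {a} {A : Set a} {b} {x y : A} → T b → (if b then x else y) ≡ x
 if-true {b = true} _ = refl

 if-false : ∀ {a} {A : Set a} {b} {x y : A} → ¬ T b → (if b then x else y) ≡ y
 if-false {b = true}  ¬t = contradiction tt ¬t
 if-false {b = false} _  = refl

 bounded-weaken : ∀ {n d k r Z} {g g′ : Cut} → (∀ q → g q → g′ q) → BoundedBySize n d k r g′ Z → BoundedBySize n d k r g Z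
 bounded-weaken g⇒g′ (bounded-by m admissible bound) = bounded-by m admissible λ q gq → bound q (g⇒g′ q gq)

 exponent : ∀ d k s → k ≤ suc s → (fromℕ d ℚ.* (1ℚ ℚ.- k ÷ suc s)) ℚ.* ι (pos (suc s)) ≡ ι (pos (d ℕ.* (suc s ∸ k)))
 exponent d k s k≤s = begin
   ι (pos d) ℚ.* (1ℚ ℚ.- κ) ℚ.* σ              ≡⟨ ℚ.*-assoc (ι (pos d)) (1ℚ ℚ.- κ) σ ⟩
   ι (pos d) ℚ.* ((1ℚ ℚ.- κ) ℚ.* σ)            ≡⟨ cong (ι (pos d) ℚ.*_) (begin
     (1ℚ ℚ.- κ) ℚ.* σ                            ≡⟨ ℚ.*-distribʳ-+ σ 1ℚ (ℚ.- κ) ⟩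
     1ℚ ℚ.* σ ℚ.+ ℚ.- κ ℚ.* σ                    ≡⟨ cong₂ ℚ._+_ (ℚ.*-identityˡ σ) (trans (sym (ℚ.neg-distribˡ-* κ σ)) (cong ℚ.-_ (/-inverse k s))) ⟩
     σ ℚ.- ι (pos k)                             ≡⟨ cong (ℚ._- ι (pos k)) (trans (cong (λ z → ι (pos z)) (sym (ℕ.m∸n+n≡m k≤s)))
                                                      (trans (cong ι (ℤ.pos-+ δ k)) (ι-+ (pos δ) (pos k)))) ⟩
     ι (pos δ) ℚ.+ ι (pos k) ℚ.- ι (pos k)       ≡⟨ ℚ.+-assoc (ι (pos δ)) (ι (pos k)) (ℚ.- ι (pos k)) ⟩
     ι (pos δ) ℚ.+ (ι (pos k) ℚ.- ι (pos k))     ≡⟨ cong (ι (pos δ) ℚ.+_) (ℚ.+-inverseʳ (ι (pos k))) ⟩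
     ι (pos δ) ℚ.+ 0ℚ                            ≡⟨ ℚ.+-identityʳ (ι (pos δ)) ⟩
     ι (pos δ)                                   ∎) ⟩
   ι (pos d) ℚ.* ι (pos δ)                     ≡⟨ ι-*ℕ d δ ⟨
   ι (pos (d ℕ.* δ))                           ∎
   where
   open ≡-Reasoning
   κ = k ÷ suc s
   σ = ι (pos (suc s))
   δ = suc s ∸ k

 -- Here d = 1 + a′, k = 1 + m and r = 2 + b′.
 module _ (a′ b′ m : ℕ) (k≤s : suc m ≤ suc b′) (k≤d : suc m ≤ suc a′) where
   private
     d = suc a′
     k = suc m
     r = suc (suc b′)

   tall-cut : b′ < a′ → ∀ n q → f⟨_,_,_⟩ d k r n q → PowerCut b′ (n ℕ.^ (d ℕ.* (suc b′ ∸ k))) q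
   tall-cut b′<a′ n q h = cut-power (fromℕ d ℚ.* (1ℚ ℚ.- k ÷ suc b′)) (d ℕ.* (suc b′ ∸ k)) b′ (exponent d k b′ k≤s) n
     (subst (λ (c : Cut) → c q) (if-true {b = r ≤ᵇ d} (ℕ.≤⇒≤ᵇ {r} {d} (s≤s b′<a′))) h)

   square-cut : b′ ≡ a′ → ∀ n q → f⟨_,_,_⟩ d k r n q → ((n ℕ.^ (d ∸ k)) ÷ᶜ root d (log n)) q
   square-cut refl n q h = subst (λ (c : Cut) → c q)
     (trans (if-false {b = r ≤ᵇ d} (λ t → ℕ.1+n≰n (ℕ.≤ᵇ⇒≤ r d t))) (if-true {b = r ≡ᵇ suc d} (ℕ.≡⇒≡ᵇ r (suc d) refl))) h

   wide-cut : a′ < b′ → ∀ n q → f⟨_,_,_⟩ d k r n q → ⟦ n ℕ.^ (d ∸ k) ⟧ q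
   wide-cut a′<b′ n q h = subst (λ (c : Cut) → c q)
     (trans (if-false {b = r ≤ᵇ d} (λ t → ℕ.<⇒≱ (s≤s (ℕ.m≤n⇒m≤1+n a′<b′)) (ℕ.≤ᵇ⇒≤ r d t)))
       (if-false {b = r ≡ᵇ suc d} (λ t → ℕ.<⇒≢ (s≤s (s≤s a′<b′)) (sym (ℕ.≡ᵇ⇒≡ r (suc d) t))))) h

   general : (λ n M → f-aff[ n , d , k , r ]≡ M) =Ω f⟨_,_,_⟩ d k r
   general with ℕ.<-cmp b′ a′
   ... | tri< b′<a′ _ _ =
         let Z , h = tall-bounded b′ a′ m b′<a′ k≤s in
         bounded⇒Ω d k r (f⟨_,_,_⟩ d k r) Z 1 λ n 1≤n → bounded-weaken (tall-cut b′<a′ n) (h n 1≤n)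
   ... | tri≈ _ b′≡a′ _ =
         let Z , h = square-bounded a′ m k≤d in
         bounded⇒Ω d k r (f⟨_,_,_⟩ d k r) Z 2 λ n 2≤n → bounded-weaken (square-cut b′≡a′ n)
           (subst (λ b → BoundedBySize n d k (suc (suc b)) ((n ℕ.^ (d ∸ k)) ÷ᶜ root d (log n)) (suc Z)) (sym b′≡a′) (h n 2≤n))
   ... | tri> _ _ a′<b′ =
         let Z , h = wide-bounded a′ b′ m a′<b′ k≤d in
         bounded⇒Ω d k r (f⟨_,_,_⟩ d k r) Z 1 λ n 1≤n → bounded-weaken (wide-cut a′<b′ n) (h n 1≤n)

 -- Here s = k + 1 and s - k = 1, so the general exponent d (s - k) / s becomes d / (k + 1). Since k
 -- < d, r = k + 2 is at most d + 1, with equality exactly when k = d - 1: only two of the three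
 -- regimes occur.
 special : ∀ a′ m → suc m ≤ a′ → (λ n M → f-aff[ n , suc a′ , suc m , suc (suc (suc m)) ]≡ M) =Ω f⟨_,_⟩ (suc a′) (suc m)
 special a′ m k≤a′ with suc m ℕ.≟ a′
 ... | yes refl =
       let Z , h = square-bounded (suc m) m (ℕ.n≤1+n (suc m)) in
       bounded⇒Ω d k r (f⟨_,_⟩ d k) Z 2 λ n 2≤n → bounded-weaken (cut n) (h n 2≤n)
   where
   d = suc (suc m)
   k = suc m
   r = suc (suc (suc m))
   linear : ∀ n → n ≡ n ℕ.^ (d ∸ k)
   linear n = trans (sym (ℕ.^-identityʳ n)) (cong (n ℕ.^_) (sym (ℕ.m+n∸n≡m 1 m)))
   cut : ∀ n q → f⟨_,_⟩ d k n q → ((n ℕ.^ (d ∸ k)) ÷ᶜ root d (log n)) q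
   cut n q h = subst (λ z → (z ÷ᶜ root d (log n)) q) (linear n)
     (subst (λ (c : Cut) → c q) (if-true {b = k ≡ᵇ d ∸ 1} (ℕ.≡⇒≡ᵇ k k refl)) h)
 ... | no k≢a′ =
       let Z , h = tall-bounded (suc m) a′ m (ℕ.≤∧≢⇒< k≤a′ k≢a′) (ℕ.n≤1+n (suc m)) in
       bounded⇒Ω d k r (f⟨_,_⟩ d k) Z 1 λ n 1≤n → bounded-weaken (cut n) (h n 1≤n)
   where
   d = suc a′
   k = suc m
   r = suc (suc (suc m))
   numerator : d ≡ d ℕ.* (suc k ∸ k)
   numerator = trans (sym (ℕ.*-identityʳ d)) (cong (d ℕ.*_) (sym (ℕ.m+n∸n≡m 1 m)))
   cut : ∀ n q → f⟨_,_⟩ d k n q → PowerCut k (n ℕ.^ (d ℕ.* (suc k ∸ k))) q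
   cut n q h = cut-power (d ÷ suc k) (d ℕ.* (suc k ∸ k)) k
     (trans (/-inverse d k) (cong (λ z → ι (pos z)) numerator)) n
     (subst (λ (c : Cut) → c q) (if-false {b = k ≡ᵇ d ∸ 1} (λ t → k≢a′ (ℕ.≡ᵇ⇒≡ k a′ t))) h)

 main-general : ∀ d k r → 1 ≤ d → 1 ≤ k → 1 ≤ r → k < d → k + 2 ≤ r →
                (λ n m → f-aff[ n , d , k , r ]≡ m) =Ω f⟨_,_,_⟩ d k r
 main-general (suc a′) (suc m) r _ _ _ k<d k+2≤r with r | subst (_≤ r) (ℕ.+-comm (suc m) 2) k+2≤r
 ... | suc (suc b′) | s≤s (s≤s k≤b′) = general a′ b′ m (ℕ.m≤n⇒m≤1+n k≤b′) (ℕ.<⇒≤ k<d)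

 main-special : ∀ d k → 1 ≤ d → 1 ≤ k → k < d →
                (λ n m → f-aff[ n , d , k , k + 2 ]≡ m) =Ω f⟨_,_⟩ d k
 main-special (suc a′) (suc m) _ _ k<d =
   subst (λ r → (λ n M → f-aff[ n , suc a′ , suc m , r ]≡ M) =Ω f⟨_,_⟩ (suc a′) (suc m))
     (ℕ.+-comm 2 (suc m)) (special a′ m (ℕ.s≤s⁻¹ k<d))

open import Defs
open import Data.Nat.Base using (ℕ; _+_; _≤_; _<_)
open import Data.Product.Base using (_×_)

theorem1p1 : (∀ (d k r : ℕ) → 1 ≤ d → 1 ≤ k → 1 ≤ r → k < d → k + 2 ≤ r →
    (λ n m → f-aff[ n , d , k , r ]≡ m) =Ω f⟨ d , k , r ⟩)
    ×
    (∀ (d k : ℕ) → 1 ≤ d → 1 ≤ k → k < d →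
    (λ n m → f-aff[ n , d , k , k + 2 ]≡ m) =Ω f⟨ d , k ⟩)
theorem1p1 = Conclusion.main-general Product., Conclusion.main-special
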